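{- Let $p$ be a prime, $m\in\mathbb{N}$ with $m\ge 1$, $n=p^m$, $S=\{a\in\mathbb{Z}_n \mid \gcd(a,n)=1\}$, and $\Gamma=\mathrm{Cay}(\mathbb{Z}_n,S)$. Let $v\ge 1$ be an integer and let $K_v$ be the complete graph on $v$ vertices. Then the multicone graph $K_v\bigtriangledown\Gamma$ is DS with respect to its adjacency spectrum.
   Context: For a finite group $G$ and an inverse-closed subset $H\subseteq G$ not containing the identity, $\mathrm{Cay}(G,H)$ is the simple undirected graph with vertex set $G$ in which $x,y$ are adjacent iff $x^{ -1}y\in H$. Here $G=\mathbb{Z}_n$ is the additive cyclic group, so $x,y$ are adjacent iff $y-x\in S$. The join $\Gamma_1\bigtriangledown\Gamma_2$ is obtained from the disjoint union of $\Gamma_1$ and $\Gamma_2$ by joining every vertex of $\Gamma_1$ to every vertex of $\Gamma_2$; a multicone graph is the join of a complete graph and a regular graph. The adjacency spectrum of a finite simple graph is the multiset of eigenvalues of its adjacency matrix. A graph is DS (determined by its spectrum) with respect to its adjacency spectrum if every finite simple graph with the same adjacency spectrum is isomorphic to it. -}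

module Defs where

open import Algebra.Bundles using (CommutativeRing; Group)
import Algebra.Properties.Group as GroupProperties
import Algebra.Properties.Monoid.Sum as Sum
import Algebra.Properties.Semiring.Exp as Exp
open import Algebra.Structures using (IsGroup)
open import Data.Bool.Base using (if_then_else_)
open import Data.Fin.Base using (Fin; zero; suc; toℕ)
import Data.Fin.Properties as Fin
open import Data.List.Base using (foldr; map)
import Data.List.Relation.Binary.Permutation.Setoid as Permutation
open import Data.Nat.Base as ℕ using (ℕ; zero; suc; NonZero)
open import Data.Nat.Divisibility using (_∣_; ∣m+n∣m⇒∣n; ∣1⇒≡1; ∣n∣m%n⇒∣m)
open import Data.Nat.DivMod using (_%_; _mod_; m%n<n; m<n⇒m%n≡m; n%n≡0; %-distribˡ-+; m%n%n≡m%n)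
open import Data.Nat.GCD using (gcd; gcd[m,n]∣m; gcd[m,n]∣n; gcd-greatest; gcd-identityˡ)
import Data.Nat.Properties as ℕ
open import Data.Nat.Primality using (Prime; prime⇒nonTrivial; prime⇒nonZero)
open import Data.Product.Base using (Σ-syntax; ∃-syntax; _×_; _,_)
open import Data.Rational.Base as ℚ using (ℚ; 0ℚ; 1ℚ; ½; ∣_∣)
import Data.Rational.Properties as ℚ
open import Data.Rational.Solver using (module +-*-Solver)
open import Data.Sum.Base using (_⊎_; inj₁; inj₂)
open import Data.Unit.Base using (⊤; tt)
open import Data.Vec.Base using (Vec; toList)
open import Data.Vec.Functional using (removeAt)
open import Function.Bundles using (_↔_; _⇔_; Inverse)
open import Function.Construct.Composition using (_↔-∘_)
open import Function.Construct.Identity using (↔-id)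
open import Data.Sum.Function.Propositional using (_⊎-↔_)
open import Level using (0ℓ; _⊔_)
open import Relation.Binary.PropositionalEquality using (_≡_; _≢_; refl; sym; trans; cong; cong₂; subst; isEquivalence; module ≡-Reasoning)
open import Relation.Nullary using (¬_; Dec; yes; no; does)
open import Relation.Nullary.Decidable using (¬?)

-- Real numbers: Cauchy sequences of rationals modulo null sequences

Cauchy : (ℕ → ℚ) → Set
Cauchy x = ∀ ε → 0ℚ ℚ.< ε → ∃[ N ] (∀ m n → N ℕ.≤ m → N ℕ.≤ n → ∣ x m ℚ.- x n ∣ ℚ.< ε)

record ℝ : Set where
  constructor _,_
  field
    seq    : ℕ → ℚ
    cauchy : Cauchy seq
open ℝ

infix 4 _≈ℝ_
_≈ℝ_ : ℝ → ℝ → Set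
x ≈ℝ y = ∀ ε → 0ℚ ℚ.< ε → ∃[ N ] (∀ n → N ℕ.≤ n → ∣ seq x n ℚ.- seq y n ∣ ℚ.< ε)

private
  half-pos : ∀ {ε} → 0ℚ ℚ.< ε → 0ℚ ℚ.< ½ ℚ.* ε
  half-pos 0<ε = ℚ.*-monoʳ-<-pos ½ 0<ε

  half+half : ∀ ε → ½ ℚ.* ε ℚ.+ ½ ℚ.* ε ≡ ε
  half+half ε = trans (sym (ℚ.*-distribʳ-+ ε ½ ½)) (ℚ.*-identityˡ ε)

  ∣+∣<halves : ∀ {ε} a b → ∣ a ∣ ℚ.< ½ ℚ.* ε → ∣ b ∣ ℚ.< ½ ℚ.* ε → ∣ a ℚ.+ b ∣ ℚ.< ε
  ∣+∣<halves {ε} a b a< b< =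
    ℚ.≤-<-trans (ℚ.∣p+q∣≤∣p∣+∣q∣ a b) (subst (_ ℚ.<_) (half+half ε) (ℚ.+-mono-< a< b<))

  ∣p-p∣<ε : ∀ {ε} p → 0ℚ ℚ.< ε → ∣ p ℚ.- p ∣ ℚ.< ε
  ∣p-p∣<ε p 0<ε rewrite ℚ.+-inverseʳ p = 0<ε

  -‿flip : ∀ p q → ℚ.- (p ℚ.- q) ≡ q ℚ.- p
  -‿flip = solve 2 (λ p q → :- (p :- q) := q :- p) refl
    where open +-*-Solver

  ∣-∣-sym : ∀ p q → ∣ p ℚ.- q ∣ ≡ ∣ q ℚ.- p ∣
  ∣-∣-sym p q = trans (sym (ℚ.∣-p∣≡∣p∣ (p ℚ.- q))) (cong ∣_∣ (-‿flip p q))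

  -‿interchange : ∀ a b c d → (a ℚ.+ b) ℚ.- (c ℚ.+ d) ≡ (a ℚ.- c) ℚ.+ (b ℚ.- d)
  -‿interchange = solve 4 (λ a b c d → (a :+ b) :- (c :+ d) := (a :- c) :+ (b :- d)) refl
    where open +-*-Solver

  -‿telescope : ∀ a b c → a ℚ.- c ≡ (a ℚ.- b) ℚ.+ (b ℚ.- c)
  -‿telescope = solve 3 (λ a b c → a :- c := (a :- b) :+ (b :- c)) refl
    where open +-*-Solver

  -‿neg : ∀ a b → (ℚ.- a) ℚ.- (ℚ.- b) ≡ ℚ.- (a ℚ.- b)
  -‿neg = solve 2 (λ a b → (:- a) :- (:- b) := :- (a :- b)) refl
    where open +-*-Solver

  *-split : ∀ a b c d → a ℚ.* b ℚ.- c ℚ.* d ≡ a ℚ.* (b ℚ.- d) ℚ.+ (a ℚ.- c) ℚ.* d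
  *-split = solve 4 (λ a b c d → a :* b :- c :* d := a :* (b :- d) :+ (a :- c) :* d) refl
    where open +-*-Solver

  ≡⇒≈ : ∀ {x y} → (∀ n → seq x n ≡ seq y n) → x ≈ℝ y
  ≡⇒≈ {x} {y} eq ε 0<ε = 0 , λ n _ →
    subst (λ z → ∣ z ℚ.- seq y n ∣ ℚ.< ε) (sym (eq n)) (∣p-p∣<ε (seq y n) 0<ε)

  bounded : ∀ x → Cauchy x → ∃[ B ] (0ℚ ℚ.< B × ∃[ N ] (∀ n → N ℕ.≤ n → ∣ x n ∣ ℚ.≤ B))
  bounded x cx with cx 1ℚ (ℚ.positive⁻¹ 1ℚ)
  ... | N , close = 1ℚ ℚ.+ ∣ x N ∣ , pos , N , bd
    where
    pos : 0ℚ ℚ.< 1ℚ ℚ.+ ∣ x N ∣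
    pos = ℚ.+-mono-<-≤ (ℚ.positive⁻¹ 1ℚ) (ℚ.0≤∣p∣ (x N))
    cancel : ∀ a b → (a ℚ.- b) ℚ.+ b ≡ a
    cancel = solve 2 (λ a b → (a :- b) :+ b := a) refl where open +-*-Solver
    bd : ∀ n → N ℕ.≤ n → ∣ x n ∣ ℚ.≤ 1ℚ ℚ.+ ∣ x N ∣
    bd n N≤n = ℚ.≤-trans
      (subst (λ z → ∣ z ∣ ℚ.≤ ∣ x n ℚ.- x N ∣ ℚ.+ ∣ x N ∣) (cancel (x n) (x N))
        (ℚ.∣p+q∣≤∣p∣+∣q∣ (x n ℚ.- x N) (x N)))
      (ℚ.+-monoˡ-≤ ∣ x N ∣ (ℚ.<⇒≤ (close n N N≤n ℕ.≤-refl)))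

  shrink : ∀ B ε → 0ℚ ℚ.< B → 0ℚ ℚ.< ε → ∃[ δ ] (0ℚ ℚ.< δ × B ℚ.* δ ≡ ε)
  shrink B ε 0<B 0<ε = 1/B ℚ.* ε , pos , eq
    where
    instance
      B-pos : ℚ.Positive B
      B-pos = ℚ.positive 0<B
      B≢0 : ℚ.NonZero B
      B≢0 = ℚ.pos⇒nonZero B
    1/B = ℚ.1/ B
    instance
      1/B-pos : ℚ.Positive 1/B
      1/B-pos = ℚ.1/pos⇒pos B
    pos : 0ℚ ℚ.< 1/B ℚ.* ε
    pos = subst (ℚ._< 1/B ℚ.* ε) (ℚ.*-zeroʳ 1/B) (ℚ.*-monoʳ-<-pos 1/B 0<ε)
    eq : B ℚ.* (1/B ℚ.* ε) ≡ ε
    eq = trans (sym (ℚ.*-assoc B 1/B ε))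
         (trans (cong (ℚ._* ε) (ℚ.*-inverseʳ B)) (ℚ.*-identityˡ ε))

  ∣*∣<half : ∀ {B δ h} a b → 0ℚ ℚ.< B → B ℚ.* δ ≡ h → ∣ a ∣ ℚ.≤ B → ∣ b ∣ ℚ.< δ →
             ∣ a ℚ.* b ∣ ℚ.< h
  ∣*∣<half {B} {δ} a b 0<B refl a≤ b< = begin-strict
    ∣ a ℚ.* b ∣     ≡⟨ ℚ.∣p*q∣≡∣p∣*∣q∣ a b ⟩
    ∣ a ∣ ℚ.* ∣ b ∣ ≤⟨ ℚ.*-monoʳ-≤-nonNeg ∣ b ∣ {{ℚ.∣-∣-nonNeg b}} a≤ ⟩
    B ℚ.* ∣ b ∣     <⟨ ℚ.*-monoʳ-<-pos B {{ℚ.positive 0<B}} b< ⟩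
    B ℚ.* δ         ∎
    where open ℚ.≤-Reasoning

  ∣*-*∣< : ∀ {B C δ η ε} a b c d → 0ℚ ℚ.< B → 0ℚ ℚ.< C →
           B ℚ.* δ ≡ ½ ℚ.* ε → C ℚ.* η ≡ ½ ℚ.* ε →
           ∣ a ∣ ℚ.≤ B → ∣ d ∣ ℚ.≤ C → ∣ b ℚ.- d ∣ ℚ.< δ → ∣ a ℚ.- c ∣ ℚ.< η →
           ∣ a ℚ.* b ℚ.- c ℚ.* d ∣ ℚ.< ε
  ∣*-*∣< {ε = ε} a b c d 0<B 0<C Bδ Cη a≤ d≤ b-d a-c =
    subst (λ z → ∣ z ∣ ℚ.< ε) (sym (*-split a b c d))
      (∣+∣<halves (a ℚ.* (b ℚ.- d)) ((a ℚ.- c) ℚ.* d)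
        (∣*∣<half a (b ℚ.- d) 0<B Bδ a≤ b-d)
        (subst (λ z → ∣ z ∣ ℚ.< ½ ℚ.* ε) (ℚ.*-comm d (a ℚ.- c))
          (∣*∣<half d (a ℚ.- c) 0<C Cη d≤ a-c)))

  ⊔ˡ : ∀ {m n o} → m ℕ.⊔ n ℕ.≤ o → m ℕ.≤ o
  ⊔ˡ {m} {n} = ℕ.m⊔n≤o⇒m≤o m n
  ⊔ʳ : ∀ {m n o} → m ℕ.⊔ n ℕ.≤ o → n ℕ.≤ o
  ⊔ʳ {m} {n} = ℕ.m⊔n≤o⇒n≤o m n

fromℚ : ℚ → ℝ
fromℚ q = (λ _ → q) , λ ε 0<ε → 0 , λ _ _ _ _ → ∣p-p∣<ε q 0<ε

0ℝ 1ℝ : ℝ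
0ℝ = fromℚ 0ℚ
1ℝ = fromℚ 1ℚ

infixl 6 _+ℝ_
infixl 7 _*ℝ_
infix  8 -ℝ_

_+ℝ_ : ℝ → ℝ → ℝ
seq (x +ℝ y) n = seq x n ℚ.+ seq y n
cauchy (x +ℝ y) ε 0<ε with cauchy x (½ ℚ.* ε) (half-pos 0<ε) | cauchy y (½ ℚ.* ε) (half-pos 0<ε)
... | M , p | N , q = M ℕ.⊔ N , λ m n ≤m ≤n →
  subst (λ z → ∣ z ∣ ℚ.< ε) (sym (-‿interchange (seq x m) (seq y m) (seq x n) (seq y n)))
    (∣+∣<halves (seq x m ℚ.- seq x n) (seq y m ℚ.- seq y n)
      (p m n (⊔ˡ ≤m) (⊔ˡ ≤n)) (q m n (⊔ʳ {M} ≤m) (⊔ʳ {M} ≤n)))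

-ℝ_ : ℝ → ℝ
seq (-ℝ x) n = ℚ.- seq x n
cauchy (-ℝ x) ε 0<ε with cauchy x ε 0<ε
... | N , p = N , λ m n ≤m ≤n →
  subst (ℚ._< ε)
    (sym (trans (cong ∣_∣ (-‿neg (seq x m) (seq x n))) (ℚ.∣-p∣≡∣p∣ (seq x m ℚ.- seq x n))))
    (p m n ≤m ≤n)

_*ℝ_ : ℝ → ℝ → ℝ
seq (x *ℝ y) n = seq x n ℚ.* seq y n
cauchy (x *ℝ y) ε 0<ε =
  let B , 0<B , M₁ , x≤B = bounded (seq x) (cauchy x)
      C , 0<C , M₂ , y≤C = bounded (seq y) (cauchy y)
      δ , 0<δ , Bδ = shrink B (½ ℚ.* ε) 0<B (half-pos 0<ε)
      η , 0<η , Cη = shrink C (½ ℚ.* ε) 0<C (half-pos 0<ε)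
      M₃ , q = cauchy y δ 0<δ
      M₄ , p = cauchy x η 0<η
  in (M₁ ℕ.⊔ M₂) ℕ.⊔ (M₃ ℕ.⊔ M₄) , λ m n ≤m ≤n →
     ∣*-*∣< (seq x m) (seq y m) (seq x n) (seq y n) 0<B 0<C Bδ Cη
       (x≤B m (⊔ˡ (⊔ˡ {M₁ ℕ.⊔ M₂} ≤m)))
       (y≤C n (⊔ʳ {M₁} (⊔ˡ {M₁ ℕ.⊔ M₂} ≤n)))
       (q m n (⊔ˡ (⊔ʳ {M₁ ℕ.⊔ M₂} ≤m)) (⊔ˡ (⊔ʳ {M₁ ℕ.⊔ M₂} ≤n)))
       (p m n (⊔ʳ {M₃} (⊔ʳ {M₁ ℕ.⊔ M₂} ≤m)) (⊔ʳ {M₃} (⊔ʳ {M₁ ℕ.⊔ M₂} ≤n)))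

private
  ≈ℝ-refl : ∀ {x} → x ≈ℝ x
  ≈ℝ-refl {x} = ≡⇒≈ {x} {x} (λ _ → refl)

  ≈ℝ-sym : ∀ {x y} → x ≈ℝ y → y ≈ℝ x
  ≈ℝ-sym {x} {y} x≈y ε 0<ε with x≈y ε 0<ε
  ... | N , p = N , λ n ≤n → subst (ℚ._< ε) (∣-∣-sym (seq x n) (seq y n)) (p n ≤n)

  ≈ℝ-trans : ∀ {x y z} → x ≈ℝ y → y ≈ℝ z → x ≈ℝ z
  ≈ℝ-trans {x} {y} {z} x≈y y≈z ε 0<ε
    with x≈y (½ ℚ.* ε) (half-pos 0<ε) | y≈z (½ ℚ.* ε) (half-pos 0<ε)
  ... | M , p | N , q = M ℕ.⊔ N , λ n ≤n →
    subst (λ w → ∣ w ∣ ℚ.< ε) (sym (-‿telescope (seq x n) (seq y n) (seq z n)))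
      (∣+∣<halves (seq x n ℚ.- seq y n) (seq y n ℚ.- seq z n) (p n (⊔ˡ ≤n)) (q n (⊔ʳ {M} ≤n)))

  +ℝ-cong : ∀ {x x′ y y′} → x ≈ℝ x′ → y ≈ℝ y′ → x +ℝ y ≈ℝ x′ +ℝ y′
  +ℝ-cong {x} {x′} {y} {y′} x≈ y≈ ε 0<ε
    with x≈ (½ ℚ.* ε) (half-pos 0<ε) | y≈ (½ ℚ.* ε) (half-pos 0<ε)
  ... | M , p | N , q = M ℕ.⊔ N , λ n ≤n →
    subst (λ z → ∣ z ∣ ℚ.< ε) (sym (-‿interchange (seq x n) (seq y n) (seq x′ n) (seq y′ n)))
      (∣+∣<halves (seq x n ℚ.- seq x′ n) (seq y n ℚ.- seq y′ n) (p n (⊔ˡ ≤n)) (q n (⊔ʳ {M} ≤n)))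

  -ℝ-cong : ∀ {x y} → x ≈ℝ y → -ℝ x ≈ℝ -ℝ y
  -ℝ-cong {x} {y} x≈y ε 0<ε with x≈y ε 0<ε
  ... | N , p = N , λ n ≤n →
    subst (ℚ._< ε)
      (sym (trans (cong ∣_∣ (-‿neg (seq x n) (seq y n))) (ℚ.∣-p∣≡∣p∣ (seq x n ℚ.- seq y n))))
      (p n ≤n)

  *ℝ-cong : ∀ {x x′ y y′} → x ≈ℝ x′ → y ≈ℝ y′ → x *ℝ y ≈ℝ x′ *ℝ y′
  *ℝ-cong {x} {x′} {y} {y′} x≈ y≈ ε 0<ε =
    let B , 0<B , M₁ , x≤B = bounded (seq x) (cauchy x)
        C , 0<C , M₂ , y≤C = bounded (seq y′) (cauchy y′)
        δ , 0<δ , Bδ = shrink B (½ ℚ.* ε) 0<B (half-pos 0<ε)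
        η , 0<η , Cη = shrink C (½ ℚ.* ε) 0<C (half-pos 0<ε)
        M₃ , q = y≈ δ 0<δ
        M₄ , p = x≈ η 0<η
    in (M₁ ℕ.⊔ M₂) ℕ.⊔ (M₃ ℕ.⊔ M₄) , λ n ≤n →
       ∣*-*∣< (seq x n) (seq y n) (seq x′ n) (seq y′ n) 0<B 0<C Bδ Cη
         (x≤B n (⊔ˡ (⊔ˡ {M₁ ℕ.⊔ M₂} ≤n)))
         (y≤C n (⊔ʳ {M₁} (⊔ˡ {M₁ ℕ.⊔ M₂} ≤n)))
         (q n (⊔ˡ (⊔ʳ {M₁ ℕ.⊔ M₂} ≤n)))
         (p n (⊔ʳ {M₃} (⊔ʳ {M₁ ℕ.⊔ M₂} ≤n)))

ℝ-commutativeRing : CommutativeRing 0ℓ 0ℓ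
ℝ-commutativeRing = record
  { Carrier = ℝ ; _≈_ = _≈ℝ_ ; _+_ = _+ℝ_ ; _*_ = _*ℝ_ ; -_ = -ℝ_ ; 0# = 0ℝ ; 1# = 1ℝ
  ; isCommutativeRing = record
    { isRing = record
      { +-isAbelianGroup = record
        { isGroup = record
          { isMonoid = record
            { isSemigroup = record
              { isMagma = record
                { isEquivalence = record
                  { refl  = λ {x} → ≈ℝ-refl {x}
                  ; sym   = λ {x} {y} → ≈ℝ-sym {x} {y}
                  ; trans = λ {x} {y} {z} → ≈ℝ-trans {x} {y} {z}
                  }
                ; ∙-cong = λ {x} {x′} {y} {y′} → +ℝ-cong {x} {x′} {y} {y′}
                }
              ; assoc = λ x y z → ≡⇒≈ {(x +ℝ y) +ℝ z} {x +ℝ (y +ℝ z)}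
                  λ n → ℚ.+-assoc (seq x n) (seq y n) (seq z n)
              }
            ; identity = (λ x → ≡⇒≈ {0ℝ +ℝ x} {x} λ n → ℚ.+-identityˡ (seq x n))
                       , (λ x → ≡⇒≈ {x +ℝ 0ℝ} {x} λ n → ℚ.+-identityʳ (seq x n))
            }
          ; inverse = (λ x → ≡⇒≈ { -ℝ x +ℝ x} {0ℝ} λ n → ℚ.+-inverseˡ (seq x n))
                    , (λ x → ≡⇒≈ {x +ℝ -ℝ x} {0ℝ} λ n → ℚ.+-inverseʳ (seq x n))
          ; ⁻¹-cong = λ {x} {y} → -ℝ-cong {x} {y}
          }
        ; comm = λ x y → ≡⇒≈ {x +ℝ y} {y +ℝ x} λ n → ℚ.+-comm (seq x n) (seq y n)
        }
      ; *-cong = λ {x} {x′} {y} {y′} → *ℝ-cong {x} {x′} {y} {y′}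
      ; *-assoc = λ x y z → ≡⇒≈ {(x *ℝ y) *ℝ z} {x *ℝ (y *ℝ z)}
          λ n → ℚ.*-assoc (seq x n) (seq y n) (seq z n)
      ; *-identity = (λ x → ≡⇒≈ {1ℝ *ℝ x} {x} λ n → ℚ.*-identityˡ (seq x n))
                   , (λ x → ≡⇒≈ {x *ℝ 1ℝ} {x} λ n → ℚ.*-identityʳ (seq x n))
      ; distrib = (λ x y z → ≡⇒≈ {x *ℝ (y +ℝ z)} {x *ℝ y +ℝ x *ℝ z}
                     λ n → ℚ.*-distribˡ-+ (seq x n) (seq y n) (seq z n))
                , (λ x y z → ≡⇒≈ {(y +ℝ z) *ℝ x} {y *ℝ x +ℝ z *ℝ x}
                     λ n → ℚ.*-distribʳ-+ (seq x n) (seq y n) (seq z n))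
      }
    ; *-comm = λ x y → ≡⇒≈ {x *ℝ y} {y *ℝ x} λ n → ℚ.*-comm (seq x n) (seq y n)
    }
  }

module Matrices {c ℓ} (R : CommutativeRing c ℓ) where
  open CommutativeRing R hiding (zero)
  open Sum +-monoid using (sum)
  open Exp semiring using (_^_)

  Matrix : ℕ → Set c
  Matrix n = Fin n → Fin n → Carrier

  det : ∀ {n} → Matrix n → Carrier
  det {zero}  M = 1#
  det {suc n} M = sum λ j →
    (- 1#) ^ toℕ j * (M zero j * det (λ i → removeAt (M (suc i)) j))

  scalar : ∀ {n} → Carrier → Matrix n
  scalar x i j = if does (i Fin.≟ j) then x else 0#

  charPoly : ∀ {n} → Matrix n → Carrier → Carrier
  charPoly A x = det (λ i j → scalar x i j - A i j)

  -- λs lists the eigenvalues of A with (algebraic) multiplicity: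
  -- det (xI - A) = (x - λ₁) ⋯ (x - λₙ), as polynomial functions of x.
  IsSpectrum : ∀ {n} → Matrix n → Vec Carrier n → Set (c ⊔ ℓ)
  IsSpectrum A λs = ∀ x →
    charPoly A x ≈ foldr _*_ 1# (map (λ μ → x - μ) (toList λs))

open Matrices ℝ-commutativeRing public

record Graph : Set₁ where
  infix 4 _~_ _~?_
  field
    Vertex   : Set
    order    : ℕ
    enum     : Fin order ↔ Vertex
    _~_      : Vertex → Vertex → Set
    _~?_     : ∀ x y → Dec (x ~ y)
    ~-sym    : ∀ {x y} → x ~ y → y ~ x
    ~-irrefl : ∀ {x} → ¬ (x ~ x)

  -- The ordering of the vertices is that of enum; the spectrum does not
  -- depend on it.
  adjacencyMatrix : Matrix order
  adjacencyMatrix i j = if does (Inverse.to enum i ~? Inverse.to enum j) then 1ℝ else 0ℝ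

infix 4 _≅_
_≅_ : Graph → Graph → Set
G ≅ H = Σ[ f ∈ G.Vertex ↔ H.Vertex ]
          (∀ x y → (x G.~ y) ⇔ (Inverse.to f x H.~ Inverse.to f y))
  where
  module G = Graph G
  module H = Graph H

-- Multisets of reals are lists up to permutation and ≈ℝ.
open Permutation (CommutativeRing.setoid ℝ-commutativeRing) using (_↭_)

Cospectral : Graph → Graph → Set
Cospectral G H =
  ∃[ λs ] ∃[ μs ] (IsSpectrum (Graph.adjacencyMatrix G) λs
                 × IsSpectrum (Graph.adjacencyMatrix H) μs
                 × toList λs ↭ toList μs)

DS : Graph → Set₁
DS G = ∀ H → Cospectral H G → H ≅ G

K : ℕ → Graph
K n = record
  { Vertex   = Fin n
  ; order    = n
  ; enum     = ↔-id (Fin n)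
  ; _~_      = _≢_
  ; _~?_     = λ x y → ¬? (x Fin.≟ y)
  ; ~-sym    = λ x≢y y≡x → x≢y (sym y≡x)
  ; ~-irrefl = λ x≢x → x≢x refl
  }

infixl 6 _▽_
_▽_ : Graph → Graph → Graph
G ▽ H = record
  { Vertex   = G.Vertex ⊎ H.Vertex
  ; order    = G.order ℕ.+ H.order
  ; enum     = (G.enum ⊎-↔ H.enum) ↔-∘ Fin.+↔⊎
  ; _~_      = Adj
  ; _~?_     = adj?
  ; ~-sym    = λ {x} {y} → adj-sym x y
  ; ~-irrefl = λ {x} → adj-irrefl x
  }
  where
  module G = Graph G
  module H = Graph H

  Adj : G.Vertex ⊎ H.Vertex → G.Vertex ⊎ H.Vertex → Set
  Adj (inj₁ x) (inj₁ y) = x G.~ y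
  Adj (inj₁ _) (inj₂ _) = ⊤
  Adj (inj₂ _) (inj₁ _) = ⊤
  Adj (inj₂ x) (inj₂ y) = x H.~ y

  adj? : ∀ x y → Dec (Adj x y)
  adj? (inj₁ x) (inj₁ y) = x G.~? y
  adj? (inj₁ _) (inj₂ _) = yes tt
  adj? (inj₂ _) (inj₁ _) = yes tt
  adj? (inj₂ x) (inj₂ y) = x H.~? y

  adj-sym : ∀ x y → Adj x y → Adj y x
  adj-sym (inj₁ x) (inj₁ y) = G.~-sym
  adj-sym (inj₁ _) (inj₂ _) _ = tt
  adj-sym (inj₂ _) (inj₁ _) _ = tt
  adj-sym (inj₂ x) (inj₂ y) = H.~-sym

  adj-irrefl : ∀ x → ¬ Adj x x
  adj-irrefl (inj₁ x) = G.~-irrefl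
  adj-irrefl (inj₂ x) = H.~-irrefl

record FiniteGroup : Set₁ where
  infixl 7 _∙_
  infix  8 _⁻¹
  field
    Carrier : Set
    order   : ℕ
    enum    : Fin order ↔ Carrier
    _∙_     : Carrier → Carrier → Carrier
    ε       : Carrier
    _⁻¹     : Carrier → Carrier
    isGroup : IsGroup _≡_ _∙_ ε _⁻¹

  group : Group 0ℓ 0ℓ
  group = record { isGroup = isGroup }

record ConnectionSet (G : FiniteGroup) : Set₁ where
  open FiniteGroup G
  field
    ∈H        : Carrier → Set
    ∈H?       : ∀ a → Dec (∈H a)
    ⁻¹-closed : ∀ {a} → ∈H a → ∈H (a ⁻¹)
    ε∉H       : ¬ ∈H ε

Cay : (G : FiniteGroup) → ConnectionSet G → Graph
Cay G H = record
  { Vertex   = Carrier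
  ; order    = order
  ; enum     = enum
  ; _~_      = λ x y → ∈H (x ⁻¹ ∙ y)
  ; _~?_     = λ x y → ∈H? (x ⁻¹ ∙ y)
  ; ~-sym    = λ {x} {y} h → subst ∈H (flip x y) (⁻¹-closed h)
  ; ~-irrefl = λ {x} h → ε∉H (subst ∈H (inverseˡ x) h)
  }
  where
  open FiniteGroup G
  open ConnectionSet H
  open IsGroup isGroup using (inverseˡ)
  open GroupProperties group using (⁻¹-anti-homo-∙; ⁻¹-involutive)

  flip : ∀ x y → (x ⁻¹ ∙ y) ⁻¹ ≡ y ⁻¹ ∙ x
  flip x y = trans (⁻¹-anti-homo-∙ (x ⁻¹) y) (cong (y ⁻¹ ∙_) (⁻¹-involutive x))

module _ (n : ℕ) .{{_ : NonZero n}} where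

  private
    _⊕_ : Fin n → Fin n → Fin n
    i ⊕ j = (toℕ i ℕ.+ toℕ j) mod n

    0ₙ : Fin n
    0ₙ = 0 mod n

    ⊖_ : Fin n → Fin n
    ⊖ i = (n ℕ.∸ toℕ i) mod n

    toℕ-mod : ∀ a → toℕ (a mod n) ≡ a % n
    toℕ-mod a = Fin.toℕ-fromℕ< (m%n<n a n)

    %-fixed : ∀ (i : Fin n) → toℕ i % n ≡ toℕ i
    %-fixed i = m<n⇒m%n≡m (Fin.toℕ<n i)

    toℕ-0ₙ : toℕ 0ₙ ≡ 0
    toℕ-0ₙ = trans (toℕ-mod 0) (m<n⇒m%n≡m (ℕ.>-nonZero⁻¹ n))

    absorbˡ : ∀ a b → (a % n ℕ.+ b) % n ≡ (a ℕ.+ b) % n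
    absorbˡ a b = begin
      (a % n ℕ.+ b) % n             ≡⟨ %-distribˡ-+ (a % n) b n ⟩
      (a % n % n ℕ.+ b % n) % n     ≡⟨ cong (λ z → (z ℕ.+ b % n) % n) (m%n%n≡m%n a n) ⟩
      (a % n ℕ.+ b % n) % n         ≡⟨ %-distribˡ-+ a b n ⟨
      (a ℕ.+ b) % n                 ∎
      where open ≡-Reasoning

    absorbʳ : ∀ a b → (a ℕ.+ b % n) % n ≡ (a ℕ.+ b) % n
    absorbʳ a b = begin
      (a ℕ.+ b % n) % n ≡⟨ cong (_% n) (ℕ.+-comm a (b % n)) ⟩
      (b % n ℕ.+ a) % n ≡⟨ absorbˡ b a ⟩
      (b ℕ.+ a) % n     ≡⟨ cong (_% n) (ℕ.+-comm b a) ⟩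
      (a ℕ.+ b) % n     ∎
      where open ≡-Reasoning

    ⊕-comm : ∀ i j → i ⊕ j ≡ j ⊕ i
    ⊕-comm i j = cong (_mod n) (ℕ.+-comm (toℕ i) (toℕ j))

    ⊕-assoc : ∀ i j k → (i ⊕ j) ⊕ k ≡ i ⊕ (j ⊕ k)
    ⊕-assoc i j k = Fin.toℕ-injective (begin
      toℕ ((i ⊕ j) ⊕ k)                         ≡⟨ toℕ-mod _ ⟩
      (toℕ (i ⊕ j) ℕ.+ toℕ k) % n               ≡⟨ cong (λ z → (z ℕ.+ toℕ k) % n) (toℕ-mod _) ⟩
      ((toℕ i ℕ.+ toℕ j) % n ℕ.+ toℕ k) % n     ≡⟨ absorbˡ (toℕ i ℕ.+ toℕ j) (toℕ k) ⟩
      (toℕ i ℕ.+ toℕ j ℕ.+ toℕ k) % n           ≡⟨ cong (_% n) (ℕ.+-assoc (toℕ i) (toℕ j) (toℕ k)) ⟩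
      (toℕ i ℕ.+ (toℕ j ℕ.+ toℕ k)) % n         ≡⟨ absorbʳ (toℕ i) (toℕ j ℕ.+ toℕ k) ⟨
      (toℕ i ℕ.+ (toℕ j ℕ.+ toℕ k) % n) % n     ≡⟨ cong (λ z → (toℕ i ℕ.+ z) % n) (toℕ-mod _) ⟨
      (toℕ i ℕ.+ toℕ (j ⊕ k)) % n               ≡⟨ toℕ-mod _ ⟨
      toℕ (i ⊕ (j ⊕ k))                         ∎)
      where open ≡-Reasoning

    ⊕-identityˡ : ∀ i → 0ₙ ⊕ i ≡ i
    ⊕-identityˡ i = Fin.toℕ-injective (begin
      toℕ (0ₙ ⊕ i)             ≡⟨ toℕ-mod _ ⟩
      (toℕ 0ₙ ℕ.+ toℕ i) % n   ≡⟨ cong (λ z → (z ℕ.+ toℕ i) % n) toℕ-0ₙ ⟩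
      toℕ i % n                ≡⟨ %-fixed i ⟩
      toℕ i                    ∎)
      where open ≡-Reasoning

    ⊕-inverseˡ : ∀ i → (⊖ i) ⊕ i ≡ 0ₙ
    ⊕-inverseˡ i = Fin.toℕ-injective (begin
      toℕ ((⊖ i) ⊕ i)                     ≡⟨ toℕ-mod _ ⟩
      (toℕ (⊖ i) ℕ.+ toℕ i) % n           ≡⟨ cong (λ z → (z ℕ.+ toℕ i) % n) (toℕ-mod _) ⟩
      ((n ℕ.∸ toℕ i) % n ℕ.+ toℕ i) % n   ≡⟨ absorbˡ (n ℕ.∸ toℕ i) (toℕ i) ⟩
      (n ℕ.∸ toℕ i ℕ.+ toℕ i) % n         ≡⟨ cong (_% n) (ℕ.m∸n+n≡m (ℕ.<⇒≤ (Fin.toℕ<n i))) ⟩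
      n % n                               ≡⟨ n%n≡0 n ⟩
      0                                   ≡⟨ toℕ-0ₙ ⟨
      toℕ 0ₙ                              ∎)
      where open ≡-Reasoning

  ℤₙ : FiniteGroup
  ℤₙ = record
    { Carrier = Fin n
    ; order   = n
    ; enum    = ↔-id (Fin n)
    ; _∙_     = _⊕_
    ; ε       = 0ₙ
    ; _⁻¹     = ⊖_
    ; isGroup = record
      { isMonoid = record
        { isSemigroup = record
          { isMagma = record { isEquivalence = isEquivalence ; ∙-cong = cong₂ _⊕_ }
          ; assoc   = ⊕-assoc
          }
        ; identity = ⊕-identityˡ , λ i → trans (⊕-comm i 0ₙ) (⊕-identityˡ i)
        }
      ; inverse = ⊕-inverseˡ , λ i → trans (⊕-comm i (⊖ i)) (⊕-inverseˡ i)
      ; ⁻¹-cong = cong ⊖_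
      }
    }

  -- n ≢ 1 is what makes 0 a non-unit.
  units : n ≢ 1 → ConnectionSet ℤₙ
  units n≢1 = record
    { ∈H        = λ a → gcd (toℕ a) n ≡ 1
    ; ∈H?       = λ a → gcd (toℕ a) n ℕ.≟ 1
    ; ⁻¹-closed = λ {a} → closed a
    ; ε∉H       = λ h → n≢1 (trans (sym (gcd-identityˡ n)) (subst (λ z → gcd z n ≡ 1) toℕ-0ₙ h))
    }
    where
    closed : ∀ a → gcd (toℕ a) n ≡ 1 → gcd (toℕ (⊖ a)) n ≡ 1
    closed a h = ∣1⇒≡1 (subst (d ∣_) h (gcd-greatest d∣a d∣n))
      where
      d = gcd (toℕ (⊖ a)) n
      d∣n : d ∣ n
      d∣n = gcd[m,n]∣n (toℕ (⊖ a)) n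
      d∣n∸a : d ∣ n ℕ.∸ toℕ a
      d∣n∸a = ∣n∣m%n⇒∣m d∣n (subst (d ∣_) (toℕ-mod _) (gcd[m,n]∣m (toℕ (⊖ a)) n))
      d∣a : d ∣ toℕ a
      d∣a = ∣m+n∣m⇒∣n (subst (d ∣_) (sym (ℕ.m∸n+n≡m (ℕ.<⇒≤ (Fin.toℕ<n a)))) d∣n) d∣n∸a

primePower-nonZero : ∀ {p} m → Prime p → NonZero (p ℕ.^ m)
primePower-nonZero {p} m pp = ℕ.m^n≢0 p m {{prime⇒nonZero pp}}

primePower≢1 : ∀ {p m} → Prime p → 1 ℕ.≤ m → p ℕ.^ m ≢ 1
primePower≢1 {p} {suc m} pp _ eq =
  ℕ.nonTrivial⇒≢1 {{prime⇒nonTrivial pp}} (ℕ.m*n≡1⇒m≡1 p (p ℕ.^ m) eq)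

Γ : ∀ p m → Prime p → 1 ℕ.≤ m → Graph
Γ p m pp 1≤m = Cay (ℤₙ n) (units n (primePower≢1 pp 1≤m))
  where
  n = p ℕ.^ m
  instance
    n≢0 : NonZero n
    n≢0 = primePower-nonZero m pp

{-# OPTIONS --safe #-}

-- Γ is the complete p-partite graph with parts of size q = p^(m-1), so K_v ▽ Γ is the
-- complete multipartite graph G with v parts of size 1 and p parts of size q.
--
-- For y ≠ 0, det (I - y A) = yⁿ det (y⁻¹ I - A), so cospectral graphs have the same integer
-- polynomial det (I - y A).  Expanding it row by row shows that it determines all traces
-- tr Aᵏ, hence tr f(A) for every polynomial f; and if f annihilates the adjacency matrix of
-- G it annihilates that of a cospectral graph H, because f(A) is symmetric and tr f(A)² = 0.
--
-- The eigenvalues of G are 0, -1, -q and the roots λ₁ > 0 > λ₂ of F = X² - s X - d.  A suitable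
-- multiple E of the projection onto the λ₁- and λ₂-eigenvectors is a polynomial in A of
-- rank 2 (a trace condition), and A - A E / N is negative semidefinite, N being that multiple;
-- since λ₁ λ₂ < 0, the quadratic form of A has no positive definite plane.  Hence (Smith) in
-- H a vertex with a neighbour is adjacent to an end of every edge: H is complete multipartite
-- up to t isolated vertices.
--
-- If p ≥ 3, the eigenvalue -q has multiplicity p - 1 ≥ 2, which forces p parts of size q in
-- H, and the number of edges does the rest.  If p = 2, the eigenvalue -1 yields v parts of
-- size 1 (or v = 1 and there is no such part); then the numbers of edges and triangles give a
-- vanishing sum of nonnegative terms, whence t = 0 and all other parts have size q (or a
-- contradiction).  When q = 1 the graph is complete and the number of edges suffices.

module Submission where

open import Defs hiding (Matrix; det; scalar)
open import Algebra.Bundles using (CommutativeRing)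
import Algebra.Properties.Semiring.Exp as Exp
import Algebra.Properties.Semiring.Sum as Sum
import Algebra.Solver.Ring as RingSolver
open import Algebra.Solver.Ring.AlmostCommutativeRing using (fromCommutativeRing; _-Raw-AlmostCommutative⟶_)
open import Data.Bool.Base using (if_then_else_; Bool; true; false; not; _∧_)
import Data.Bool.Properties as Bool
open import Data.Empty using (⊥-elim; ⊥)
open import Data.Fin.Base using (Fin; zero; suc; toℕ; punchIn; splitAt; _↑ˡ_; _↑ʳ_)
import Data.Fin.Properties as Fin
import Data.Integer.Base as ℤ
import Data.Integer.Properties as ℤ
open import Data.Integer.Tactic.RingSolver using (solve-∀)
import Data.List.Relation.Binary.Permutation.Setoid as Permutation
import Data.List.Relation.Binary.Permutation.Setoid.Properties as PermutationProperties
open import Data.Maybe.Base using (Maybe; just; nothing)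
open import Data.Nat.Base as ℕ using (ℕ; zero; suc; s≤s; z≤n; NonZero)
open import Data.Nat.Coprimality as Coprimality using (Coprime; coprime-divisor)
open import Data.Nat.DivMod using (_%_; _mod_; m%n<n; m<n⇒m%n≡m; [m+n]%n≡m%n; %-distribˡ-+; m∣n⇒o%n%m≡o%m; m%n%n≡m%n)
open import Data.Nat.Divisibility using (_∣_; ∣-trans; ∣1⇒≡1; m∣m*n; m%n≡0⇒n∣m; n∣m⇒m%n≡0)
open import Data.Nat.GCD using (gcd; gcd[m,n]∣m; gcd[m,n]∣n; gcd-greatest)
open import Data.Nat.Primality using (Prime; prime⇒irreducible; prime⇒nonZero; prime⇒nonTrivial)
import Data.Nat.Properties as ℕ
open import Data.Product.Base using (Σ-syntax; ∃-syntax; _×_; _,_; proj₁; proj₂)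
open import Data.Rational.Base as ℚ using (ℚ; 0ℚ; 1ℚ; mkℚ)
import Data.Rational.Properties as ℚ
open import Data.Rational.Unnormalised.Base as ℚᵘ using (*≡*)
import Data.Rational.Unnormalised.Properties as ℚᵘ
open import Data.Sum.Base using (_⊎_; inj₁; inj₂; [_,_]′)
open import Data.Vec.Base as Vec using (Vec; toList)
open import Data.Vec.Functional using (removeAt)
import Data.Vec.Properties as Vec
open import Function.Base using (_∘_)
open import Function.Bundles using (Inverse; _↔_; mk↔ₛ′; mk⇔)
open import Function.Construct.Composition using (_↔-∘_)
open import Function.Construct.Symmetry using (↔-sym)
open import Level using (0ℓ)
open import Relation.Binary.Definitions using (tri<; tri≈; tri>)
open import Relation.Binary.PropositionalEquality using (_≡_; _≢_; _≗_; refl; sym; trans; cong; cong₂; subst; module ≡-Reasoning; subst₂)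
import Relation.Binary.Reasoning.Setoid as SetoidReasoning
open import Relation.Nullary using (¬_; Dec; yes; no; does)
open import Relation.Nullary.Decidable using (dec-true; dec-false)

-- The roots λ₁ and λ₂ are irrational in general, and equality and order of the reals are
-- undecidable, so no eigenvector for them is ever formed: after the passage to traces everything
-- takes place in ℤ. Spectral projections appear as integral multiples that are polynomials in A,
-- and statements about dimensions become the vanishing of a sum of squares of integers: of the
-- entries of p(A) for an annihilator p, of the entries of Λ²M + d Λ²E for rank 2. The product h(X)
-- h(s - X) is invariant under X ↦ s - X, which exchanges λ₁ and λ₂; hence its values at both are
-- one integer N.
--
-- Isolated vertices contribute nothing to the quadratic form, so the argument with the positive
-- plane cannot exclude them; they remain until the edges, and for p = 2 also the triangles, are
-- counted. The case p = 2 is separate because -q is then a simple eigenvalue, and a complete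
-- multipartite graph may have a simple eigenvalue -q without having a part of size q.

-- Determinants over ℤ as multilinear alternating functions of the rows

module Determinants where

  open import Data.Integer.Base using (ℤ; +_; _+_; _*_; -_; _-_; 0ℤ; 1ℤ; ∣_∣)

  open import Algebra.Properties.Semiring.Sum ℤ.+-*-semiring public
    using (sum; sum-cong-≗; ∑-distrib-+; ∑-comm; *-distribˡ-sum; *-distribʳ-sum)
  open import Algebra.Properties.AbelianGroup ℤ.+-0-abelianGroup public
    using () renaming (∙-cancelˡ to +-cancelˡ; ∙-cancelʳ to +-cancelʳ)
  open Matrices ℤ.+-*-commutativeRing public using (Matrix; det)
  open Exp ℤ.+-*-semiring using (_^_)
  open ≡-Reasoning

  sum-zero : ∀ {n} {f : Fin n → ℤ} → (∀ i → f i ≡ 0ℤ) → sum f ≡ 0ℤ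
  sum-zero {zero}  f≡0 = refl
  sum-zero {suc n} f≡0 = cong₂ _+_ (f≡0 zero) (sum-zero (f≡0 ∘ suc))

  sum-only : ∀ {n} (f : Fin n → ℤ) i → (∀ k → k ≢ i → f k ≡ 0ℤ) → sum f ≡ f i
  sum-only f zero    f≡0 =
    trans (cong (λ z → f zero + z) (sum-zero λ k → f≡0 (suc k) λ ())) (ℤ.+-identityʳ (f zero))
  sum-only f (suc i) f≡0 = trans
    (cong₂ _+_ (f≡0 zero λ ()) (sum-only (f ∘ suc) i λ k k≢i → f≡0 (suc k) (k≢i ∘ Fin.suc-injective)))
    (ℤ.+-identityˡ (f (suc i)))

  sum-lin : ∀ {n} a b (f g : Fin n → ℤ) → sum (λ i → a * f i + b * g i) ≡ a * sum f + b * sum g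
  sum-lin a b f g = trans (∑-distrib-+ (λ i → a * f i) (λ i → b * g i))
    (sym (cong₂ _+_ (*-distribˡ-sum a f) (*-distribˡ-sum b g)))

  -- The identity matrix; `δ i` also serves as the i-th standard basis vector.
  δ : ∀ {n} → Fin n → Fin n → ℤ
  δ i j = if does (i Fin.≟ j) then 1ℤ else 0ℤ

  δ-refl : ∀ {n} (i : Fin n) → δ i i ≡ 1ℤ
  δ-refl i with i Fin.≟ i
  ... | yes _  = refl
  ... | no i≢i = ⊥-elim (i≢i refl)

  δ-≢ : ∀ {n} {i j : Fin n} → i ≢ j → δ i j ≡ 0ℤ
  δ-≢ {i = i} {j} i≢j with i Fin.≟ j
  ... | yes i≡j = ⊥-elim (i≢j i≡j)
  ... | no _    = refl

  δ-sym : ∀ {n} (i j : Fin n) → δ i j ≡ δ j i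
  δ-sym i j with i Fin.≟ j
  ... | yes refl = sym (δ-refl i)
  ... | no i≢j   = sym (δ-≢ (i≢j ∘ sym))

  sum-δʳ : ∀ {n} (f : Fin n → ℤ) i → sum (λ j → f j * δ j i) ≡ f i
  sum-δʳ f i = begin
    sum (λ j → f j * δ j i) ≡⟨ sum-only (λ j → f j * δ j i) i (λ k k≢i → trans (cong (f k *_) (δ-≢ k≢i)) (ℤ.*-zeroʳ (f k))) ⟩
    f i * δ i i             ≡⟨ cong (f i *_) (δ-refl i) ⟩
    f i * 1ℤ                ≡⟨ ℤ.*-identityʳ (f i) ⟩
    f i                     ∎

  sgn : ∀ {n} → Fin n → ℤ
  sgn j = (- 1ℤ) ^ toℕ j

  minor : ∀ {n} → Matrix (suc n) → Fin (suc n) → Matrix n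
  minor M j i = removeAt (M (suc i)) j

  det-cong : ∀ {n} {M N : Matrix n} → (∀ i j → M i j ≡ N i j) → det M ≡ det N
  det-cong {zero}  M≡N = refl
  det-cong {suc n} M≡N = sum-cong-≗ λ j →
    cong (sgn j *_) (cong₂ _*_ (M≡N zero j) (det-cong λ i k → M≡N (suc i) (punchIn j k)))

  -- Rows are elements of an arbitrary type V, so that deleting a column is a map on rows and
  -- commutes with the replacement by `setRow-map`.
  setRow : ∀ {n} {V : Set} → Fin n → V → (Fin n → V) → Fin n → V
  setRow zero    r M zero    = r
  setRow zero    r M (suc k) = M (suc k)
  setRow (suc i) r M zero    = M zero
  setRow (suc i) r M (suc k) = setRow i r (M ∘ suc) k

  setRow-map : ∀ {n} {V W : Set} (g : V → W) i r (M : Fin n → V) k →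
               g (setRow i r M k) ≡ setRow i (g r) (g ∘ M) k
  setRow-map g zero    r M zero    = refl
  setRow-map g zero    r M (suc k) = refl
  setRow-map g (suc i) r M zero    = refl
  setRow-map g (suc i) r M (suc k) = setRow-map g i r (M ∘ suc) k

  setRow-same : ∀ {n} {V : Set} i (r : V) (M : Fin n → V) → setRow i r M i ≡ r
  setRow-same zero    r M = refl
  setRow-same (suc i) r M = setRow-same i r (M ∘ suc)

  setRow-other : ∀ {n} {V : Set} i (r : V) (M : Fin n → V) k → k ≢ i → setRow i r M k ≡ M k
  setRow-other zero    r M zero    k≢i = ⊥-elim (k≢i refl)
  setRow-other zero    r M (suc k) k≢i = refl
  setRow-other (suc i) r M zero    k≢i = refl
  setRow-other (suc i) r M (suc k) k≢i = setRow-other i r (M ∘ suc) k (k≢i ∘ cong suc)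

  setRow-self : ∀ {n} {V : Set} i (M : Fin n → V) k → setRow i (M i) M k ≡ M k
  setRow-self zero    M zero    = refl
  setRow-self zero    M (suc k) = refl
  setRow-self (suc i) M zero    = refl
  setRow-self (suc i) M (suc k) = setRow-self i (M ∘ suc) k

  setRow-cong : ∀ {n m} i {r s : Fin m → ℤ} (M : Fin n → Fin m → ℤ) → r ≗ s →
                ∀ k j → setRow i r M k j ≡ setRow i s M k j
  setRow-cong zero    M r≗s zero    j = r≗s j
  setRow-cong zero    M r≗s (suc k) j = refl
  setRow-cong (suc i) M r≗s zero    j = refl
  setRow-cong (suc i) M r≗s (suc k) j = setRow-cong i (M ∘ suc) r≗s k j

  det-setRow-cong : ∀ {n} i {r s : Fin n → ℤ} (M : Matrix n) → r ≗ s →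
                    det (setRow i r M) ≡ det (setRow i s M)
  det-setRow-cong i M r≗s = det-cong (setRow-cong i M r≗s)

  minor-setRow : ∀ {n} i r (M : Matrix (suc n)) j →
                 det (minor (setRow (suc i) r M) j) ≡ det (setRow i (removeAt r j) (minor M j))
  minor-setRow i r M j = det-cong λ k l →
    cong (λ s → s l) (setRow-map (λ s → removeAt s j) i r (M ∘ suc) k)

  det-row-lin : ∀ {n} i a b (r s : Fin n → ℤ) (M : Matrix n) →
                det (setRow i (λ j → a * r j + b * s j) M) ≡
                a * det (setRow i r M) + b * det (setRow i s M)
  det-row-lin zero a b r s M = trans
    (sum-cong-≗ λ j → distr (sgn j) a b (r j) (s j) (det (minor M j)))
    (sum-lin a b (λ j → sgn j * (r j * det (minor M j))) (λ j → sgn j * (s j * det (minor M j))))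
    where
    distr : ∀ g a b r s d → g * ((a * r + b * s) * d) ≡ a * (g * (r * d)) + b * (g * (s * d))
    distr = solve-∀
  det-row-lin (suc i) a b r s M = trans
    (sum-cong-≗ λ j → trans
      (cong (λ d → sgn j * (M zero j * d))
        (trans (minor-setRow i (λ k → a * r k + b * s k) M j)
        (trans (det-row-lin i a b (removeAt r j) (removeAt s j) (minor M j))
               (sym (cong₂ (λ x y → a * x + b * y) (minor-setRow i r M j) (minor-setRow i s M j))))))
      (distr (sgn j) a b (M zero j) (det (minor (setRow (suc i) r M) j)) (det (minor (setRow (suc i) s M) j))))
    (sum-lin a b (λ j → sgn j * (M zero j * det (minor (setRow (suc i) r M) j)))
                 (λ j → sgn j * (M zero j * det (minor (setRow (suc i) s M) j))))
    where
    distr : ∀ g a b m x y → g * (m * (a * x + b * y)) ≡ a * (g * (m * x)) + b * (g * (m * y))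
    distr = solve-∀

  det-row-comb : ∀ {n m} i (c : Fin m → ℤ) (R : Fin m → Fin n → ℤ) (M : Matrix n) →
                 det (setRow i (λ j → sum λ k → c k * R k j) M) ≡ sum λ k → c k * det (setRow i (R k) M)
  det-row-comb {m = zero} i c R M = trans
    (det-row-lin i 0ℤ 0ℤ (λ _ → 0ℤ) (λ _ → 0ℤ) M)
    refl
  det-row-comb {m = suc m} i c R M = begin
    det (setRow i (λ j → c zero * R zero j + rest j) M)
      ≡⟨ det-setRow-cong i M (λ j → cong (λ z → c zero * R zero j + z) (sym (ℤ.*-identityˡ (rest j)))) ⟩
    det (setRow i (λ j → c zero * R zero j + 1ℤ * rest j) M)
      ≡⟨ det-row-lin i (c zero) 1ℤ (R zero) rest M ⟩
    c zero * det (setRow i (R zero) M) + 1ℤ * det (setRow i rest M)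
      ≡⟨ cong (λ z → c zero * det (setRow i (R zero) M) + z)
           (trans (ℤ.*-identityˡ _) (det-row-comb i (c ∘ suc) (R ∘ suc) M)) ⟩
    c zero * det (setRow i (R zero) M) + (sum λ k → c (suc k) * det (setRow i (R (suc k)) M)) ∎
    where
    rest : Fin _ → ℤ
    rest j = sum λ k → c (suc k) * R (suc k) j

  private
    lift : ∀ {m n} → (Fin m → Fin n) → Fin (suc m) → Fin (suc n)
    lift θ zero    = zero
    lift θ (suc c) = suc (θ c)

  -- Twofold expansion along two equal rows r: the terms for the column pairs
  -- (j , k) and (k , j) cancel.  Φ stands for the complementary minor.
  alternating-sum : ∀ n (r : Fin (suc (suc n)) → ℤ) (Φ : (Fin n → Fin (suc (suc n))) → ℤ) →
    (∀ {θ θ′} → θ ≗ θ′ → Φ θ ≡ Φ θ′) →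
    sum (λ j → sum λ l → sgn j * (sgn l * (r j * (r (punchIn j l) * Φ (punchIn j ∘ punchIn l))))) ≡ 0ℤ
  alternating-sum n r Φ Φ-cong = begin
    sum (t zero) + sum (λ j → t (suc j) zero + sum (λ l → t (suc j) (suc l)))
      ≡⟨ cong (λ z → sum (t zero) + z) (∑-distrib-+ (λ j → t (suc j) zero) (λ j → sum (λ l → t (suc j) (suc l)))) ⟩
    sum (t zero) + (sum (λ j → t (suc j) zero) + rest)
      ≡⟨ sym (ℤ.+-assoc (sum (t zero)) _ rest) ⟩
    sum (t zero) + sum (λ j → t (suc j) zero) + rest
      ≡⟨ cong (_+ rest) (trans (sym (∑-distrib-+ (t zero) (λ j → t (suc j) zero))) (sum-zero cancel)) ⟩
    0ℤ + rest
      ≡⟨ trans (ℤ.+-identityˡ rest) (rest≡0 n r Φ Φ-cong) ⟩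
    0ℤ ∎
    where
    t : Fin (suc (suc n)) → Fin (suc n) → ℤ
    t j l = sgn j * (sgn l * (r j * (r (punchIn j l) * Φ (punchIn j ∘ punchIn l))))
    rest : ℤ
    rest = sum (λ j → sum (λ l → t (suc j) (suc l)))
    swap : ∀ g a b φ → 1ℤ * (g * (a * (b * φ))) + (- 1ℤ * g) * (1ℤ * (b * (a * φ))) ≡ 0ℤ
    swap = solve-∀
    cancel : ∀ l → t zero l + t (suc l) zero ≡ 0ℤ
    cancel l = trans
      (cong (λ φ → t zero l + (- 1ℤ * sgn l) * (1ℤ * (r (suc l) * (r zero * φ))))
        (Φ-cong {punchIn (suc l) ∘ punchIn zero} {punchIn zero ∘ punchIn l} λ c → refl))
      (swap (sgn l) (r zero) (r (suc l)) (Φ (punchIn zero ∘ punchIn l)))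
    -- If neither deleted column is the first, both signs change and the complementary minor keeps
    -- the first column: this is the same sum with one column fewer, for `Φ ∘ lift`.
    rest≡0 : ∀ n (r : Fin (suc (suc n)) → ℤ) (Φ : (Fin n → Fin (suc (suc n))) → ℤ) →
      (∀ {θ θ′} → θ ≗ θ′ → Φ θ ≡ Φ θ′) →
      sum (λ j → sum λ l → sgn (suc j) * (sgn (suc l) *
        (r (suc j) * (r (suc (punchIn j l)) * Φ (punchIn (suc j) ∘ punchIn (suc l)))))) ≡ 0ℤ
    rest≡0 zero    r Φ Φ-cong = refl
    rest≡0 (suc n) r Φ Φ-cong = trans
      (sum-cong-≗ λ j → sum-cong-≗ λ l → trans
        (signs (sgn j) (sgn l) (r (suc j) * (r (suc (punchIn j l)) * Φ (punchIn (suc j) ∘ punchIn (suc l)))))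
        (cong (λ φ → sgn j * (sgn l * (r (suc j) * (r (suc (punchIn j l)) * φ))))
          (Φ-cong {punchIn (suc j) ∘ punchIn (suc l)} {lift (punchIn j ∘ punchIn l)}
            λ { zero → refl ; (suc c) → refl })))
      (alternating-sum n (r ∘ suc) (Φ ∘ lift) λ θ≗θ′ → Φ-cong λ { zero → refl ; (suc c) → cong suc (θ≗θ′ c) })
      where
      signs : ∀ g h x → (- 1ℤ * g) * ((- 1ℤ * h) * x) ≡ g * (h * x)
      signs = solve-∀

  det-rows₀₁ : ∀ {n} (M : Matrix (suc (suc n))) → M zero ≗ M (suc zero) → det M ≡ 0ℤ
  det-rows₀₁ {n} M eq = trans
    (sum-cong-≗ λ j → trans
      (cong (sgn j *_) (*-distribˡ-sum (M zero j) (λ l → sgn l * (M (suc zero) (punchIn j l) * Φ j l))))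
      (trans (*-distribˡ-sum (sgn j) (λ l → M zero j * (sgn l * (M (suc zero) (punchIn j l) * Φ j l))))
        (sum-cong-≗ λ l → trans (reorder (sgn j) (M zero j) (sgn l) (M (suc zero) (punchIn j l)) (Φ j l))
          (cong (λ z → sgn j * (sgn l * (M zero j * (z * Φ j l)))) (sym (eq (punchIn j l)))))))
    (alternating-sum n (M zero) (λ θ → det (λ i → M (suc (suc i)) ∘ θ))
      λ θ≗θ′ → det-cong λ i c → cong (M (suc (suc i))) (θ≗θ′ c))
    where
    Φ : Fin (suc (suc n)) → Fin (suc n) → ℤ
    Φ j l = det (λ i → M (suc (suc i)) ∘ (punchIn j ∘ punchIn l))
    reorder : ∀ g a h b φ → g * (a * (h * (b * φ))) ≡ g * (h * (a * (b * φ)))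
    reorder = solve-∀

  private
    rows : ∀ {n} {V : Set} → V → V → (Fin n → V) → Fin (suc (suc n)) → V
    rows r s M zero          = r
    rows r s M (suc zero)    = s
    rows r s M (suc (suc k)) = M k

  -- Polarisation: the determinant with r + s in both places vanishes, and so do those of its four
  -- bilinear parts that have two equal rows.
  det-swap₀₁ : ∀ {n} r s (M : Fin n → Fin (suc (suc n)) → ℤ) → det (rows r s M) + det (rows s r M) ≡ 0ℤ
  det-swap₀₁ r s M = begin
    det (rows r s M) + det (rows s r M)
      ≡⟨ expand (det (rows r s M)) (det (rows s r M)) ⟩
    1ℤ * (1ℤ * 0ℤ + 1ℤ * det (rows r s M)) + 1ℤ * (1ℤ * det (rows s r M) + 1ℤ * 0ℤ)
      ≡⟨ sym (cong₂ (λ x y → 1ℤ * (1ℤ * x + 1ℤ * det (rows r s M)) + 1ℤ * (1ℤ * det (rows s r M) + 1ℤ * y))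
          (det-rows₀₁ (rows r r M) (λ j → refl)) (det-rows₀₁ (rows s s M) (λ j → refl))) ⟩
    1ℤ * (1ℤ * det (rows r r M) + 1ℤ * det (rows r s M)) + 1ℤ * (1ℤ * det (rows s r M) + 1ℤ * det (rows s s M))
      ≡⟨ sym (cong₂ (λ x y → 1ℤ * x + 1ℤ * y) (second r) (second s)) ⟩
    1ℤ * det (rows r r+s M) + 1ℤ * det (rows s r+s M)
      ≡⟨ sym (trans (sym (det-cong (zero-row {r+s} {r+s} {r})))
           (trans (det-row-lin zero 1ℤ 1ℤ r s (rows r r+s M))
             (cong₂ (λ x y → 1ℤ * x + 1ℤ * y) (det-cong (zero-row {r} {r+s} {r})) (det-cong (zero-row {s} {r+s} {r}))))) ⟩
    det (rows r+s r+s M)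
      ≡⟨ det-rows₀₁ (rows r+s r+s M) (λ _ → refl) ⟩
    0ℤ ∎
    where
    r+s : Fin _ → ℤ
    r+s j = 1ℤ * r j + 1ℤ * s j
    expand : ∀ a b → a + b ≡ 1ℤ * (1ℤ * 0ℤ + 1ℤ * a) + 1ℤ * (1ℤ * b + 1ℤ * 0ℤ)
    expand = solve-∀
    zero-row : ∀ {a b c} i j → setRow zero a (rows c b M) i j ≡ rows a b M i j
    zero-row zero          j = refl
    zero-row (suc zero)    j = refl
    zero-row (suc (suc i)) j = refl
    one-row : ∀ {a b c} i j → setRow (suc zero) b (rows a c M) i j ≡ rows a b M i j
    one-row zero          j = refl
    one-row (suc zero)    j = refl
    one-row (suc (suc i)) j = refl
    second : ∀ a → det (rows a r+s M) ≡ 1ℤ * det (rows a r M) + 1ℤ * det (rows a s M)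
    second a = trans (sym (det-cong (one-row {a} {r+s} {r}))) (trans (det-row-lin (suc zero) 1ℤ 1ℤ r s (rows a r M))
      (cong₂ (λ x y → 1ℤ * x + 1ℤ * y) (det-cong (one-row {a} {r} {r})) (det-cong (one-row {a} {s} {r}))))

  -- Induction on the size. Two equal rows below the first are repeated in every minor; if the first
  -- row recurs further down, `det-swap₀₁` moves it to the second place, which leads back to that
  -- case.
  det-repeated-row : ∀ {n} (M : Matrix n) i k → i ≢ k → M i ≗ M k → det M ≡ 0ℤ
  det-repeated-row {suc n} M = go
    where
    below : ∀ (N : Matrix (suc n)) i k → i ≢ k → N (suc i) ≗ N (suc k) → det N ≡ 0ℤ
    below N i k i≢k eq = sum-zero λ j → trans
      (cong (λ d → sgn j * (N zero j * d))
        (det-repeated-row (minor N j) i k i≢k λ c → eq (punchIn j c)))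
      (zeros (sgn j) (N zero j))
      where
      zeros : ∀ a b → a * (b * 0ℤ) ≡ 0ℤ
      zeros = solve-∀
    first : ∀ k → M zero ≗ M (suc k) → det M ≡ 0ℤ
    first zero    eq = det-rows₀₁ M eq
    first (suc k) eq = begin
      det M                              ≡⟨ det-cong as-rows ⟩
      det (rows r s N)                   ≡⟨ sym (ℤ.+-identityʳ _) ⟩
      det (rows r s N) + 0ℤ              ≡⟨ cong (λ z → det (rows r s N) + z) (sym (below (rows s r N) zero (suc k) (λ ()) eq)) ⟩
      det (rows r s N) + det (rows s r N) ≡⟨ det-swap₀₁ r s N ⟩
      0ℤ                                 ∎
      where
      r s : Fin (suc n) → ℤ
      r = M zero
      s = M (suc zero)
      N : Fin _ → Fin (suc n) → ℤ
      N i = M (suc (suc i))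
      as-rows : ∀ i j → M i j ≡ rows r s N i j
      as-rows zero          j = refl
      as-rows (suc zero)    j = refl
      as-rows (suc (suc i)) j = refl
    go : ∀ i k → i ≢ k → M i ≗ M k → det M ≡ 0ℤ
    go zero    zero    i≢k eq = ⊥-elim (i≢k refl)
    go zero    (suc k) i≢k eq = first k eq
    go (suc i) zero    i≢k eq = first i (sym ∘ eq)
    go (suc i) (suc k) i≢k eq = below M i k (i≢k ∘ cong suc) eq

  -- Cramer's rule by rows: the k-th term has row k also in place i, so every term but k = i has a
  -- repeated row.
  det-own-rows : ∀ {n} i (c : Fin n → ℤ) (M : Matrix n) →
                 det (setRow i (λ j → sum λ k → c k * M k j) M) ≡ c i * det M
  det-own-rows i c M = begin
    det (setRow i (λ j → sum λ k → c k * M k j) M)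
      ≡⟨ det-row-comb i c M M ⟩
    sum (λ k → c k * det (setRow i (M k) M))
      ≡⟨ sum-only (λ k → c k * det (setRow i (M k) M)) i (λ k k≢i → trans (cong (c k *_)
           (det-repeated-row (setRow i (M k) M) i k (k≢i ∘ sym) λ j → cong (λ s → s j)
             (trans (setRow-same i (M k) M) (sym (setRow-other i (M k) M k k≢i)))))
           (ℤ.*-zeroʳ (c k))) ⟩
    c i * det (setRow i (M i) M)
      ≡⟨ cong (c i *_) (det-cong λ k j → cong (λ s → s j) (setRow-self i M k)) ⟩
    c i * det M ∎

  det-δ : ∀ n → det (δ {n}) ≡ 1ℤ
  det-δ zero    = refl
  det-δ (suc n) = begin
    sum (λ j → sgn j * (δ {suc n} zero j * d j))
      ≡⟨ sum-only (λ j → sgn j * (δ {suc n} zero j * d j)) zero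
           (λ { zero k≢0 → ⊥-elim (k≢0 refl) ; (suc k) _ → trans (cong (sgn (suc k) *_) (ℤ.*-zeroˡ (d (suc k)))) (ℤ.*-zeroʳ (sgn (suc k))) }) ⟩
    1ℤ * (1ℤ * d zero) ≡⟨ trans (ℤ.*-identityˡ (1ℤ * d zero)) (ℤ.*-identityˡ (d zero)) ⟩
    d zero             ≡⟨ trans (det-cong {n} {minor δ zero} {δ} δ-suc) (det-δ n) ⟩
    1ℤ                 ∎
    where
    d : Fin (suc n) → ℤ
    d j = det (minor (δ {suc n}) j)
    δ-suc : ∀ (i j : Fin n) → δ (suc i) (suc j) ≡ δ i j
    δ-suc i j with i Fin.≟ j
    ... | yes _ = refl
    ... | no  _ = refl

  -- The first-order expansion of the determinant. The remainder is left existential because only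
  -- its divisibility by ε² matters: congruences take the place of derivatives.
  det-perturb : ∀ {n} ε (M N : Matrix n) → ∃[ w ]
    det (λ i j → M i j + ε * N i j) ≡ det M + ε * sum (λ i → det (setRow i (N i) M)) + ε * ε * w
  det-perturb {zero}  ε M N = 0ℤ , base ε
    where
    base : ∀ ε → 1ℤ ≡ 1ℤ + ε * 0ℤ + ε * ε * 0ℤ
    base = solve-∀
  det-perturb {suc n} ε M N = sum w , (begin
    sum (λ j → sgn j * ((M zero j + ε * N zero j) * det (λ i k → minor M j i k + ε * minor N j i k)))
      ≡⟨ sum-cong-≗ (λ j → trans (cong (λ d → sgn j * ((M zero j + ε * N zero j) * d)) (proj₂ (ih j)))
           (expand (sgn j) ε (M zero j) (N zero j) (D j) (T j) (v j))) ⟩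
    sum (λ j → 1ℤ * a j + 1ℤ * (ε * b j + (ε * c j + ε * ε * w j)))
      ≡⟨ sum-lin 1ℤ 1ℤ a (λ j → ε * b j + (ε * c j + ε * ε * w j)) ⟩
    1ℤ * det M + 1ℤ * sum (λ j → ε * b j + (ε * c j + ε * ε * w j))
      ≡⟨ cong (λ z → 1ℤ * det M + 1ℤ * z) (trans
           (∑-distrib-+ (λ j → ε * b j) (λ j → ε * c j + ε * ε * w j))
           (cong₂ _+_ (sym (*-distribˡ-sum ε b)) (sum-lin ε (ε * ε) c w))) ⟩
    1ℤ * det M + 1ℤ * (ε * det (setRow zero (N zero) M) + (ε * sum c + ε * ε * sum w))
      ≡⟨ cong (λ z → 1ℤ * det M + 1ℤ * (ε * det (setRow zero (N zero) M) + (ε * z + ε * ε * sum w))) later ⟩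
    1ℤ * det M + 1ℤ * (ε * det (setRow zero (N zero) M) + (ε * sum (λ i → det (setRow (suc i) (N (suc i)) M)) + ε * ε * sum w))
      ≡⟨ collect ε (det M) (det (setRow zero (N zero) M)) (sum (λ i → det (setRow (suc i) (N (suc i)) M))) (sum w) ⟩
    det M + ε * (det (setRow zero (N zero) M) + sum (λ i → det (setRow (suc i) (N (suc i)) M))) + ε * ε * sum w ∎)
    where
    ih : ∀ j → ∃[ w ] det (λ i k → minor M j i k + ε * minor N j i k) ≡
           det (minor M j) + ε * sum (λ i → det (setRow i (minor N j i) (minor M j))) + ε * ε * w
    ih j = det-perturb ε (minor M j) (minor N j)
    D T v w a b c : Fin (suc n) → ℤ
    D j = det (minor M j)
    T j = sum λ i → det (setRow i (minor N j i) (minor M j))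
    v j = proj₁ (ih j)
    w j = sgn j * (N zero j * T j + (M zero j + ε * N zero j) * v j)
    a j = sgn j * (M zero j * D j)
    b j = sgn j * (N zero j * D j)
    c j = sgn j * (M zero j * T j)
    expand : ∀ g ε m n D T v → g * ((m + ε * n) * (D + ε * T + ε * ε * v)) ≡
      1ℤ * (g * (m * D)) + 1ℤ * (ε * (g * (n * D)) + (ε * (g * (m * T)) + ε * ε * (g * (n * T + (m + ε * n) * v))))
    expand = solve-∀
    collect : ∀ ε d a b w → 1ℤ * d + 1ℤ * (ε * a + (ε * b + ε * ε * w)) ≡ d + ε * (a + b) + ε * ε * w
    collect = solve-∀
    later : sum c ≡ sum (λ i → det (setRow (suc i) (N (suc i)) M))
    later = trans
      (sum-cong-≗ λ j → trans (cong (sgn j *_) (*-distribˡ-sum (M zero j) (λ i → det (setRow i (minor N j i) (minor M j)))))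
        (trans (*-distribˡ-sum (sgn j) (λ i → M zero j * det (setRow i (minor N j i) (minor M j))))
          (sum-cong-≗ λ i → cong (λ d → sgn j * (M zero j * d)) (sym (minor-setRow i (N (suc i)) M j)))))
      (∑-comm λ j i → sgn j * (M zero j * det (minor (setRow (suc i) (N (suc i)) M) j)))

  -- Power traces from the values of det (I - y A)

  act : ∀ {n} → Matrix n → (Fin n → ℤ) → Fin n → ℤ
  act A y i = sum λ j → A i j * y j

  power : ∀ {n} → Matrix n → ℕ → (Fin n → ℤ) → Fin n → ℤ
  power A zero    y = y
  power A (suc k) y = act A (power A k y)

  powerTrace : ∀ {n} → Matrix n → ℕ → ℤ
  powerTrace A k = sum λ i → power A k (δ i) i

  I-_⊛_ : ∀ {n} → ℤ → Matrix n → Matrix n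
  (I- y ⊛ A) i j = δ i j - y * A i j

  -- The modulus ∣z∣ + 1 alone forces z = 0. This replaces the comparison of coefficients of
  -- polynomials in y.
  divisible-by-all⇒0 : ∀ z → (∀ k → ∃[ w ] z ≡ + suc k * w) → z ≡ 0ℤ
  divisible-by-all⇒0 z div with div ∣ z ∣
  ... | w , eq with ∣ w ∣ in ∣w∣≡ | trans (cong ∣_∣ eq) (ℤ.abs-* (+ suc ∣ z ∣) w)
  ...   | zero  | e = ℤ.∣i∣≡0⇒i≡0 (trans e (ℕ.*-zeroʳ (suc ∣ z ∣)))
  ...   | suc m | e = ⊥-elim (ℕ.1+n≰n (subst (suc ∣ z ∣ ℕ.≤_) (sym e) (ℕ.m≤m*n (suc ∣ z ∣) (suc m))))

  module _ {n} (A : Matrix n) (A-sym : ∀ i j → A i j ≡ A j i) where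

    -- This is tr (Aᵏ adj (I - y A)); for k = 1 it is minus the derivative of det (I - y A) with
    -- respect to y.
    replaced : ℕ → ℤ → ℤ
    replaced k y = sum λ i → det (setRow i (power A k (δ i)) (I- y ⊛ A))

    -- Aᵏ = Aᵏ (I - y A) + y Aᵏ⁺¹, and the rows of the first summand are combinations of the rows of
    -- I - y A, to which `det-own-rows` applies. This is a form of Newton's identities that mentions
    -- no coefficients.
    replaced-step : ∀ k y → replaced k y ≡ powerTrace A k * det (I- y ⊛ A) + y * replaced (suc k) y
    replaced-step k y = begin
      sum (λ i → det (setRow i (r i) M))
        ≡⟨ sum-cong-≗ (λ i → trans (det-setRow-cong i M (split (r i)))
             (trans (det-row-lin i 1ℤ y (λ j → sum λ k → r i k * M k j) (act A (r i)) M)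
               (cong (λ d → 1ℤ * d + y * det (setRow i (act A (r i)) M)) (det-own-rows i (r i) M)))) ⟩
      sum (λ i → 1ℤ * (r i i * det M) + y * det (setRow i (act A (r i)) M))
        ≡⟨ sum-lin 1ℤ y (λ i → r i i * det M) (λ i → det (setRow i (act A (r i)) M)) ⟩
      1ℤ * sum (λ i → r i i * det M) + y * replaced (suc k) y
        ≡⟨ cong (_+ y * replaced (suc k) y) (trans (ℤ.*-identityˡ _) (sym (*-distribʳ-sum (det M) (λ i → r i i)))) ⟩
      powerTrace A k * det M + y * replaced (suc k) y ∎
      where
      M : Matrix n
      M = I- y ⊛ A
      r : Fin n → Fin n → ℤ
      r i = power A k (δ i)
      arith : ∀ x d y a → x * d ≡ 1ℤ * (x * (d - y * a)) + y * (a * x)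
      arith = solve-∀
      split : ∀ (x : Fin n → ℤ) j → x j ≡ 1ℤ * sum (λ k → x k * M k j) + y * act A x j
      split x j = begin
        x j                                                     ≡⟨ sym (sum-δʳ x j) ⟩
        sum (λ k → x k * δ k j)                                 ≡⟨ sum-cong-≗ (λ k → trans (arith (x k) (δ k j) y (A k j))
                                                                    (cong (λ a → 1ℤ * (x k * M k j) + y * (a * x k)) (A-sym k j))) ⟩
        sum (λ k → 1ℤ * (x k * M k j) + y * (A j k * x k))      ≡⟨ sum-lin 1ℤ y (λ k → x k * M k j) (λ k → A j k * x k) ⟩
        1ℤ * sum (λ k → x k * M k j) + y * act A x j            ∎

    det-shift : ∀ y ε → ∃[ w ]
      det (I- (y + ε) ⊛ A) ≡ det (I- y ⊛ A) + ε * (- replaced 1 y) + ε * ε * w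
    -- The perturbation -A is written as a two-term combination so that `det-row-lin` can pull out
    -- the sign.
    det-shift y ε with det-perturb ε (I- y ⊛ A) (λ i j → - 1ℤ * A i j + 0ℤ * A i j)
    ... | w , eq = w , trans (det-cong λ i j → arith (δ i j) y ε (A i j)) (trans eq
      (cong (λ z → det (I- y ⊛ A) + ε * z + ε * ε * w) (begin
        sum (λ i → det (setRow i (λ j → - 1ℤ * A i j + 0ℤ * A i j) (I- y ⊛ A)))
          ≡⟨ sum-cong-≗ (λ i → trans (det-row-lin i (- 1ℤ) 0ℤ (A i) (A i) (I- y ⊛ A)) (cong₂ (λ a b → - 1ℤ * a + 0ℤ * b) (row i) (row i))) ⟩
        sum (λ i → - 1ℤ * R i + 0ℤ * R i)
          ≡⟨ sum-lin (- 1ℤ) 0ℤ R R ⟩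
        - 1ℤ * replaced 1 y + 0ℤ * replaced 1 y
          ≡⟨ neg (replaced 1 y) ⟩
        - replaced 1 y ∎)))
      where
      R : Fin n → ℤ
      R i = det (setRow i (power A 1 (δ i)) (I- y ⊛ A))
      arith : ∀ d y ε a → d - (y + ε) * a ≡ (d - y * a) + ε * (- 1ℤ * a + 0ℤ * a)
      arith = solve-∀
      neg : ∀ x → - 1ℤ * x + 0ℤ * x ≡ - x
      neg = solve-∀
      row : ∀ i → det (setRow i (A i) (I- y ⊛ A)) ≡ R i
      row i = det-setRow-cong i (I- y ⊛ A) λ j → trans (A-sym i j) (trans (sym (sum-δʳ (A j) i)) (sum-cong-≗ λ k → cong (A j k *_) (δ-sym k i)))

    det-unit : ∀ y → ∃[ w ] det (I- y ⊛ A) ≡ 1ℤ + y * w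
    det-unit y with det-perturb y (δ {n}) (λ i j → - A i j)
    ... | w , eq = s + y * w , trans (det-cong λ i j → arith (δ i j) y (A i j)) (trans eq
      (trans (cong (λ d → d + y * s + y * y * w) (det-δ n)) (collect y s w)))
      where
      s : ℤ
      s = sum λ i → det (setRow i (λ j → - A i j) (δ {n}))
      arith : ∀ d y a → d - y * a ≡ d + y * (- a)
      arith = solve-∀
      collect : ∀ y s w → 1ℤ + y * s + y * y * w ≡ 1ℤ + y * (s + y * w)
      collect = solve-∀

  private
    -- Two expansions of D with the same leading term d; division by ε = k + 1 leaves r ≡ s modulo
    -- ε.
    shift-cancel : ∀ k d r s v w D → D ≡ d + + suc k * (- r) + + suc k * + suc k * v →
                   D ≡ d + + suc k * (- s) + + suc k * + suc k * w → r - s ≡ + suc k * (v - w)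
    shift-cancel k d r s v w D eq eq′ = ℤ.*-cancelˡ-≡ ε (r - s) (ε * (v - w)) (+-cancelʳ D (ε * (r - s)) (ε * (ε * (v - w)))
      (trans (cong (λ z → ε * (r - s) + z) eq) (trans (arith ε d r s v w) (cong (λ z → ε * (ε * (v - w)) + z) (sym eq′)))))
      where
      ε : ℤ
      ε = + suc k
      arith : ∀ ε d r s v w → ε * (r - s) + (d + ε * (- r) + ε * ε * v) ≡ ε * (ε * (v - w)) + (d + ε * (- s) + ε * ε * w)
      arith = solve-∀

    -- Two instances of `replaced-step` with the same left side R, read modulo y, where D is 1.
    step-cancel : ∀ t u y w r z D R → D ≡ 1ℤ + y * w → R ≡ t * D + y * r → R ≡ u * D + y * z → t - u ≡ y * (z - r - (t - u) * w)
    step-cancel t u y w r z D R refl eq eq′ = +-cancelʳ R (t - u) (y * (z - r - (t - u) * w))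
      (trans (cong (λ x → t - u + x) eq′) (trans (arith t u y w r z) (cong (λ x → y * (z - r - (t - u) * w) + x) (sym eq))))
      where
      arith : ∀ t u y w r z → (t - u) + (u * (1ℤ + y * w) + y * z) ≡ y * (z - r - (t - u) * w) + (t * (1ℤ + y * w) + y * r)
      arith = solve-∀

  module _ {n} (A B : Matrix n) (A-sym : ∀ i j → A i j ≡ A j i) (B-sym : ∀ i j → B i j ≡ B j i)
           (same : ∀ k → det (I- (+ suc k) ⊛ A) ≡ det (I- (+ suc k) ⊛ B)) where

    private
      rA rB : ℕ → ℕ → ℤ
      rA k j = replaced A A-sym k (+ suc j)
      rB k j = replaced B B-sym k (+ suc j)

    -- Moving y by m changes det (I - y A) by - m times the derivative, modulo m².
    replaced-one : ∀ k → rA 1 k ≡ rB 1 k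
    replaced-one k = ℤ.i-j≡0⇒i≡j (rA 1 k) (rB 1 k) (divisible-by-all⇒0 (rA 1 k - rB 1 k) λ m →
      let v , eqA = det-shift A A-sym (+ suc k) (+ suc m)
          w , eqB = det-shift B B-sym (+ suc k) (+ suc m)
      in v - w , shift-cancel m (det (I- (+ suc k) ⊛ A)) (rA 1 k) (rB 1 k) v w (det (I- (+ suc k + + suc m) ⊛ A)) eqA
           (trans (same (k ℕ.+ suc m)) (trans eqB (cong (λ d → d + + suc m * (- rB 1 k) + + suc m * + suc m * w) (sym (same k))))))

    -- Modulo y, `replaced-step` says that `replaced k y` is the k-th trace, since the determinant
    -- is 1 there. The moduli y = j + 1 are arbitrary.
    powerTrace-from-replaced : ∀ k → (∀ j → rA k j ≡ rB k j) → powerTrace A k ≡ powerTrace B k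
    powerTrace-from-replaced k eq = ℤ.i-j≡0⇒i≡j tA tB (divisible-by-all⇒0 (tA - tB) λ j →
      let w , D≡ = det-unit A A-sym (+ suc j)
      in rB (suc k) j - rA (suc k) j - (tA - tB) * w ,
         step-cancel tA tB (+ suc j) w (rA (suc k) j) (rB (suc k) j) (det (I- (+ suc j) ⊛ A)) (rA k j) D≡ (replaced-step A A-sym k (+ suc j))
           (trans (eq j) (trans (replaced-step B B-sym k (+ suc j)) (cong (λ d → tB * d + + suc j * rB (suc k) j) (sym (same j))))))
      where
      tA tB : ℤ
      tA = powerTrace A k
      tB = powerTrace B k

    -- Equality at one exponent gives equal traces there, and then `replaced-step` can be solved for
    -- the next exponent because y ≠ 0.
    replaced-equal : ∀ k j → rA (suc k) j ≡ rB (suc k) j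
    replaced-equal zero    j = replaced-one j
    replaced-equal (suc k) j = ℤ.*-cancelˡ-≡ (+ suc j) (rA (suc (suc k)) j) (rB (suc (suc k)) j)
      (+-cancelˡ (powerTrace A (suc k) * det (I- (+ suc j) ⊛ A)) (+ suc j * rA (suc (suc k)) j) (+ suc j * rB (suc (suc k)) j) (begin
      powerTrace A (suc k) * det (I- (+ suc j) ⊛ A) + + suc j * rA (suc (suc k)) j
        ≡⟨ sym (replaced-step A A-sym (suc k) (+ suc j)) ⟩
      rA (suc k) j
        ≡⟨ replaced-equal k j ⟩
      rB (suc k) j
        ≡⟨ replaced-step B B-sym (suc k) (+ suc j) ⟩
      powerTrace B (suc k) * det (I- (+ suc j) ⊛ B) + + suc j * rB (suc (suc k)) j
        ≡⟨ cong₂ (λ t d → t * d + + suc j * rB (suc (suc k)) j)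
             (sym (powerTrace-from-replaced (suc k) (replaced-equal k))) (sym (same j)) ⟩
      powerTrace A (suc k) * det (I- (+ suc j) ⊛ A) + + suc j * rB (suc (suc k)) j ∎))

    powerTrace-equal : ∀ k → powerTrace A k ≡ powerTrace B k
    powerTrace-equal zero    = refl
    powerTrace-equal (suc k) = powerTrace-from-replaced (suc k) (replaced-equal k)

-- From real spectra to integer determinants

module IntegerSpectra where

  open import Data.Integer.Base using (ℤ; +_; _+_; _*_; -_; _-_; 0ℤ; 1ℤ; ∣_∣)
  open Determinants

  -- Stated for any commutative ring with a homomorphism from ℤ, so that nothing here depends on the
  -- construction of the reals.
  module IntegerMatrices {c ℓ} (R : CommutativeRing c ℓ) where

    open CommutativeRing R using (Carrier; _≈_; 0#; 1#) renaming (_+_ to _+ᴿ_; _*_ to _*ᴿ_; -_ to -ᴿ_)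

    module Homomorphism (⟦_⟧ : ℤ → Carrier) (+-homo : ∀ a b → ⟦ a + b ⟧ ≈ ⟦ a ⟧ +ᴿ ⟦ b ⟧) (*-homo : ∀ a b → ⟦ a * b ⟧ ≈ ⟦ a ⟧ *ᴿ ⟦ b ⟧)
        (-‿homo : ∀ a → ⟦ - a ⟧ ≈ -ᴿ ⟦ a ⟧) (0-homo : ⟦ 0ℤ ⟧ ≈ 0#) (1-homo : ⟦ 1ℤ ⟧ ≈ 1#) where

      private
        module R = CommutativeRing R
        module M = Matrices R
        module S = Sum R.semiring
      open R using (setoid; *-cong; *-congˡ; +-cong)
      open Exp R.semiring using (_^_)
      open SetoidReasoning setoid
      private module ℤ^ = Exp ℤ.+-*-semiring

      sum-homo : ∀ {n} (f : Fin n → ℤ) → ⟦ sum f ⟧ ≈ S.sum (λ i → ⟦ f i ⟧)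
      sum-homo {zero}  f = 0-homo
      sum-homo {suc n} f = R.trans (+-homo (f zero) _) (R.+-congˡ (sum-homo λ i → f (suc i)))

      sgn-homo : ∀ k → ⟦ (- 1ℤ) ℤ^.^ k ⟧ ≈ (-ᴿ 1#) ^ k
      sgn-homo zero    = 1-homo
      sgn-homo (suc k) = R.trans (*-homo (- 1ℤ) _)
        (*-cong (R.trans (-‿homo 1ℤ) (R.-‿cong 1-homo)) (sgn-homo k))

      det-homo : ∀ {n} (A : Matrix n) (B : M.Matrix n) → (∀ i j → B i j ≈ ⟦ A i j ⟧) → M.det B ≈ ⟦ det A ⟧
      det-homo {zero}  A B B≈A = R.sym 1-homo
      det-homo {suc n} A B B≈A = R.trans
        (S.sum-cong-≋ λ j → R.sym (R.trans (*-homo (sgn j) _)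
          (*-cong (sgn-homo (toℕ j)) (R.trans (*-homo (A zero j) _)
            (*-cong (R.sym (B≈A zero j)) (R.sym (det-homo (minor A j) _ λ i k → B≈A (suc i) (punchIn j k))))))))
        (R.sym (sum-homo λ j → sgn j * (A zero j * det (minor A j))))

      det-scale : ∀ {n} x (B C : M.Matrix n) → (∀ i j → C i j ≈ x *ᴿ B i j) → M.det C ≈ x ^ n *ᴿ M.det B
      det-scale {zero}  x B C C≈ = R.sym (R.*-identityˡ 1#)
      det-scale {suc n} x B C C≈ = R.trans
        (S.sum-cong-≋ λ j → begin
          σ j *ᴿ (C zero j *ᴿ M.det (λ i k → C (suc i) (punchIn j k)))
            ≈⟨ *-congˡ (*-cong (C≈ zero j) (det-scale x (λ i k → B (suc i) (punchIn j k)) _ λ i k → C≈ (suc i) (punchIn j k))) ⟩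
          σ j *ᴿ ((x *ᴿ B zero j) *ᴿ (x ^ n *ᴿ D j))
            ≈⟨ *-congˡ (interchange x (B zero j) (x ^ n) (D j)) ⟩
          σ j *ᴿ ((x *ᴿ x ^ n) *ᴿ (B zero j *ᴿ D j))
            ≈⟨ x∙yz≈y∙xz (σ j) (x *ᴿ x ^ n) (B zero j *ᴿ D j) ⟩
          (x *ᴿ x ^ n) *ᴿ (σ j *ᴿ (B zero j *ᴿ D j)) ∎)
        (R.sym (S.*-distribˡ-sum (x *ᴿ x ^ n) (λ j → σ j *ᴿ (B zero j *ᴿ D j))))
        where
        open import Algebra.Properties.CommutativeSemigroup R.*-commutativeSemigroup using (interchange; x∙yz≈y∙xz)
        σ D : Fin (suc n) → Carrier
        σ j = (-ᴿ 1#) ^ toℕ j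
        D j = M.det (λ i k → B (suc i) (punchIn j k))

      charPoly-reversed : ∀ {n} (A : Matrix n) (B : M.Matrix n) → (∀ i j → B i j ≈ ⟦ A i j ⟧) →
        ∀ y x → ⟦ y ⟧ *ᴿ x ≈ 1# → ⟦ det (I- y ⊛ A) ⟧ ≈ ⟦ y ⟧ ^ n *ᴿ M.charPoly B x
      charPoly-reversed A B B≈A y x yx≈1 = R.trans
        (R.sym (det-homo (I- y ⊛ A) _ λ i j → R.refl))
        (det-scale ⟦ y ⟧ (λ i j → M.scalar x i j R.- B i j) (λ i j → ⟦ (I- y ⊛ A) i j ⟧) entry)
        where
        open import Algebra.Properties.Ring R.ring using (-‿distribʳ-*)
        scaled : ∀ b → ⟦ if b then 1ℤ else 0ℤ ⟧ ≈ ⟦ y ⟧ *ᴿ (if b then x else 0#)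
        scaled true  = R.trans 1-homo (R.sym yx≈1)
        scaled false = R.trans 0-homo (R.sym (R.zeroʳ ⟦ y ⟧))
        entry : ∀ i j → ⟦ (I- y ⊛ A) i j ⟧ ≈ ⟦ y ⟧ *ᴿ (M.scalar x i j R.- B i j)
        entry i j = begin
          ⟦ δ i j - y * A i j ⟧                          ≈⟨ +-homo (δ i j) _ ⟩
          ⟦ δ i j ⟧ +ᴿ ⟦ - (y * A i j) ⟧                 ≈⟨ R.+-congˡ (R.trans (-‿homo _) (R.-‿cong (R.trans (*-homo y _) (*-congˡ (R.sym (B≈A i j)))))) ⟩
          ⟦ δ i j ⟧ +ᴿ -ᴿ (⟦ y ⟧ *ᴿ B i j)               ≈⟨ +-cong (scaled (does (i Fin.≟ j))) (-‿distribʳ-* ⟦ y ⟧ (B i j)) ⟩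
          ⟦ y ⟧ *ᴿ M.scalar x i j +ᴿ ⟦ y ⟧ *ᴿ (-ᴿ B i j) ≈⟨ R.distribˡ ⟦ y ⟧ _ _ ⟨
          ⟦ y ⟧ *ᴿ (M.scalar x i j R.- B i j)            ∎

      same-charPoly⇒same-det : ∀ {n} (A A′ : Matrix n) (B B′ : M.Matrix n) →
        (∀ i j → B i j ≈ ⟦ A i j ⟧) → (∀ i j → B′ i j ≈ ⟦ A′ i j ⟧) →
        (∀ x → M.charPoly B x ≈ M.charPoly B′ x) →
        ∀ y x → ⟦ y ⟧ *ᴿ x ≈ 1# → ⟦ det (I- y ⊛ A) ⟧ ≈ ⟦ det (I- y ⊛ A′) ⟧
      same-charPoly⇒same-det A A′ B B′ B≈ B′≈ same y x yx≈1 = R.trans (charPoly-reversed A B B≈ y x yx≈1)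
        (R.trans (*-congˡ (same x)) (R.sym (charPoly-reversed A′ B′ B′≈ y x yx≈1)))

  module _ {c ℓ} (R : CommutativeRing c ℓ) where
    open CommutativeRing R hiding (refl; sym; trans)
    private module M = Matrices R
    open Permutation setoid using (_↭_)
    open PermutationProperties setoid using (foldr-commMonoid; map⁺)

    same-spectrum⇒same-charPoly : ∀ {n m} {A : M.Matrix n} {B : M.Matrix m} λs μs →
      M.IsSpectrum A λs → M.IsSpectrum B μs → toList λs ↭ toList μs → ∀ x → M.charPoly A x ≈ M.charPoly B x
    same-spectrum⇒same-charPoly λs μs specA specB λs↭μs x = CommutativeRing.trans R (specA x) (CommutativeRing.trans R
      (foldr-commMonoid *-isCommutativeMonoid (map⁺ setoid (λ p → +-congˡ (-‿cong p)) λs↭μs)) (CommutativeRing.sym R (specB x)))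

  ℤ→ℚ : ℤ → ℚ
  ℤ→ℚ z = mkℚ z 0 (Coprimality.sym (Coprimality.1-coprimeTo ∣ z ∣))

  ℤ→ℝ : ℤ → ℝ
  ℤ→ℝ z = fromℚ (ℤ→ℚ z)

  ℤ→ℚ-+ : ∀ a b → ℤ→ℚ (a + b) ≡ ℤ→ℚ a ℚ.+ ℤ→ℚ b
  ℤ→ℚ-+ a b = ℚ.toℚᵘ-injective (ℚᵘ.≃-trans
    (*≡* (cong (_* 1ℤ) (sym (cong₂ _+_ (ℤ.*-identityʳ a) (ℤ.*-identityʳ b)))))
    (ℚᵘ.≃-sym (ℚ.toℚᵘ-homo-+ (ℤ→ℚ a) (ℤ→ℚ b))))

  ℤ→ℚ-* : ∀ a b → ℤ→ℚ (a * b) ≡ ℤ→ℚ a ℚ.* ℤ→ℚ b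
  ℤ→ℚ-* a b = ℚ.toℚᵘ-injective (ℚᵘ.≃-sym (ℚ.toℚᵘ-homo-* (ℤ→ℚ a) (ℤ→ℚ b)))

  ℤ→ℚ-neg : ∀ a → ℤ→ℚ (- a) ≡ ℚ.- ℤ→ℚ a
  ℤ→ℚ-neg a = ℚ.toℚᵘ-injective (ℚᵘ.≃-sym (ℚ.toℚᵘ-homo‿- (ℤ→ℚ a)))

  fromℚ-cong : ∀ {p q} → p ≡ q → fromℚ p ≈ℝ fromℚ q
  fromℚ-cong {p} refl = CommutativeRing.refl ℝ-commutativeRing {fromℚ p}

  -- Between constant sequences the choice ε = ∣p - q∣ would ask the distance to be smaller than
  -- itself.
  fromℚ-injective : ∀ {p q} → fromℚ p ≈ℝ fromℚ q → p ≡ q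
  fromℚ-injective {p} {q} p≈q with p ℚ.≟ q
  ... | yes p≡q = p≡q
  ... | no  p≢q = ⊥-elim (ℚ.<-irrefl refl (proj₂ (p≈q ε 0<ε) _ ℕ.≤-refl))
    where
    open import Algebra.Properties.AbelianGroup ℚ.+-0-abelianGroup using (x∙y⁻¹≈ε⇒x≈y)
    ε : ℚ
    ε = ℚ.∣ p ℚ.- q ∣
    0<ε : 0ℚ ℚ.< ε
    0<ε = ℚ.≰⇒> λ ε≤0 → p≢q (x∙y⁻¹≈ε⇒x≈y p q (ℚ.∣p∣≡0⇒p≡0 (p ℚ.- q) (ℚ.≤-antisym ε≤0 (ℚ.0≤∣p∣ (p ℚ.- q)))))

  adjacency : ∀ G → Matrix (Graph.order G)
  adjacency G i j = if does (Inverse.to enum i ~? Inverse.to enum j) then 1ℤ else 0ℤ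
    where
    open Graph G

  adjacency-ℝ : ∀ G i j → Graph.adjacencyMatrix G i j ≈ℝ ℤ→ℝ (adjacency G i j)
  adjacency-ℝ G i j with does (Graph._~?_ G (Inverse.to (Graph.enum G) i) (Inverse.to (Graph.enum G) j))
  ... | true  = fromℚ-cong {1ℚ} refl
  ... | false = fromℚ-cong {0ℚ} refl

  cospectral⇒order : ∀ {H G} → Cospectral H G → Graph.order H ≡ Graph.order G
  cospectral⇒order (λs , μs , _ , _ , λs↭μs) = trans (sym (Vec.length-toList λs))
    (trans (PermutationProperties.xs↭ys⇒|xs|≡|ys| (CommutativeRing.setoid ℝ-commutativeRing) λs↭μs) (Vec.length-toList μs))

  open IntegerMatrices.Homomorphism ℝ-commutativeRing ℤ→ℝ
    (λ a b → fromℚ-cong (ℤ→ℚ-+ a b)) (λ a b → fromℚ-cong (ℤ→ℚ-* a b)) (λ a → fromℚ-cong (ℤ→ℚ-neg a))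
    (fromℚ-cong {0ℚ} refl) (fromℚ-cong {1ℚ} refl)
    using (same-charPoly⇒same-det)

  -- At x = 1/(k + 1), after multiplication by (k + 1)ⁿ, both sides are embedded integers, and
  -- `fromℚ-injective` turns the equality of reals into one of integers.
  same-charPoly⇒same-reversed : ∀ {n} (A A′ : Matrix n) (B B′ : Defs.Matrix n) →
    (∀ i j → B i j ≈ℝ ℤ→ℝ (A i j)) → (∀ i j → B′ i j ≈ℝ ℤ→ℝ (A′ i j)) →
    (∀ x → charPoly B x ≈ℝ charPoly B′ x) →
    ∀ k → det (I- (+ suc k) ⊛ A) ≡ det (I- (+ suc k) ⊛ A′)
  same-charPoly⇒same-reversed A A′ B B′ B≈ B′≈ same k = cong ℚ.ℚ.numerator (fromℚ-injective {ℤ→ℚ (det (I- (+ suc k) ⊛ A))} {ℤ→ℚ (det (I- (+ suc k) ⊛ A′))}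
    (same-charPoly⇒same-det A A′ B B′ B≈ B′≈ same (+ suc k) (fromℚ (ℚ.1/ y)) (fromℚ-cong (ℚ.*-inverseʳ y))))
    where
    y : ℚ
    y = ℤ→ℚ (+ suc k)

  cospectral⇒charPoly : ∀ {H G} → Cospectral H G →
    ∀ x → charPoly (Graph.adjacencyMatrix H) x ≈ℝ charPoly (Graph.adjacencyMatrix G) x
  cospectral⇒charPoly {H} {G} (λs , μs , specH , specG , λs↭μs) =
    same-spectrum⇒same-charPoly ℝ-commutativeRing {A = Graph.adjacencyMatrix H} {Graph.adjacencyMatrix G} λs μs specH specG λs↭μs

-- Polynomials in a symmetric integer matrix and their traces

module MatrixPolynomials where

  open import Data.Integer.Base using (ℤ; +_; -[1+_]; _+_; _*_; -_; _-_; 0ℤ; 1ℤ; _≤_; +≤+)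
  open Determinants

  open ≡-Reasoning

  square-nonneg : ∀ x → 0ℤ ≤ x * x
  square-nonneg (+ n)    = subst (0ℤ ≤_) (ℤ.pos-* n n) (+≤+ ℕ.z≤n)
  square-nonneg -[1+ n ] = +≤+ ℕ.z≤n

  square≡0 : ∀ x → x * x ≡ 0ℤ → x ≡ 0ℤ
  square≡0 x x²≡0 = [ (λ p → p) , (λ p → p) ]′ (ℤ.i*j≡0⇒i≡0∨j≡0 x x²≡0)

  sum-nonneg : ∀ {n} {f : Fin n → ℤ} → (∀ i → 0ℤ ≤ f i) → 0ℤ ≤ sum f
  sum-nonneg {zero}  f≥0 = ℤ.≤-refl
  sum-nonneg {suc n} f≥0 = ℤ.+-mono-≤ (f≥0 zero) (sum-nonneg (f≥0 ∘ suc))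

  +-nonneg-≡0 : ∀ {x y} → 0ℤ ≤ x → 0ℤ ≤ y → x + y ≡ 0ℤ → x ≡ 0ℤ × y ≡ 0ℤ
  +-nonneg-≡0 {+ zero}  {+ zero}  _ _ _ = refl , refl
  +-nonneg-≡0 {+ zero}  {+ suc n} _ _ ()
  +-nonneg-≡0 {+ suc m} {+ n}     _ _ ()

  sum-nonneg-≡0 : ∀ {n} {f : Fin n → ℤ} → (∀ i → 0ℤ ≤ f i) → sum f ≡ 0ℤ → ∀ i → f i ≡ 0ℤ
  sum-nonneg-≡0 {suc n} {f} f≥0 eq zero    = proj₁ (+-nonneg-≡0 {f zero} (f≥0 zero) (sum-nonneg (f≥0 ∘ suc)) eq)
  sum-nonneg-≡0 {suc n} {f} f≥0 eq (suc i) =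
    sum-nonneg-≡0 (f≥0 ∘ suc) (proj₂ (+-nonneg-≡0 {f zero} (f≥0 zero) (sum-nonneg (f≥0 ∘ suc)) eq)) i

  sum-scale : ∀ {n} c (f : Fin n → ℤ) → sum (λ i → c * f i) ≡ c * sum f
  sum-scale c f = sym (*-distribˡ-sum c f)

  infixl 6 _⊞_ _⊟_
  infixl 7 _⊠_

  -- Unreduced expressions instead of coefficient lists. One expression acts through any matrix,
  -- which is what the transfer between cospectral graphs needs, and two expressions are compared
  -- only through their action.
  data Pol : Set where
    con     : ℤ → Pol
    X       : Pol
    _⊞_ _⊠_ : Pol → Pol → Pol

  neg : Pol → Pol
  neg p = con (- 1ℤ) ⊠ p

  _⊟_ : Pol → Pol → Pol
  p ⊟ q = p ⊞ neg q

  eval : Pol → ℤ → ℤ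
  eval (con c) x = c
  eval X       x = x
  eval (p ⊞ q) x = eval p x + eval q x
  eval (p ⊠ q) x = eval p x * eval q x

  ⟨_,_⟩ : ∀ {n} → (Fin n → ℤ) → (Fin n → ℤ) → ℤ
  ⟨ y , z ⟩ = sum λ i → y i * z i

  ⟨⟩-comm : ∀ {n} (y z : Fin n → ℤ) → ⟨ y , z ⟩ ≡ ⟨ z , y ⟩
  ⟨⟩-comm y z = sum-cong-≗ λ i → ℤ.*-comm (y i) (z i)

  ⟨⟩-linʳ : ∀ {n} a b (x y z : Fin n → ℤ) → ⟨ x , (λ i → a * y i + b * z i) ⟩ ≡ a * ⟨ x , y ⟩ + b * ⟨ x , z ⟩
  ⟨⟩-linʳ a b x y z = trans
    (sum-cong-≗ λ i → arith a b (x i) (y i) (z i))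
    (sum-lin a b (λ i → x i * y i) (λ i → x i * z i))
    where
    arith : ∀ a b x y z → x * (a * y + b * z) ≡ a * (x * y) + b * (x * z)
    arith = solve-∀

  ⟨⟩-congʳ : ∀ {n} (x : Fin n → ℤ) {y z : Fin n → ℤ} → y ≗ z → ⟨ x , y ⟩ ≡ ⟨ x , z ⟩
  ⟨⟩-congʳ x y≗z = sum-cong-≗ λ i → cong (x i *_) (y≗z i)

  ⟨⟩-linˡ : ∀ {n} a b (x y z : Fin n → ℤ) → ⟨ (λ i → a * y i + b * z i) , x ⟩ ≡ a * ⟨ y , x ⟩ + b * ⟨ z , x ⟩
  ⟨⟩-linˡ a b x y z = trans (⟨⟩-comm (λ i → a * y i + b * z i) x) (trans (⟨⟩-linʳ a b x y z)
    (cong₂ (λ s t → a * s + b * t) (⟨⟩-comm x y) (⟨⟩-comm x z)))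

  ⟨δ,⟩ : ∀ {n} i (y : Fin n → ℤ) → ⟨ δ i , y ⟩ ≡ y i
  ⟨δ,⟩ i y = trans (sum-cong-≗ λ j → trans (ℤ.*-comm (δ i j) (y j)) (cong (y j *_) (δ-sym i j))) (sum-δʳ y i)

  ⟨⟩-square-nonneg : ∀ {n} (y : Fin n → ℤ) → 0ℤ ≤ ⟨ y , y ⟩
  ⟨⟩-square-nonneg y = sum-nonneg λ i → square-nonneg (y i)

  ⟨⟩-square≡0 : ∀ {n} (y : Fin n → ℤ) → ⟨ y , y ⟩ ≡ 0ℤ → ∀ i → y i ≡ 0ℤ
  ⟨⟩-square≡0 y eq i = square≡0 (y i) (sum-nonneg-≡0 (λ i → square-nonneg (y i)) eq i)

  act-lin : ∀ {n} (A : Matrix n) a b (y z : Fin n → ℤ) i →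
            act A (λ j → a * y j + b * z j) i ≡ a * act A y i + b * act A z i
  act-lin A a b y z i = ⟨⟩-linʳ a b (A i) y z

  act-cong : ∀ {n} (A : Matrix n) {y z : Fin n → ℤ} → y ≗ z → act A y ≗ act A z
  act-cong A y≗z i = ⟨⟩-congʳ (A i) y≗z

  module Operator {n} (A : Matrix n) (A-sym : ∀ i j → A i j ≡ A j i) where

    ⟦_⟧ : Pol → (Fin n → ℤ) → Fin n → ℤ
    ⟦ con c ⟧ y i = c * y i
    ⟦ X ⟧     y   = act A y
    ⟦ p ⊞ q ⟧ y i = ⟦ p ⟧ y i + ⟦ q ⟧ y i
    ⟦ p ⊠ q ⟧ y   = ⟦ p ⟧ (⟦ q ⟧ y)

    ⟦⟧-cong : ∀ p {y z} → y ≗ z → ⟦ p ⟧ y ≗ ⟦ p ⟧ z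
    ⟦⟧-cong (con c) y≗z i = cong (c *_) (y≗z i)
    ⟦⟧-cong X       y≗z i = act-cong A y≗z i
    ⟦⟧-cong (p ⊞ q) y≗z i = cong₂ _+_ (⟦⟧-cong p y≗z i) (⟦⟧-cong q y≗z i)
    ⟦⟧-cong (p ⊠ q) y≗z i = ⟦⟧-cong p (⟦⟧-cong q y≗z) i

    ⟦⟧-lin : ∀ p a b y z i → ⟦ p ⟧ (λ j → a * y j + b * z j) i ≡ a * ⟦ p ⟧ y i + b * ⟦ p ⟧ z i
    ⟦⟧-lin (con c) a b y z i = arith a b c (y i) (z i)
      where
      arith : ∀ a b c y z → c * (a * y + b * z) ≡ a * (c * y) + b * (c * z)
      arith = solve-∀
    ⟦⟧-lin X       a b y z i = act-lin A a b y z i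
    ⟦⟧-lin (p ⊞ q) a b y z i = trans (cong₂ _+_ (⟦⟧-lin p a b y z i) (⟦⟧-lin q a b y z i))
      (arith a b (⟦ p ⟧ y i) (⟦ p ⟧ z i) (⟦ q ⟧ y i) (⟦ q ⟧ z i))
      where
      arith : ∀ a b p p′ q q′ → a * p + b * p′ + (a * q + b * q′) ≡ a * (p + q) + b * (p′ + q′)
      arith = solve-∀
    ⟦⟧-lin (p ⊠ q) a b y z i = trans (⟦⟧-cong p (⟦⟧-lin q a b y z) i) (⟦⟧-lin p a b (⟦ q ⟧ y) (⟦ q ⟧ z) i)

    ⟦⟧-scale : ∀ p c y i → ⟦ p ⟧ (λ j → c * y j) i ≡ c * ⟦ p ⟧ y i
    ⟦⟧-scale p c y i = trans (⟦⟧-cong p (λ j → pad c (y j)) i)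
      (trans (⟦⟧-lin p c 0ℤ y y i) (sym (pad c (⟦ p ⟧ y i))))
      where
      pad : ∀ c y → c * y ≡ c * y + 0ℤ * y
      pad = solve-∀

    ⟦⟧-+ : ∀ p y z i → ⟦ p ⟧ (λ j → y j + z j) i ≡ ⟦ p ⟧ y i + ⟦ p ⟧ z i
    ⟦⟧-+ p y z i = trans (⟦⟧-cong p (λ j → pad (y j) (z j)) i)
      (trans (⟦⟧-lin p 1ℤ 1ℤ y z i) (sym (pad (⟦ p ⟧ y i) (⟦ p ⟧ z i))))
      where
      pad : ∀ y z → y + z ≡ 1ℤ * y + 1ℤ * z
      pad = solve-∀

    ⟦⟧-zero : ∀ p {y} → (∀ i → y i ≡ 0ℤ) → ∀ i → ⟦ p ⟧ y i ≡ 0ℤ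
    ⟦⟧-zero p {y} y≡0 i = trans (⟦⟧-cong p (λ j → trans (y≡0 j) (sym (ℤ.*-zeroˡ (y j)))) i)
      (trans (⟦⟧-scale p 0ℤ y i) (ℤ.*-zeroˡ (⟦ p ⟧ y i)))

    ⟦⟧-eigen : ∀ p {y} x → (∀ i → act A y i ≡ x * y i) → ∀ i → ⟦ p ⟧ y i ≡ eval p x * y i
    ⟦⟧-eigen (con c) x eig i = refl
    ⟦⟧-eigen X       x eig i = eig i
    ⟦⟧-eigen (p ⊞ q) {y} x eig i = trans (cong₂ _+_ (⟦⟧-eigen p x eig i) (⟦⟧-eigen q x eig i))
      (sym (ℤ.*-distribʳ-+ (y i) (eval p x) (eval q x)))
    ⟦⟧-eigen (p ⊠ q) {y} x eig i = begin
      ⟦ p ⟧ (⟦ q ⟧ y) i               ≡⟨ ⟦⟧-cong p (⟦⟧-eigen q x eig) i ⟩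
      ⟦ p ⟧ (λ j → eval q x * y j) i  ≡⟨ ⟦⟧-scale p (eval q x) y i ⟩
      eval q x * ⟦ p ⟧ y i            ≡⟨ cong (eval q x *_) (⟦⟧-eigen p x eig i) ⟩
      eval q x * (eval p x * y i)     ≡⟨ arith (eval q x) (eval p x) (y i) ⟩
      eval p x * eval q x * y i       ∎
      where
      arith : ∀ a b c → a * (b * c) ≡ b * a * c
      arith = solve-∀

    X-comm : ∀ q y i → act A (⟦ q ⟧ y) i ≡ ⟦ q ⟧ (act A y) i
    X-comm (con c) y i = ⟦⟧-scale X c y i
    X-comm X       y i = refl
    X-comm (p ⊞ q) y i = trans (⟦⟧-+ X (⟦ p ⟧ y) (⟦ q ⟧ y) i) (cong₂ _+_ (X-comm p y i) (X-comm q y i))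
    X-comm (p ⊠ q) y i = trans (X-comm p (⟦ q ⟧ y) i) (⟦⟧-cong p (X-comm q y) i)

    ⟦⟧-comm : ∀ p q y i → ⟦ p ⟧ (⟦ q ⟧ y) i ≡ ⟦ q ⟧ (⟦ p ⟧ y) i
    ⟦⟧-comm (con c) q y i = sym (⟦⟧-scale q c y i)
    ⟦⟧-comm X       q y i = X-comm q y i
    ⟦⟧-comm (p ⊞ r) q y i = trans (cong₂ _+_ (⟦⟧-comm p q y i) (⟦⟧-comm r q y i)) (sym (⟦⟧-+ q (⟦ p ⟧ y) (⟦ r ⟧ y) i))
    ⟦⟧-comm (p ⊠ r) q y i = trans (⟦⟧-cong p (⟦⟧-comm r q y) i) (⟦⟧-comm p q (⟦ r ⟧ y) i)

    self-adjoint : ∀ p y z → ⟨ ⟦ p ⟧ y , z ⟩ ≡ ⟨ y , ⟦ p ⟧ z ⟩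
    self-adjoint (con c) y z = sum-cong-≗ λ i → arith c (y i) (z i)
      where
      arith : ∀ c y z → c * y * z ≡ y * (c * z)
      arith = solve-∀
    self-adjoint X y z = begin
      sum (λ i → act A y i * z i)               ≡⟨ sum-cong-≗ (λ i → *-distribʳ-sum (z i) (λ j → A i j * y j)) ⟩
      sum (λ i → sum λ j → A i j * y j * z i)   ≡⟨ ∑-comm (λ i j → A i j * y j * z i) ⟩
      sum (λ j → sum λ i → A i j * y j * z i)   ≡⟨ sum-cong-≗ (λ j → sum-cong-≗ λ i → trans
                                                    (cong (λ a → a * y j * z i) (A-sym i j)) (arith (A j i) (y j) (z i))) ⟩
      sum (λ j → sum λ i → y j * (A j i * z i)) ≡⟨ sum-cong-≗ (λ j → sum-scale (y j) (λ i → A j i * z i)) ⟩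
      sum (λ j → y j * act A z j)               ∎
      where
      arith : ∀ a y z → a * y * z ≡ y * (a * z)
      arith = solve-∀
    self-adjoint (p ⊞ q) y z = begin
      sum (λ i → (⟦ p ⟧ y i + ⟦ q ⟧ y i) * z i)
        ≡⟨ sum-cong-≗ (λ i → ℤ.*-distribʳ-+ (z i) (⟦ p ⟧ y i) (⟦ q ⟧ y i)) ⟩
      sum (λ i → ⟦ p ⟧ y i * z i + ⟦ q ⟧ y i * z i)
        ≡⟨ ∑-distrib-+ (λ i → ⟦ p ⟧ y i * z i) (λ i → ⟦ q ⟧ y i * z i) ⟩
      ⟨ ⟦ p ⟧ y , z ⟩ + ⟨ ⟦ q ⟧ y , z ⟩
        ≡⟨ cong₂ _+_ (self-adjoint p y z) (self-adjoint q y z) ⟩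
      ⟨ y , ⟦ p ⟧ z ⟩ + ⟨ y , ⟦ q ⟧ z ⟩
        ≡⟨ ∑-distrib-+ (λ i → y i * ⟦ p ⟧ z i) (λ i → y i * ⟦ q ⟧ z i) ⟨
      sum (λ i → y i * ⟦ p ⟧ z i + y i * ⟦ q ⟧ z i)
        ≡⟨ sum-cong-≗ (λ i → ℤ.*-distribˡ-+ (y i) (⟦ p ⟧ z i) (⟦ q ⟧ z i)) ⟨
      ⟨ y , ⟦ p ⊞ q ⟧ z ⟩ ∎
    self-adjoint (p ⊠ q) y z = begin
      ⟨ ⟦ p ⟧ (⟦ q ⟧ y) , z ⟩ ≡⟨ self-adjoint p (⟦ q ⟧ y) z ⟩
      ⟨ ⟦ q ⟧ y , ⟦ p ⟧ z ⟩   ≡⟨ self-adjoint q y (⟦ p ⟧ z) ⟩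
      ⟨ y , ⟦ q ⟧ (⟦ p ⟧ z) ⟩ ≡⟨ ⟨⟩-congʳ y (⟦⟧-comm q p z) ⟩
      ⟨ y , ⟦ p ⟧ (⟦ q ⟧ z) ⟩ ∎

    infix 4 _≋_
    _≋_ : Pol → Pol → Set
    p ≋ q = ∀ y i → ⟦ p ⟧ y i ≡ ⟦ q ⟧ y i

    -- The ring ℤ[A], with equality of operators. It makes the ring solver available: an identity of
    -- polynomials in several commuting operators needs no manual rewriting.
    polRing : CommutativeRing 0ℓ 0ℓ
    polRing = record
      { Carrier = Pol ; _≈_ = _≋_ ; _+_ = _⊞_ ; _*_ = _⊠_ ; -_ = neg ; 0# = con 0ℤ ; 1# = con 1ℤ
      ; isCommutativeRing = record
        { isRing = record
          { +-isAbelianGroup = record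
            { isGroup = record
              { isMonoid = record
                { isSemigroup = record
                  { isMagma = record
                    { isEquivalence = record
                      { refl  = λ y i → refl
                      ; sym   = λ e y i → sym (e y i)
                      ; trans = λ e f y i → trans (e y i) (f y i)
                      }
                    ; ∙-cong = λ e f y i → cong₂ _+_ (e y i) (f y i)
                    }
                  ; assoc = λ p q r y i → ℤ.+-assoc (⟦ p ⟧ y i) (⟦ q ⟧ y i) (⟦ r ⟧ y i)
                  }
                ; identity = (λ p y i → trans (cong (_+ ⟦ p ⟧ y i) (ℤ.*-zeroˡ (y i))) (ℤ.+-identityˡ (⟦ p ⟧ y i)))
                           , (λ p y i → trans (cong (λ z → ⟦ p ⟧ y i + z) (ℤ.*-zeroˡ (y i))) (ℤ.+-identityʳ (⟦ p ⟧ y i)))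
                }
              ; inverse = (λ p y i → inverseˡ (⟦ p ⟧ y i) (y i)) , (λ p y i → inverseʳ (⟦ p ⟧ y i) (y i))
              ; ⁻¹-cong = λ e y i → cong (- 1ℤ *_) (e y i)
              }
            ; comm = λ p q y i → ℤ.+-comm (⟦ p ⟧ y i) (⟦ q ⟧ y i)
            }
          ; *-cong = λ {p} {q} {r} {s} e f y i → trans (⟦⟧-cong p (f y) i) (e (⟦ s ⟧ y) i)
          ; *-assoc = λ p q r y i → refl
          ; *-identity = (λ p y i → ℤ.*-identityˡ (⟦ p ⟧ y i)) , (λ p y i → ⟦⟧-cong p (λ j → ℤ.*-identityˡ (y j)) i)
          ; distrib = (λ p q r y i → ⟦⟧-+ p (⟦ q ⟧ y) (⟦ r ⟧ y) i) , (λ p q r y i → refl)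
          }
        ; *-comm = ⟦⟧-comm
        }
      }
      where
      inverseˡ : ∀ x y → - 1ℤ * x + x ≡ 0ℤ * y
      inverseˡ = solve-∀
      inverseʳ : ∀ x y → x + - 1ℤ * x ≡ 0ℤ * y
      inverseʳ = solve-∀

    con-morphism : ℤ.+-*-rawRing -Raw-AlmostCommutative⟶ fromCommutativeRing polRing
    con-morphism = record
      { ⟦_⟧    = con
      ; +-homo = λ a b y i → ℤ.*-distribʳ-+ (y i) a b
      ; *-homo = λ a b y i → ℤ.*-assoc a b (y i)
      ; -‿homo = λ a y i → neg-homo a (y i)
      ; 0-homo = λ y i → refl
      ; 1-homo = λ y i → refl
      }
      where
      neg-homo : ∀ a y → - a * y ≡ - 1ℤ * (a * y)
      neg-homo = solve-∀

    con-dec : ∀ a b → Maybe (con a ≋ con b)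
    con-dec a b with a ℤ.≟ b
    ... | yes refl = just λ y i → refl
    ... | no  _    = nothing

    module PolSolver = RingSolver ℤ.+-*-rawRing (fromCommutativeRing polRing) con-morphism con-dec

    -- Taken literally, `entry p i` is column i of p(A); `entry-sym` makes rows and columns
    -- interchangeable.
    entry : Pol → Fin n → Fin n → ℤ
    entry p i j = ⟦ p ⟧ (δ i) j

    tr : Pol → ℤ
    tr p = sum λ i → entry p i i

    ⟦⟧-entries : ∀ p y i → ⟦ p ⟧ y i ≡ ⟨ entry p i , y ⟩
    ⟦⟧-entries p y i = trans (sym (⟨δ,⟩ i (⟦ p ⟧ y))) (sym (self-adjoint p (δ i) y))

    entry-sym : ∀ p i j → entry p i j ≡ entry p j i
    entry-sym p i j = trans (⟦⟧-entries p (δ i) j) (trans (⟨⟩-comm (entry p j) (δ i)) (⟨δ,⟩ i (entry p j)))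

    entry-⊠ : ∀ p q i j → entry (p ⊠ q) i j ≡ ⟨ entry p j , entry q i ⟩
    entry-⊠ p q i j = ⟦⟧-entries p (entry q i) j

    ≋-from-entries : ∀ {p q} → (∀ i j → entry p i j ≡ entry q i j) → p ≋ q
    ≋-from-entries {p} {q} eq y i = trans (⟦⟧-entries p y i)
      (trans (sum-cong-≗ λ j → cong (_* y j) (eq i j)) (sym (⟦⟧-entries q y i)))

    tr-cong : ∀ {p q} → p ≋ q → tr p ≡ tr q
    tr-cong p≋q = sum-cong-≗ λ i → p≋q (δ i) i

    tr-⊞ : ∀ p q → tr (p ⊞ q) ≡ tr p + tr q
    tr-⊞ p q = ∑-distrib-+ (λ i → entry p i i) (λ i → entry q i i)

    tr-con : ∀ c p → tr (con c ⊠ p) ≡ c * tr p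
    tr-con c p = sum-scale c (λ i → entry p i i)

    tr-⊠ : ∀ p q → tr (p ⊠ q) ≡ sum λ i → sum λ j → entry p i j * entry q i j
    tr-⊠ p q = sum-cong-≗ λ i → entry-⊠ p q i i

    -- For the symmetric matrix p(A), the trace of the square is the sum of the squares of all
    -- entries.
    tr-square≡0 : ∀ p → tr (p ⊠ p) ≡ 0ℤ → p ≋ con 0ℤ
    tr-square≡0 p eq = ≋-from-entries {p} {con 0ℤ} λ i j → trans
      (⟨⟩-square≡0 (entry p i) (sum-nonneg-≡0 (λ k → ⟨⟩-square-nonneg (entry p k)) (trans (sym (tr-⊠ p p)) eq) i) j)
      (sym (ℤ.*-zeroˡ (δ i j)))

    form : Pol → (Fin n → ℤ) → (Fin n → ℤ) → ℤ
    form p u w = ⟨ u , ⟦ p ⟧ w ⟩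

    form-cong : ∀ {p q} → p ≋ q → ∀ u w → form p u w ≡ form q u w
    form-cong p≋q u w = ⟨⟩-congʳ u (p≋q w)

    form-⊞ : ∀ p q u w → form (p ⊞ q) u w ≡ form p u w + form q u w
    form-⊞ p q u w = trans (sum-cong-≗ λ i → ℤ.*-distribˡ-+ (u i) (⟦ p ⟧ w i) (⟦ q ⟧ w i))
      (∑-distrib-+ (λ i → u i * ⟦ p ⟧ w i) (λ i → u i * ⟦ q ⟧ w i))

    form-con : ∀ c p u w → form (con c ⊠ p) u w ≡ c * form p u w
    form-con c p u w = trans (sum-cong-≗ λ i → arith (u i) c (⟦ p ⟧ w i)) (sum-scale c (λ i → u i * ⟦ p ⟧ w i))
      where
      arith : ∀ u c x → u * (c * x) ≡ c * (u * x)
      arith = solve-∀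

    form-⊠ : ∀ p q u w → form (p ⊠ q) u w ≡ ⟨ ⟦ p ⟧ u , ⟦ q ⟧ w ⟩
    form-⊠ p q u w = sym (self-adjoint p u (⟦ q ⟧ w))

    form-sym : ∀ p u w → form p u w ≡ form p w u
    form-sym p u w = trans (sym (self-adjoint p u w)) (⟨⟩-comm (⟦ p ⟧ u) w)

    form-square-nonneg : ∀ p u → 0ℤ ≤ form (p ⊠ p) u u
    form-square-nonneg p u = subst (0ℤ ≤_) (sym (form-⊠ p p u u)) (⟨⟩-square-nonneg (⟦ p ⟧ u))

    form-lin : ∀ p a b u w → form p (λ i → a * u i + b * w i) (λ i → a * u i + b * w i) ≡
               a * a * form p u u + (a * b + a * b) * form p u w + b * b * form p w w
    form-lin p a b u w = begin
      ⟨ v , ⟦ p ⟧ v ⟩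
        ≡⟨ ⟨⟩-congʳ v (⟦⟧-lin p a b u w) ⟩
      ⟨ v , (λ i → a * ⟦ p ⟧ u i + b * ⟦ p ⟧ w i) ⟩
        ≡⟨ ⟨⟩-linʳ a b v (⟦ p ⟧ u) (⟦ p ⟧ w) ⟩
      a * ⟨ v , ⟦ p ⟧ u ⟩ + b * ⟨ v , ⟦ p ⟧ w ⟩
        ≡⟨ cong₂ (λ s t → a * s + b * t) (⟨⟩-linˡ a b (⟦ p ⟧ u) u w) (⟨⟩-linˡ a b (⟦ p ⟧ w) u w) ⟩
      a * (a * form p u u + b * form p w u) + b * (a * form p u w + b * form p w w)
        ≡⟨ cong (λ z → a * (a * form p u u + b * z) + b * (a * form p u w + b * form p w w)) (form-sym p w u) ⟩
      a * (a * form p u u + b * form p u w) + b * (a * form p u w + b * form p w w)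
        ≡⟨ arith a b (form p u u) (form p u w) (form p w w) ⟩
      a * a * form p u u + (a * b + a * b) * form p u w + b * b * form p w w ∎
      where
      v : Fin n → ℤ
      v i = a * u i + b * w i
      arith : ∀ a b x y z → a * (a * x + b * y) + b * (a * y + b * z) ≡ a * a * x + (a * b + a * b) * y + b * b * z
      arith = solve-∀

    private
      power-pol : ℕ → Pol
      power-pol zero    = con 1ℤ
      power-pol (suc k) = X ⊠ power-pol k

      power-⟦⟧ : ∀ k y i → power A k y i ≡ ⟦ power-pol k ⟧ y i
      power-⟦⟧ zero    y i = sym (ℤ.*-identityˡ (y i))
      power-⟦⟧ (suc k) y i = act-cong A (power-⟦⟧ k y) i

    power-scale : ∀ k c y i → power A k (λ j → c * y j) i ≡ c * power A k y i
    power-scale k c y i = trans (power-⟦⟧ k (λ j → c * y j) i)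
      (trans (⟦⟧-scale (power-pol k) c y i) (cong (c *_) (sym (power-⟦⟧ k y i))))

    power-+ : ∀ k y z i → power A k (λ j → y j + z j) i ≡ power A k y i + power A k z i
    power-+ k y z i = trans (power-⟦⟧ k (λ j → y j + z j) i)
      (trans (⟦⟧-+ (power-pol k) y z i) (sym (cong₂ _+_ (power-⟦⟧ k y i) (power-⟦⟧ k z i))))

    power-act : ∀ k y i → power A k (act A y) i ≡ power A (suc k) y i
    power-act k y i = trans (power-⟦⟧ k (act A y) i)
      (trans (sym (X-comm (power-pol k) y i)) (act-cong A (λ j → sym (power-⟦⟧ k y j)) i))

  module Isospectral {n} (A B : Matrix n) (A-sym : ∀ i j → A i j ≡ A j i) (B-sym : ∀ i j → B i j ≡ B j i)
                     (same : ∀ k → powerTrace A k ≡ powerTrace B k) where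
    private
      module A = Operator A A-sym
      module B = Operator B B-sym

    -- Operators r and s with tr (Aᵏ r) = tr (Bᵏ s) for all k; closed under
    -- composition with p(A), p(B), so no normal form of p is needed.
    Matching : ((Fin n → ℤ) → Fin n → ℤ) → ((Fin n → ℤ) → Fin n → ℤ) → Set
    Matching r s = ∀ k → sum (λ i → power A k (r (δ i)) i) ≡ sum (λ i → power B k (s (δ i)) i)

    matching : ∀ p {r s} → Matching r s → Matching (λ y → A.⟦ p ⟧ (r y)) (λ y → B.⟦ p ⟧ (s y))
    matching (con c) {r} {s} m k = begin
      sum (λ i → power A k (λ j → c * r (δ i) j) i) ≡⟨ sum-cong-≗ (λ i → A.power-scale k c (r (δ i)) i) ⟩
      sum (λ i → c * power A k (r (δ i)) i)         ≡⟨ sum-scale c (λ i → power A k (r (δ i)) i) ⟩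
      c * sum (λ i → power A k (r (δ i)) i)         ≡⟨ cong (c *_) (m k) ⟩
      c * sum (λ i → power B k (s (δ i)) i)         ≡⟨ sum-scale c (λ i → power B k (s (δ i)) i) ⟨
      sum (λ i → c * power B k (s (δ i)) i)         ≡⟨ sum-cong-≗ (λ i → B.power-scale k c (s (δ i)) i) ⟨
      sum (λ i → power B k (λ j → c * s (δ i) j) i) ∎
    -- A factor X is absorbed by passing from k to k + 1, which is why `Matching` speaks of all
    -- exponents.
    matching X {r} {s} m k = trans (sum-cong-≗ λ i → A.power-act k (r (δ i)) i)
      (trans (m (suc k)) (sym (sum-cong-≗ λ i → B.power-act k (s (δ i)) i)))
    matching (p ⊞ q) {r} {s} m k = begin
      sum (λ i → power A k (λ j → A.⟦ p ⟧ (r (δ i)) j + A.⟦ q ⟧ (r (δ i)) j) i)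
        ≡⟨ sum-cong-≗ (λ i → A.power-+ k (A.⟦ p ⟧ (r (δ i))) (A.⟦ q ⟧ (r (δ i))) i) ⟩
      sum (λ i → power A k (A.⟦ p ⟧ (r (δ i))) i + power A k (A.⟦ q ⟧ (r (δ i))) i)
        ≡⟨ ∑-distrib-+ (λ i → power A k (A.⟦ p ⟧ (r (δ i))) i) (λ i → power A k (A.⟦ q ⟧ (r (δ i))) i) ⟩
      sum (λ i → power A k (A.⟦ p ⟧ (r (δ i))) i) + sum (λ i → power A k (A.⟦ q ⟧ (r (δ i))) i)
        ≡⟨ cong₂ _+_ (matching p {r} {s} m k) (matching q {r} {s} m k) ⟩
      sum (λ i → power B k (B.⟦ p ⟧ (s (δ i))) i) + sum (λ i → power B k (B.⟦ q ⟧ (s (δ i))) i)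
        ≡⟨ ∑-distrib-+ (λ i → power B k (B.⟦ p ⟧ (s (δ i))) i) (λ i → power B k (B.⟦ q ⟧ (s (δ i))) i) ⟨
      sum (λ i → power B k (B.⟦ p ⟧ (s (δ i))) i + power B k (B.⟦ q ⟧ (s (δ i))) i)
        ≡⟨ sum-cong-≗ (λ i → B.power-+ k (B.⟦ p ⟧ (s (δ i))) (B.⟦ q ⟧ (s (δ i))) i) ⟨
      sum (λ i → power B k (λ j → B.⟦ p ⟧ (s (δ i)) j + B.⟦ q ⟧ (s (δ i)) j) i) ∎
    matching (p ⊠ q) {r} {s} m =
      matching p {λ y → A.⟦ q ⟧ (r y)} {λ y → B.⟦ q ⟧ (s y)} (matching q {r} {s} m)

    tr-equal : ∀ p → A.tr p ≡ B.tr p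
    tr-equal p = matching p {λ y → y} {λ y → y} same 0

    annihilator-transfer : ∀ p → p B.≋ con 0ℤ → p A.≋ con 0ℤ
    annihilator-transfer p p≋0 = A.tr-square≡0 p (trans (tr-equal (p ⊠ p)) (sum-zero λ i →
      B.⟦⟧-zero p (λ j → trans (p≋0 (δ i) j) (ℤ.*-zeroˡ (δ i j))) i))

-- The quadratic form of A has no positive definite plane

module OnePositiveEigenvalue where

  open import Data.Integer.Base using (ℤ; +_; _+_; _*_; -_; _-_; 0ℤ; 1ℤ; _≤_; _<_; +≤+; +<+)
  open Determinants
  open MatrixPolynomials

  open ≡-Reasoning

  *-pos : ∀ {x y} → 0ℤ < x → 0ℤ < y → 0ℤ < x * y
  *-pos {+ suc m} {+ suc n} _ _ = +<+ (ℕ.s≤s ℕ.z≤n)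
  *-pos {+ suc m} {+ zero} _ (+<+ ())
  *-pos {+ zero} (+<+ ()) _

  *-nonneg : ∀ {x y} → 0ℤ ≤ x → 0ℤ ≤ y → 0ℤ ≤ x * y
  *-nonneg {+ m} {+ n} _ _ = subst (0ℤ ≤_) (ℤ.pos-* m n) (+≤+ ℕ.z≤n)

  nonpos-if : ∀ {κ a r} → 0ℤ < κ → 0ℤ ≤ r → κ * a + r ≡ 0ℤ → a ≤ 0ℤ
  nonpos-if {κ} {a} {r} 0<κ 0≤r eq with ℤ.<-cmp 0ℤ a
  ... | tri< 0<a _ _    = ⊥-elim (ℤ.<-irrefl (sym eq) (ℤ.+-mono-<-≤ (*-pos 0<κ 0<a) 0≤r))
  ... | tri≈ _ 0≡a _    = ℤ.≤-reflexive (sym 0≡a)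
  ... | tri> _ _ a<0    = ℤ.<⇒≤ a<0

  nonneg-cancel : ∀ {κ a} → 0ℤ < κ → 0ℤ ≤ κ * a → 0ℤ ≤ a
  nonneg-cancel {κ} {a} 0<κ 0≤κa = subst (0ℤ ≤_) (ℤ.neg-involutive a)
    (ℤ.neg-mono-≤ (nonpos-if {κ} { - a} {κ * a} 0<κ 0≤κa (arith κ a)))
    where
    arith : ∀ κ a → κ * - a + κ * a ≡ 0ℤ
    arith = solve-∀

  *-cancel-≡0 : ∀ c x → 0ℤ < c → c * x ≡ 0ℤ → x ≡ 0ℤ
  *-cancel-≡0 c x 0<c eq = ℤ.*-cancelˡ-≡ c x 0ℤ {{ℤ.>-nonZero 0<c}} (trans eq (sym (ℤ.*-zeroʳ c)))

  ≤-from-diff : ∀ {a b} → a - b ≤ 0ℤ → a ≤ b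
  ≤-from-diff {a} {b} p = ℤ.i-j≤0⇒i≤j {a} {b} p

  -- F has the eigenvalues λ₁ > 0 > λ₂ as roots and h the eigenvalues 0, -1, -q.  As λ₁ + λ₂ = s,
  -- E = h(X) h(s - X) takes the value N = h(λ₁) h(λ₂) at both λ₁ and λ₂.
  module Polynomials (s d q : ℤ) where

    -- Pairing the factors of `h` and `h̄` gives x (s - x) = -(F + D), (x + 1)(s - x + 1) = -(F + B)
    -- and (x + q)(s - x + q) = -(F - G). Hence E = -(F + D)(F + B)(F - G), with constant term D B G
    -- = N as a polynomial in F; the remaining terms are -F w.
    S D Q B G F h h̄ E w : Pol
    S = con s
    D = con d
    Q = con q
    B = D ⊟ S ⊟ con 1ℤ
    G = Q ⊠ Q ⊞ Q ⊠ S ⊟ D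
    F = X ⊠ X ⊟ S ⊠ X ⊟ D
    h = X ⊠ (X ⊞ con 1ℤ) ⊠ (X ⊞ Q)
    h̄ = (S ⊟ X) ⊠ (S ⊟ X ⊞ con 1ℤ) ⊠ (S ⊟ X ⊞ Q)
    E = h ⊠ h̄
    w = F ⊠ F ⊞ (D ⊞ B ⊟ G) ⊠ F ⊞ (D ⊠ B ⊟ D ⊠ G ⊟ B ⊠ G)

    N : ℤ
    N = d * (d - s - 1ℤ) * (q * q + q * s - d)

  -- The coordinates of the bivector a ∧ b + d (a′ ∧ b′).
  wedge : ∀ {n} → ℤ → (a b a′ b′ : Fin n → ℤ) → Fin n → Fin n → ℤ
  wedge d a b a′ b′ i j = a i * b j - b i * a j + d * (a′ i * b′ j - b′ i * a′ j)

  wedge-contract : ∀ {n} d (a b a′ b′ u v : Fin n → ℤ) →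
    sum (λ i → sum λ j → wedge d a b a′ b′ i j * (u i * v j)) ≡
    ⟨ a , u ⟩ * ⟨ b , v ⟩ - ⟨ b , u ⟩ * ⟨ a , v ⟩ + d * (⟨ a′ , u ⟩ * ⟨ b′ , v ⟩ - ⟨ b′ , u ⟩ * ⟨ a′ , v ⟩)
  wedge-contract {n} d a b a′ b′ u v = begin
    sum (λ i → sum λ j → wedge d a b a′ b′ i j * (u i * v j))
      ≡⟨ sum-cong-≗ (λ i → trans (sum-cong-≗ λ j → split₁ d (a i) (b j) (b i) (a j) (a′ i) (b′ j) (b′ i) (a′ j) (u i) (v j))
           (four (a i * u i) (- (b i * u i)) (d * (a′ i * u i)) (- (d * (b′ i * u i)))
                 (λ j → b j * v j) (λ j → a j * v j) (λ j → b′ j * v j) (λ j → a′ j * v j))) ⟩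
    sum (λ i → a i * u i * ⟨ b , v ⟩ + - (b i * u i) * ⟨ a , v ⟩ + (d * (a′ i * u i) * ⟨ b′ , v ⟩ + - (d * (b′ i * u i)) * ⟨ a′ , v ⟩))
      ≡⟨ trans (sum-cong-≗ λ i → split₂ d (a i) (b i) (a′ i) (b′ i) (u i) ⟨ b , v ⟩ ⟨ a , v ⟩ ⟨ b′ , v ⟩ ⟨ a′ , v ⟩)
           (four ⟨ b , v ⟩ (- ⟨ a , v ⟩) (d * ⟨ b′ , v ⟩) (- (d * ⟨ a′ , v ⟩))
                 (λ i → a i * u i) (λ i → b i * u i) (λ i → a′ i * u i) (λ i → b′ i * u i)) ⟩
    ⟨ b , v ⟩ * ⟨ a , u ⟩ + - ⟨ a , v ⟩ * ⟨ b , u ⟩ + (d * ⟨ b′ , v ⟩ * ⟨ a′ , u ⟩ + - (d * ⟨ a′ , v ⟩) * ⟨ b′ , u ⟩)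
      ≡⟨ collect d ⟨ a , u ⟩ ⟨ b , u ⟩ ⟨ a′ , u ⟩ ⟨ b′ , u ⟩ ⟨ b , v ⟩ ⟨ a , v ⟩ ⟨ b′ , v ⟩ ⟨ a′ , v ⟩ ⟩
    ⟨ a , u ⟩ * ⟨ b , v ⟩ - ⟨ b , u ⟩ * ⟨ a , v ⟩ + d * (⟨ a′ , u ⟩ * ⟨ b′ , v ⟩ - ⟨ b′ , u ⟩ * ⟨ a′ , v ⟩) ∎
    where
    four : ∀ x y z t (f g k l : Fin n → ℤ) →
      sum (λ j → x * f j + y * g j + (z * k j + t * l j)) ≡ x * sum f + y * sum g + (z * sum k + t * sum l)
    four x y z t f g k l = trans
      (∑-distrib-+ (λ j → x * f j + y * g j) (λ j → z * k j + t * l j))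
      (cong₂ _+_ (sum-lin x y f g) (sum-lin z t k l))
    split₁ : ∀ d ai bj bi aj a′i b′j b′i a′j u v →
      (ai * bj - bi * aj + d * (a′i * b′j - b′i * a′j)) * (u * v) ≡
      ai * u * (bj * v) + - (bi * u) * (aj * v) + (d * (a′i * u) * (b′j * v) + - (d * (b′i * u)) * (a′j * v))
    split₁ = solve-∀
    split₂ : ∀ d a b a′ b′ u p q r t →
      a * u * p + - (b * u) * q + (d * (a′ * u) * r + - (d * (b′ * u)) * t) ≡
      p * (a * u) + - q * (b * u) + (d * r * (a′ * u) + - (d * t) * (b′ * u))
    split₂ = solve-∀
    collect : ∀ d au bu a′u b′u bv av b′v a′v →
      bv * au + - av * bu + (d * b′v * a′u + - (d * a′v) * b′u) ≡ au * bv - bu * av + d * (a′u * b′v - b′u * a′v)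
    collect = solve-∀

  wedge-square : ∀ {n} d (a b a′ b′ : Fin n → ℤ) →
    sum (λ i → sum λ j → wedge d a b a′ b′ i j * wedge d a b a′ b′ i j) ≡
    sum (λ i → sum λ j → wedge d a b a′ b′ i j * (a i * b j)) - sum (λ i → sum λ j → wedge d a b a′ b′ i j * (b i * a j))
    + d * (sum (λ i → sum λ j → wedge d a b a′ b′ i j * (a′ i * b′ j)) - sum (λ i → sum λ j → wedge d a b a′ b′ i j * (b′ i * a′ j)))
  wedge-square {n} d a b a′ b′ = begin
    sum (λ i → sum λ j → W i j * W i j)
      ≡⟨ sum-cong-≗ (λ i → trans (sum-cong-≗ λ j → split (W i j) d (a i) (b j) (b i) (a j) (a′ i) (b′ j) (b′ i) (a′ j))
           (four (λ j → W i j * (a i * b j)) (λ j → W i j * (b i * a j)) (λ j → W i j * (a′ i * b′ j)) (λ j → W i j * (b′ i * a′ j)))) ⟩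
    sum (λ i → 1ℤ * f i + - 1ℤ * g i + (d * k i + - d * l i))
      ≡⟨ four f g k l ⟩
    1ℤ * sum f + - 1ℤ * sum g + (d * sum k + - d * sum l)
      ≡⟨ collect d (sum f) (sum g) (sum k) (sum l) ⟩
    sum f - sum g + d * (sum k - sum l) ∎
    where
    W : Fin n → Fin n → ℤ
    W = wedge d a b a′ b′
    f g k l : Fin n → ℤ
    f i = sum λ j → W i j * (a i * b j)
    g i = sum λ j → W i j * (b i * a j)
    k i = sum λ j → W i j * (a′ i * b′ j)
    l i = sum λ j → W i j * (b′ i * a′ j)
    four : ∀ (f g k l : Fin n → ℤ) →
      sum (λ j → 1ℤ * f j + - 1ℤ * g j + (d * k j + - d * l j)) ≡ 1ℤ * sum f + - 1ℤ * sum g + (d * sum k + - d * sum l)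
    four f g k l = trans
      (∑-distrib-+ (λ j → 1ℤ * f j + - 1ℤ * g j) (λ j → d * k j + - d * l j))
      (cong₂ _+_ (sum-lin 1ℤ (- 1ℤ) f g) (sum-lin d (- d) k l))
    split : ∀ W d ai bj bi aj a′i b′j b′i a′j →
      W * (ai * bj - bi * aj + d * (a′i * b′j - b′i * a′j)) ≡
      1ℤ * (W * (ai * bj)) + - 1ℤ * (W * (bi * aj)) + (d * (W * (a′i * b′j)) + - d * (W * (b′i * a′j)))
    split = solve-∀
    collect : ∀ d f g k l → 1ℤ * f + - 1ℤ * g + (d * k + - d * l) ≡ f - g + d * (k - l)
    collect = solve-∀

  module _ {n} (A : Matrix n) (A-sym : ∀ i j → A i j ≡ A j i) (s d q : ℤ) where

    open Operator A A-sym
    open Polynomials s d q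

    open PolSolver using (solve; _:=_; _:+_; _:*_; _:-_; :-_) renaming (con to :con)

    con-N : con N ≋ D ⊠ B ⊠ G
    con-N y i = arith s d q (y i)
      where
      arith : ∀ s d q y → d * (d - s - 1ℤ) * (q * q + q * s - d) * y ≡
        d * ((d * (q * (q * y) + q * (s * y) + - 1ℤ * (d * y)) + - 1ℤ * (s * (q * (q * y) + q * (s * y) + - 1ℤ * (d * y))))
             + - 1ℤ * (1ℤ * (q * (q * y) + q * (s * y) + - 1ℤ * (d * y))))
      arith = solve-∀

    E-in-F : E ≋ con N ⊟ F ⊠ w
    E-in-F y i = trans (via-F X S D Q y i) (trans (expand F D B G y i) (cong (λ z → z + - 1ℤ * ⟦ F ⊠ w ⟧ y i) (sym (con-N y i))))
      where
      via-F : ∀ x s d q → let f = x ⊠ x ⊟ s ⊠ x ⊟ d ; b = d ⊟ s ⊟ con 1ℤ ; g = q ⊠ q ⊞ q ⊠ s ⊟ d in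
        (x ⊠ (x ⊞ con 1ℤ) ⊠ (x ⊞ q)) ⊠ ((s ⊟ x) ⊠ (s ⊟ x ⊞ con 1ℤ) ⊠ (s ⊟ x ⊞ q)) ≋ neg ((f ⊞ d) ⊠ (f ⊞ b) ⊠ (f ⊟ g))
      via-F = solve 4 (λ x s d q → let f = x :* x :- s :* x :- d ; b = d :- s :- :con 1ℤ ; g = q :* q :+ q :* s :- d in
        (x :* (x :+ :con 1ℤ) :* (x :+ q)) :* ((s :- x) :* (s :- x :+ :con 1ℤ) :* (s :- x :+ q)) := :- ((f :+ d) :* (f :+ b) :* (f :- g))) (λ y i → refl)
      expand : ∀ f d b g → neg ((f ⊞ d) ⊠ (f ⊞ b) ⊠ (f ⊟ g)) ≋
        d ⊠ b ⊠ g ⊟ f ⊠ (f ⊠ f ⊞ (d ⊞ b ⊟ g) ⊠ f ⊞ (d ⊠ b ⊟ d ⊠ g ⊟ b ⊠ g))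
      expand = solve 4 (λ f d b g → :- ((f :+ d) :* (f :+ b) :* (f :- g)) :=
        d :* b :* g :- f :* (f :* f :+ (d :+ b :- g) :* f :+ (d :* b :- d :* g :- b :* g))) (λ y i → refl)

  -- `N`, `E` and `w` are parameters here: the argument uses only the relations assumed below, and
  -- `E` does not unfold into its six factors.
  module OnePositive {n} (A : Matrix n) (A-sym : ∀ i j → A i j ≡ A j i) (s d q N : ℤ) (E w : Pol) where

    open Operator A A-sym
    open Polynomials s d q using (S; D; Q; F; h)

    module _ (0<d : 0ℤ < d) (0<N : 0ℤ < N) (1<q : 1ℤ < q) (Fh≡0 : ∀ y i → ⟦ F ⊠ h ⟧ y i ≡ 0ℤ)
        (FE≡0 : ∀ y i → ⟦ F ⊠ E ⟧ y i ≡ 0ℤ) (E-in-F : E ≋ con N ⊟ F ⊠ w) (tr-E : tr E ≡ + 2 * N)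
        (tr-M : tr (X ⊠ E) ≡ s * N) where

      open PolSolver using (solve; _:=_; _:+_; _:*_; _:-_; :-_) renaming (con to :con)

      M C : Pol
      M = X ⊠ E
      C = con N ⊟ E

      Vanishes : Pol → Set
      Vanishes p = ∀ y i → ⟦ p ⟧ y i ≡ 0ℤ

      private
        -- The relations below hold modulo F E and E² - N E. Each is a polynomial identity with an
        -- explicit combination of these two as remainder: the ring solver checks the identity, and
        -- the remainder acts as zero.
        drop : ∀ {p} q {r} → p ≋ q ⊞ r → Vanishes r → p ≋ q
        drop q {r} eq r≡0 y i = trans (eq y i) (trans (cong (λ z → ⟦ q ⟧ y i + z) (r≡0 y i)) (ℤ.+-identityʳ (⟦ q ⟧ y i)))

        vanish-⊞ : ∀ {p q} → Vanishes p → Vanishes q → Vanishes (p ⊞ q)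
        vanish-⊞ p≡0 q≡0 y i = cong₂ _+_ (p≡0 y i) (q≡0 y i)

        vanish-⊠ : ∀ p {q} → Vanishes q → Vanishes (p ⊠ q)
        vanish-⊠ p q≡0 y i = ⟦⟧-zero p (q≡0 y) i

        -- E = N - F w and F E = 0 give E² = N E, so E / N is a projection.
        E²-NE≡0 : Vanishes (E ⊠ E ⊟ con N ⊠ E)
        E²-NE≡0 y i = begin
          ⟦ E ⟧ z i + - 1ℤ * (N * z i)                                   ≡⟨ cong (_+ - 1ℤ * (N * z i)) (E-in-F z i) ⟩
          N * z i + - 1ℤ * ⟦ F ⟧ (⟦ w ⟧ z) i + - 1ℤ * (N * z i)          ≡⟨ cong (λ t → N * z i + - 1ℤ * t + - 1ℤ * (N * z i))
                                                                              (trans (⟦⟧-comm F w z i) (⟦⟧-zero w (FE≡0 y) i)) ⟩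
          N * z i + - 1ℤ * 0ℤ + - 1ℤ * (N * z i)                         ≡⟨ arith (N * z i) ⟩
          0ℤ ∎
          where
          z : Fin n → ℤ
          z = ⟦ E ⟧ y
          arith : ∀ x → x + - 1ℤ * 0ℤ + - 1ℤ * x ≡ 0ℤ
          arith = solve-∀

        E² : E ⊠ E ≋ con N ⊠ E
        E² = drop {E ⊠ E} (con N ⊠ E) {E ⊠ E ⊟ con N ⊠ E} (identity E (con N)) E²-NE≡0
          where
          identity : ∀ e n → e ⊠ e ≋ n ⊠ e ⊞ (e ⊠ e ⊟ n ⊠ e)
          identity = solve 2 (λ e n → e :* e := n :* e :+ (e :* e :- n :* e)) (λ y i → refl)

        ME : M ⊠ E ≋ con N ⊠ M
        ME = drop {M ⊠ E} (con N ⊠ M) {X ⊠ (E ⊠ E ⊟ con N ⊠ E)} (identity X E (con N)) (vanish-⊠ X {E ⊠ E ⊟ con N ⊠ E} E²-NE≡0)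
          where
          identity : ∀ x e n → x ⊠ e ⊠ e ≋ n ⊠ (x ⊠ e) ⊞ x ⊠ (e ⊠ e ⊟ n ⊠ e)
          identity = solve 3 (λ x e n → x :* e :* e := n :* (x :* e) :+ x :* (e :* e :- n :* e)) (λ y i → refl)

        -- As an operator this is X² E, since F E = 0.
        W : Pol
        W = S ⊠ M ⊞ D ⊠ E

        M² : M ⊠ M ≋ con N ⊠ W
        M² = drop {M ⊠ M} (con N ⊠ W) {X ⊠ X ⊠ (E ⊠ E ⊟ con N ⊠ E) ⊞ con N ⊠ (F ⊠ E)} (identity X E (con N) S D)
          (vanish-⊞ {X ⊠ X ⊠ (E ⊠ E ⊟ con N ⊠ E)} {con N ⊠ (F ⊠ E)} (vanish-⊠ (X ⊠ X) {E ⊠ E ⊟ con N ⊠ E} E²-NE≡0) (vanish-⊠ (con N) {F ⊠ E} FE≡0))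
          where
          identity : ∀ x e n s d → x ⊠ e ⊠ (x ⊠ e) ≋ n ⊠ (s ⊠ (x ⊠ e) ⊞ d ⊠ e) ⊞
            (x ⊠ x ⊠ (e ⊠ e ⊟ n ⊠ e) ⊞ n ⊠ ((x ⊠ x ⊟ s ⊠ x ⊟ d) ⊠ e))
          identity = solve 5 (λ x e n s d → x :* e :* (x :* e) := n :* (s :* (x :* e) :+ d :* e) :+
            (x :* x :* (e :* e :- n :* e) :+ n :* ((x :* x :- s :* x :- d) :* e))) (λ y i → refl)

        -- W² = N X⁴ E, and X⁴ is reduced modulo F to (s³ + 2 s d) X + s² d + d²; what remains are
        -- multiples of `M` and `E`, whose traces are known.
        W² : W ⊠ W ≋ con N ⊠ ((S ⊠ S ⊠ S ⊞ con (+ 2) ⊠ S ⊠ D) ⊠ M ⊞ (S ⊠ S ⊠ D ⊞ D ⊠ D) ⊠ E)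
        W² = drop {W ⊠ W} (con N ⊠ ((S ⊠ S ⊠ S ⊞ con (+ 2) ⊠ S ⊠ D) ⊠ M ⊞ (S ⊠ S ⊠ D ⊞ D ⊠ D) ⊠ E))
          {(S ⊠ X ⊞ D) ⊠ (S ⊠ X ⊞ D) ⊠ (E ⊠ E ⊟ con N ⊠ E) ⊞ con N ⊠ S ⊠ S ⊠ (F ⊠ E)} (identity X E (con N) S D)
          (vanish-⊞ {(S ⊠ X ⊞ D) ⊠ (S ⊠ X ⊞ D) ⊠ (E ⊠ E ⊟ con N ⊠ E)} {con N ⊠ S ⊠ S ⊠ (F ⊠ E)}
            (vanish-⊠ ((S ⊠ X ⊞ D) ⊠ (S ⊠ X ⊞ D)) {E ⊠ E ⊟ con N ⊠ E} E²-NE≡0) (vanish-⊠ (con N ⊠ S ⊠ S) {F ⊠ E} FE≡0))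
          where
          identity : ∀ x e n s d → (s ⊠ (x ⊠ e) ⊞ d ⊠ e) ⊠ (s ⊠ (x ⊠ e) ⊞ d ⊠ e) ≋
            n ⊠ ((s ⊠ s ⊠ s ⊞ con (+ 2) ⊠ s ⊠ d) ⊠ (x ⊠ e) ⊞ (s ⊠ s ⊠ d ⊞ d ⊠ d) ⊠ e) ⊞
            ((s ⊠ x ⊞ d) ⊠ (s ⊠ x ⊞ d) ⊠ (e ⊠ e ⊟ n ⊠ e) ⊞ n ⊠ s ⊠ s ⊠ ((x ⊠ x ⊟ s ⊠ x ⊟ d) ⊠ e))
          identity = solve 5 (λ x e n s d → (s :* (x :* e) :+ d :* e) :* (s :* (x :* e) :+ d :* e) :=
            n :* ((s :* s :* s :+ :con (+ 2) :* s :* d) :* (x :* e) :+ (s :* s :* d :+ d :* d) :* e) :+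
            ((s :* x :+ d) :* (s :* x :+ d) :* (e :* e :- n :* e) :+ n :* s :* s :* ((x :* x :- s :* x :- d) :* e))) (λ y i → refl)

        C-in-F : C ≋ F ⊠ w
        C-in-F y i = trans (cong (λ z → N * y i + - 1ℤ * z) (E-in-F y i)) (arith (N * y i) (⟦ F ⊠ w ⟧ y i))
          where
          arith : ∀ a b → a + - 1ℤ * (a + - 1ℤ * b) ≡ b
          arith = solve-∀

        C² : C ⊠ C ≋ con N ⊠ C
        C² = drop {C ⊠ C} (con N ⊠ C) {E ⊠ E ⊟ con N ⊠ E} (identity E (con N)) E²-NE≡0
          where
          identity : ∀ e n → (n ⊟ e) ⊠ (n ⊟ e) ≋ n ⊠ (n ⊟ e) ⊞ (e ⊠ e ⊟ n ⊠ e)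
          identity = solve 2 (λ e n → (n :- e) :* (n :- e) := n :* (n :- e) :+ (e :* e :- n :* e)) (λ y i → refl)

        hC≡0 : Vanishes (h ⊠ C)
        hC≡0 y i = trans (⟦⟧-cong h (C-in-F y) i) (trans (⟦⟧-comm h F (⟦ w ⟧ y) i) (Fh≡0 (⟦ w ⟧ y) i))

      κ : ℤ
      κ = q * ((q - 1ℤ) * (q - 1ℤ))

      private
        U V : Pol
        U = X ⊠ (X ⊞ Q) ⊠ C
        V = X ⊠ (X ⊞ con 1ℤ) ⊠ C

        -- On the roots 0, -1, -q of h one has - κ x = q (x (x + q))² + (x (x + 1))².
        negativity : Vanishes (con κ ⊠ (X ⊠ (C ⊠ C)) ⊞ (Q ⊠ (U ⊠ U) ⊞ V ⊠ V))
        negativity y i = begin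
          ⟦ con κ ⊠ (X ⊠ (C ⊠ C)) ⊞ (Q ⊠ (U ⊠ U) ⊞ V ⊠ V) ⟧ y i
            ≡⟨ cong (λ z → z + ⟦ Q ⊠ (U ⊠ U) ⊞ V ⊠ V ⟧ y i) (con-κ (⟦ X ⊠ (C ⊠ C) ⟧ y) i) ⟩
          ⟦ Q ⊠ ((Q ⊟ con 1ℤ) ⊠ (Q ⊟ con 1ℤ)) ⊠ (X ⊠ (C ⊠ C)) ⊞ (Q ⊠ (U ⊠ U) ⊞ V ⊠ V) ⟧ y i
            ≡⟨ identity Q X C y i ⟩
          -- The quotient of κ X + q (X (X + q))² + (X (X + 1))² by h is (q + 1) X + (q - 1)².
          ⟦ ((Q ⊞ con 1ℤ) ⊠ X ⊞ (Q ⊟ con 1ℤ) ⊠ (Q ⊟ con 1ℤ)) ⊠ C ⊠ (h ⊠ C) ⟧ y i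
            ≡⟨ ⟦⟧-zero (((Q ⊞ con 1ℤ) ⊠ X ⊞ (Q ⊟ con 1ℤ) ⊠ (Q ⊟ con 1ℤ)) ⊠ C) (hC≡0 y) i ⟩
          0ℤ ∎
          where
          con-κ : con κ ≋ Q ⊠ ((Q ⊟ con 1ℤ) ⊠ (Q ⊟ con 1ℤ))
          con-κ y i = arith q (y i)
            where
            arith : ∀ q y → q * ((q - 1ℤ) * (q - 1ℤ)) * y ≡ q * (q * (q * y + - 1ℤ * (1ℤ * y)) + - 1ℤ * (1ℤ * (q * y + - 1ℤ * (1ℤ * y))))
            arith = solve-∀
          identity : ∀ q x c → q ⊠ ((q ⊟ con 1ℤ) ⊠ (q ⊟ con 1ℤ)) ⊠ (x ⊠ (c ⊠ c)) ⊞
              (q ⊠ ((x ⊠ (x ⊞ q) ⊠ c) ⊠ (x ⊠ (x ⊞ q) ⊠ c)) ⊞ (x ⊠ (x ⊞ con 1ℤ) ⊠ c) ⊠ (x ⊠ (x ⊞ con 1ℤ) ⊠ c)) ≋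
            ((q ⊞ con 1ℤ) ⊠ x ⊞ (q ⊟ con 1ℤ) ⊠ (q ⊟ con 1ℤ)) ⊠ c ⊠ ((x ⊠ (x ⊞ con 1ℤ) ⊠ (x ⊞ q)) ⊠ c)
          identity = solve 3 (λ q x c → q :* ((q :- :con 1ℤ) :* (q :- :con 1ℤ)) :* (x :* (c :* c)) :+
              (q :* ((x :* (x :+ q) :* c) :* (x :* (x :+ q) :* c)) :+ (x :* (x :+ :con 1ℤ) :* c) :* (x :* (x :+ :con 1ℤ) :* c)) :=
            ((q :+ :con 1ℤ) :* x :+ (q :- :con 1ℤ) :* (q :- :con 1ℤ)) :* c :* ((x :* (x :+ :con 1ℤ) :* (x :+ q)) :* c)) (λ y i → refl)

      0<q : 0ℤ < q
      0<q = ℤ.<-trans (+<+ (ℕ.s≤s ℕ.z≤n)) 1<q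

      0<q-1 : 0ℤ < q - 1ℤ
      0<q-1 = ℤ.+-monoˡ-< (- 1ℤ) 1<q

      -- N X - M = X C, and N X C = X C² is negative semidefinite: by `negativity`, -κ times it is a
      -- nonnegative combination of squares.
      form-X≤M : ∀ u → N * form X u u ≤ form M u u
      form-X≤M u = ≤-from-diff {N * form X u u} {form M u u} (subst (_≤ 0ℤ) XC-split XC≤0)
        where
        sum-of-squares : ℤ
        sum-of-squares = q * form (U ⊠ U) u u + form (V ⊠ V) u u
        vanishing : κ * form (X ⊠ (C ⊠ C)) u u + sum-of-squares ≡ 0ℤ
        vanishing = begin
          κ * form (X ⊠ (C ⊠ C)) u u + (q * form (U ⊠ U) u u + form (V ⊠ V) u u)
            ≡⟨ sym (cong₂ _+_ (form-con κ (X ⊠ (C ⊠ C)) u u) (trans (form-⊞ (Q ⊠ (U ⊠ U)) (V ⊠ V) u u)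
                 (cong (_+ form (V ⊠ V) u u) (form-con q (U ⊠ U) u u)))) ⟩
          form (con κ ⊠ (X ⊠ (C ⊠ C))) u u + form (Q ⊠ (U ⊠ U) ⊞ V ⊠ V) u u
            ≡⟨ sym (form-⊞ (con κ ⊠ (X ⊠ (C ⊠ C))) (Q ⊠ (U ⊠ U) ⊞ V ⊠ V) u u) ⟩
          form (con κ ⊠ (X ⊠ (C ⊠ C)) ⊞ (Q ⊠ (U ⊠ U) ⊞ V ⊠ V)) u u
            ≡⟨ sum-zero (λ i → trans (cong (u i *_) (negativity u i)) (ℤ.*-zeroʳ (u i))) ⟩
          0ℤ ∎
        XCC≤0 : form (X ⊠ (C ⊠ C)) u u ≤ 0ℤ
        XCC≤0 = nonpos-if {κ} {form (X ⊠ (C ⊠ C)) u u} {sum-of-squares} (*-pos 0<q (*-pos 0<q-1 0<q-1))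
          (ℤ.+-mono-≤ (*-nonneg (ℤ.<⇒≤ 0<q) (form-square-nonneg U u)) (form-square-nonneg V u)) vanishing
        XCC : form (X ⊠ (C ⊠ C)) u u ≡ N * form (X ⊠ C) u u
        XCC = trans (⟨⟩-congʳ u (λ i → trans (⟦⟧-cong X (C² u) i) (⟦⟧-scale X N (⟦ C ⟧ u) i))) (form-con N (X ⊠ C) u u)
        XC≤0 : form (X ⊠ C) u u ≤ 0ℤ
        XC≤0 = nonpos-if {N} {form (X ⊠ C) u u} { - form (X ⊠ (C ⊠ C)) u u} 0<N (ℤ.neg-mono-≤ XCC≤0)
          (trans (cong (λ z → N * form (X ⊠ C) u u + - z) XCC) (ℤ.+-inverseʳ (N * form (X ⊠ C) u u)))
        XC-split : form (X ⊠ C) u u ≡ N * form X u u - form M u u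
        XC-split = begin
          form (X ⊠ C) u u                             ≡⟨ form-cong {X ⊠ C} {con N ⊠ X ⊞ con (- 1ℤ) ⊠ M} (distribute X (con N) E) u u ⟩
          form (con N ⊠ X ⊞ con (- 1ℤ) ⊠ M) u u        ≡⟨ form-⊞ (con N ⊠ X) (con (- 1ℤ) ⊠ M) u u ⟩
          form (con N ⊠ X) u u + form (con (- 1ℤ) ⊠ M) u u
            ≡⟨ cong₂ _+_ (form-con N X u u) (trans (form-con (- 1ℤ) M u u) (ℤ.-1*i≡-i (form M u u))) ⟩
          N * form X u u - form M u u                  ∎
          where
          distribute : ∀ x n e → x ⊠ (n ⊟ e) ≋ n ⊠ x ⊞ con (- 1ℤ) ⊠ (x ⊠ e)
          distribute = solve 3 (λ x n e → x :* (n :- e) := n :* x :+ :con (- 1ℤ) :* (x :* e)) (λ y i → refl)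

      private
        -- The entries of Λ²M + d Λ²E: on their common two-dimensional image, M/N is A, of determinant -d.
        Y : Fin n → Fin n → Fin n → Fin n → ℤ
        Y k l = wedge d (entry M k) (entry M l) (entry E k) (entry E l)

        minor₂ : Pol → Fin n → Fin n → ℤ
        minor₂ p k l = entry p k k * entry p l l - entry p k l * entry p k l

        -- Both sides are twice the second elementary symmetric function of the eigenvalues of p(A).
        sum-minor₂ : ∀ p → sum (λ k → sum λ l → minor₂ p k l) ≡ tr p * tr p - tr (p ⊠ p)
        sum-minor₂ p = begin
          sum (λ k → sum λ l → entry p k k * entry p l l - entry p k l * entry p k l)
            ≡⟨ sum-cong-≗ (λ k → trans (sum-cong-≗ λ l → minus (entry p k k * entry p l l) (entry p k l * entry p k l))
                 (sum-lin 1ℤ (- 1ℤ) (λ l → entry p k k * entry p l l) (λ l → entry p k l * entry p k l))) ⟩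
          sum (λ k → 1ℤ * sum (λ l → entry p k k * entry p l l) + - 1ℤ * sum (λ l → entry p k l * entry p k l))
            ≡⟨ sum-lin 1ℤ (- 1ℤ) (λ k → sum (λ l → entry p k k * entry p l l)) (λ k → sum λ l → entry p k l * entry p k l) ⟩
          1ℤ * sum (λ k → sum (λ l → entry p k k * entry p l l)) + - 1ℤ * sum (λ k → sum λ l → entry p k l * entry p k l)
            ≡⟨ cong₂ (λ x y → 1ℤ * x + - 1ℤ * y)
                 (trans (sum-cong-≗ λ k → sum-scale (entry p k k) (λ l → entry p l l)) (sym (*-distribʳ-sum (tr p) (λ k → entry p k k))))
                 (sym (tr-⊠ p p)) ⟩
          1ℤ * (tr p * tr p) + - 1ℤ * tr (p ⊠ p)
            ≡⟨ sym (minus (tr p * tr p) (tr (p ⊠ p))) ⟩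
          tr p * tr p - tr (p ⊠ p) ∎
          where
          minus : ∀ a b → a - b ≡ 1ℤ * a + - 1ℤ * b
          minus = solve-∀

        MM : ∀ k l → ⟨ entry M k , entry M l ⟩ ≡ N * entry W k l
        MM k l = trans (⟨⟩-comm (entry M k) (entry M l)) (trans (sym (entry-⊠ M M k l)) (M² (δ k) l))

        ME′ : ∀ k l → ⟨ entry M k , entry E l ⟩ ≡ N * entry M k l
        ME′ k l = trans (sym (entry-⊠ M E l k)) (trans (ME (δ l) k) (cong (N *_) (entry-sym M l k)))

        EE : ∀ k l → ⟨ entry E k , entry E l ⟩ ≡ N * entry E k l
        EE k l = trans (⟨⟩-comm (entry E k) (entry E l)) (trans (sym (entry-⊠ E E k l)) (E² (δ k) l))

        -- The inner products of rows of `M` and `E` are entries of M², M E and E², that is, of N W,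
        -- N M and N E.
        Y² : ∀ k l → sum (λ i → sum λ j → Y k l i j * Y k l i j) ≡
             + 2 * (N * N) * minor₂ W k l + + 4 * d * (N * N) * minor₂ M k l + + 2 * (d * d) * (N * N) * minor₂ E k l
        Y² k l = begin
          sum (λ i → sum λ j → Y k l i j * Y k l i j)
            ≡⟨ wedge-square d a b a′ b′ ⟩
          T a b - T b a + d * (T a′ b′ - T b′ a′)
            ≡⟨ cong₂ (λ x y → x + d * y) (cong₂ _-_ (contract a b) (contract b a)) (cong₂ _-_ (contract a′ b′) (contract b′ a′)) ⟩
          R a b - R b a + d * (R a′ b′ - R b′ a′)
            ≡⟨ cong₂ (λ x y → x + d * y) (cong₂ _-_ Rab Rba) (cong₂ _-_ Ra′b′ Rb′a′) ⟩
          _ ≡⟨ arith N d (entry W k k) (entry W l l) (entry W k l) (entry M k k) (entry M l l) (entry M k l) (entry E k k) (entry E l l) (entry E k l) ⟩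
          + 2 * (N * N) * minor₂ W k l + + 4 * d * (N * N) * minor₂ M k l + + 2 * (d * d) * (N * N) * minor₂ E k l ∎
          where
          a b a′ b′ : Fin n → ℤ
          a  = entry M k
          b  = entry M l
          a′ = entry E k
          b′ = entry E l
          T R : (Fin n → ℤ) → (Fin n → ℤ) → ℤ
          T u v = sum λ i → sum λ j → Y k l i j * (u i * v j)
          R u v = ⟨ a , u ⟩ * ⟨ b , v ⟩ - ⟨ b , u ⟩ * ⟨ a , v ⟩ + d * (⟨ a′ , u ⟩ * ⟨ b′ , v ⟩ - ⟨ b′ , u ⟩ * ⟨ a′ , v ⟩)
          contract : ∀ u v → T u v ≡ R u v
          contract u v = wedge-contract d a b a′ b′ u v
          combine : ∀ {x₁ x₂ x₃ x₄ x₅ x₆ x₇ x₈ y₁ y₂ y₃ y₄ y₅ y₆ y₇ y₈ : ℤ} →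
            x₁ ≡ y₁ → x₂ ≡ y₂ → x₃ ≡ y₃ → x₄ ≡ y₄ → x₅ ≡ y₅ → x₆ ≡ y₆ → x₇ ≡ y₇ → x₈ ≡ y₈ →
            x₁ * x₂ - x₃ * x₄ + d * (x₅ * x₆ - x₇ * x₈) ≡ y₁ * y₂ - y₃ * y₄ + d * (y₅ * y₆ - y₇ * y₈)
          combine refl refl refl refl refl refl refl refl = refl
          EM : ∀ k l → ⟨ entry E k , entry M l ⟩ ≡ N * entry M k l
          EM k l = trans (⟨⟩-comm (entry E k) (entry M l)) (trans (ME′ l k) (cong (N *_) (entry-sym M l k)))
          flip : ∀ {p} {x} → x ≡ N * entry p l k → x ≡ N * entry p k l
          flip {p} e = trans e (cong (N *_) (entry-sym p l k))
          Rab = combine (MM k k) (MM l l) (flip {W} (MM l k)) (MM k l) (EM k k) (EM l l) (flip {M} (EM l k)) (EM k l)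
          Rba = combine (MM k l) (flip {W} (MM l k)) (MM l l) (MM k k) (EM k l) (flip {M} (EM l k)) (EM l l) (EM k k)
          Ra′b′ = combine (ME′ k k) (ME′ l l) (flip {M} (ME′ l k)) (ME′ k l) (EE k k) (EE l l) (flip {E} (EE l k)) (EE k l)
          Rb′a′ = combine (ME′ k l) (flip {M} (ME′ l k)) (ME′ l l) (ME′ k k) (EE k l) (flip {E} (EE l k)) (EE l l) (EE k k)
          arith : ∀ N d wk wl w mk ml m ek el e →
            (N * wk * (N * wl) - N * w * (N * w) + d * (N * mk * (N * ml) - N * m * (N * m)))
            - (N * w * (N * w) - N * wl * (N * wk) + d * (N * m * (N * m) - N * ml * (N * mk)))
            + d * ((N * mk * (N * ml) - N * m * (N * m) + d * (N * ek * (N * el) - N * e * (N * e)))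
                 - (N * m * (N * m) - N * ml * (N * mk) + d * (N * e * (N * e) - N * el * (N * ek)))) ≡
            + 2 * (N * N) * (wk * wl - w * w) + + 4 * d * (N * N) * (mk * ml - m * m) + + 2 * (d * d) * (N * N) * (ek * el - e * e)
          arith = solve-∀

        -- Here the trace conditions enter: with tr E = 2 N and tr M = s N, the total squared norm
        -- of Λ²M + d Λ²E, a combination of second elementary symmetric functions, comes out as
        -- zero.
        sum-Y² : sum (λ k → sum λ l → sum λ i → sum λ j → Y k l i j * Y k l i j) ≡ 0ℤ
        sum-Y² = begin
          sum (λ k → sum λ l → sum λ i → sum λ j → Y k l i j * Y k l i j)
            ≡⟨ sum-cong-≗ (λ k → trans (sum-cong-≗ λ l → Y² k l) (three (minor₂ W k) (minor₂ M k) (minor₂ E k))) ⟩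
          sum (λ k → α * sum (minor₂ W k) + β * sum (minor₂ M k) + γ * sum (minor₂ E k))
            ≡⟨ three (λ k → sum (minor₂ W k)) (λ k → sum (minor₂ M k)) (λ k → sum (minor₂ E k)) ⟩
          α * sum (λ k → sum (minor₂ W k)) + β * sum (λ k → sum (minor₂ M k)) + γ * sum (λ k → sum (minor₂ E k))
            ≡⟨ cong₂ _+_ (cong₂ (λ x y → α * x + β * y) (trans (sum-minor₂ W) W-value) (trans (sum-minor₂ M) M-value))
                 (cong (γ *_) (trans (sum-minor₂ E) E-value)) ⟩
          _ ≡⟨ arith N d s ⟩
          0ℤ ∎
          where
          α β γ : ℤ
          α = + 2 * (N * N)
          β = + 4 * d * (N * N)
          γ = + 2 * (d * d) * (N * N)
          three : ∀ (f g k : Fin n → ℤ) → sum (λ l → α * f l + β * g l + γ * k l) ≡ α * sum f + β * sum g + γ * sum k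
          three f g k = trans (∑-distrib-+ (λ l → α * f l + β * g l) (λ l → γ * k l)) (cong₂ _+_ (sum-lin α β f g) (sum-scale γ k))
          tr-W : tr W ≡ s * (s * N) + d * (+ 2 * N)
          tr-W = trans (tr-⊞ (S ⊠ M) (D ⊠ E)) (cong₂ _+_ (trans (tr-con s M) (cong (s *_) tr-M)) (trans (tr-con d E) (cong (d *_) tr-E)))
          W₂ : Pol
          W₂ = (S ⊠ S ⊠ S ⊞ con (+ 2) ⊠ S ⊠ D) ⊠ M ⊞ (S ⊠ S ⊠ D ⊞ D ⊠ D) ⊠ E
          W-value : tr W * tr W - tr (W ⊠ W) ≡ (s * (s * N) + d * (+ 2 * N)) * (s * (s * N) + d * (+ 2 * N))
            - N * ((s * (s * (s * (s * N))) + + 2 * (s * (d * (s * N)))) + (s * (s * (d * (+ 2 * N))) + d * (d * (+ 2 * N))))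
          W-value = cong₂ (λ x y → x * x - y) tr-W (trans (tr-cong {W ⊠ W} {con N ⊠ W₂} W²) (trans (tr-con N W₂) (cong (N *_)
            (trans (tr-⊞ ((S ⊠ S ⊠ S ⊞ con (+ 2) ⊠ S ⊠ D) ⊠ M) ((S ⊠ S ⊠ D ⊞ D ⊠ D) ⊠ E)) (cong₂ _+_
              (trans (tr-⊞ (S ⊠ (S ⊠ (S ⊠ M))) (con (+ 2) ⊠ (S ⊠ (D ⊠ M)))) (cong₂ _+_
                (con₃ s s s M tr-M) (con₃ (+ 2) s d M tr-M)))
              (trans (tr-⊞ (S ⊠ (S ⊠ (D ⊠ E))) (D ⊠ (D ⊠ E))) (cong₂ _+_ (con₃ s s d E tr-E)
                (trans (tr-con d (D ⊠ E)) (cong (d *_) (trans (tr-con d E) (cong (d *_) tr-E)))))))))))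
            where
            con₃ : ∀ a b c p {t} → tr p ≡ t → tr (con a ⊠ (con b ⊠ (con c ⊠ p))) ≡ a * (b * (c * t))
            con₃ a b c p eq = trans (tr-con a (con b ⊠ (con c ⊠ p))) (cong (a *_) (trans (tr-con b (con c ⊠ p)) (cong (b *_) (trans (tr-con c p) (cong (c *_) eq)))))
          M-value : tr M * tr M - tr (M ⊠ M) ≡ s * N * (s * N) - N * (s * (s * N) + d * (+ 2 * N))
          M-value = cong₂ (λ x y → x * x - y) tr-M (trans (tr-cong {M ⊠ M} {con N ⊠ W} M²) (trans (tr-con N W) (cong (N *_) tr-W)))
          E-value : tr E * tr E - tr (E ⊠ E) ≡ + 2 * N * (+ 2 * N) - N * (+ 2 * N)
          E-value = cong₂ (λ x y → x * x - y) tr-E (trans (tr-cong {E ⊠ E} {con N ⊠ E} E²) (trans (tr-con N E) (cong (N *_) tr-E)))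
          arith : ∀ N d s → + 2 * (N * N) * ((s * (s * N) + d * (+ 2 * N)) * (s * (s * N) + d * (+ 2 * N))
              - N * ((s * (s * (s * (s * N))) + + 2 * (s * (d * (s * N)))) + (s * (s * (d * (+ 2 * N))) + d * (d * (+ 2 * N)))))
            + + 4 * d * (N * N) * (s * N * (s * N) - N * (s * (s * N) + d * (+ 2 * N)))
            + + 2 * (d * d) * (N * N) * (+ 2 * N * (+ 2 * N) - N * (+ 2 * N)) ≡ 0ℤ
          arith = solve-∀

        Y≡0 : ∀ k l i j → Y k l i j ≡ 0ℤ
        Y≡0 k l i j = square≡0 (Y k l i j)
          (sum-nonneg-≡0 (λ j → sq k l i j)
            (sum-nonneg-≡0 (λ i → sum-nonneg λ j → sq k l i j)
              (sum-nonneg-≡0 (λ l → sum-nonneg λ i → sum-nonneg λ j → sq k l i j)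
                (sum-nonneg-≡0 (λ k → sum-nonneg λ l → sum-nonneg λ i → sum-nonneg λ j → sq k l i j) sum-Y² k) l) i) j)
          where
          sq : ∀ k l i j → 0ℤ ≤ Y k l i j * Y k l i j
          sq k l i j = square-nonneg (Y k l i j)

        Y-vectors : ∀ u v i j → wedge d (⟦ M ⟧ u) (⟦ M ⟧ v) (⟦ E ⟧ u) (⟦ E ⟧ v) i j ≡ 0ℤ
        Y-vectors u v i j = begin
          ⟦ M ⟧ u i * ⟦ M ⟧ v j - ⟦ M ⟧ v i * ⟦ M ⟧ u j + d * (⟦ E ⟧ u i * ⟦ E ⟧ v j - ⟦ E ⟧ v i * ⟦ E ⟧ u j)
            ≡⟨ combine (⟦⟧-entries M u i) (⟦⟧-entries M v j) (⟦⟧-entries M v i) (⟦⟧-entries M u j)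
                       (⟦⟧-entries E u i) (⟦⟧-entries E v j) (⟦⟧-entries E v i) (⟦⟧-entries E u j) ⟩
          ⟨ entry M i , u ⟩ * ⟨ entry M j , v ⟩ - ⟨ entry M j , u ⟩ * ⟨ entry M i , v ⟩
            + d * (⟨ entry E i , u ⟩ * ⟨ entry E j , v ⟩ - ⟨ entry E j , u ⟩ * ⟨ entry E i , v ⟩)
            ≡⟨ sym (wedge-contract d (entry M i) (entry M j) (entry E i) (entry E j) u v) ⟩
          sum (λ k → sum λ l → Y i j k l * (u k * v l))
            ≡⟨ sum-zero (λ k → sum-zero λ l → trans (cong (_* (u k * v l)) (Y≡0 i j k l)) (ℤ.*-zeroˡ (u k * v l))) ⟩
          0ℤ ∎
          where
          combine : ∀ {x₁ x₂ x₃ x₄ x₅ x₆ x₇ x₈ y₁ y₂ y₃ y₄ y₅ y₆ y₇ y₈ : ℤ} →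
            x₁ ≡ y₁ → x₂ ≡ y₂ → x₃ ≡ y₃ → x₄ ≡ y₄ → x₅ ≡ y₅ → x₆ ≡ y₆ → x₇ ≡ y₇ → x₈ ≡ y₈ →
            x₁ * x₂ - x₃ * x₄ + d * (x₅ * x₆ - x₇ * x₈) ≡ y₁ * y₂ - y₄ * y₃ + d * (y₅ * y₆ - y₈ * y₇)
          combine {x₁} {x₂} {x₃} {x₄} {x₅} {x₆} {x₇} {x₈} refl refl refl refl refl refl refl refl =
            cong₂ (λ a b → x₁ * x₂ - a + d * (x₅ * x₆ - b)) (ℤ.*-comm x₃ x₄) (ℤ.*-comm x₇ x₈)

      -- Λ²M + d Λ²E = 0, evaluated at u ∧ v: the Gram determinant of `M` is -d times that of `E`.
      form-minor₂ : ∀ u v → form M u u * form M v v - form M u v * form M u v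
                    + d * (form E u u * form E v v - form E u v * form E u v) ≡ 0ℤ
      form-minor₂ u v = begin
        form M u u * form M v v - form M u v * form M u v + d * (form E u u * form E v v - form E u v * form E u v)
          ≡⟨ combine (⟨⟩-comm u (⟦ M ⟧ u)) (⟨⟩-comm v (⟦ M ⟧ v)) (⟨⟩-comm u (⟦ M ⟧ v)) (trans (form-sym M u v) (⟨⟩-comm v (⟦ M ⟧ u)))
                     (⟨⟩-comm u (⟦ E ⟧ u)) (⟨⟩-comm v (⟦ E ⟧ v)) (⟨⟩-comm u (⟦ E ⟧ v)) (trans (form-sym E u v) (⟨⟩-comm v (⟦ E ⟧ u))) ⟩
        ⟨ ⟦ M ⟧ u , u ⟩ * ⟨ ⟦ M ⟧ v , v ⟩ - ⟨ ⟦ M ⟧ v , u ⟩ * ⟨ ⟦ M ⟧ u , v ⟩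
          + d * (⟨ ⟦ E ⟧ u , u ⟩ * ⟨ ⟦ E ⟧ v , v ⟩ - ⟨ ⟦ E ⟧ v , u ⟩ * ⟨ ⟦ E ⟧ u , v ⟩)
          ≡⟨ sym (wedge-contract d (⟦ M ⟧ u) (⟦ M ⟧ v) (⟦ E ⟧ u) (⟦ E ⟧ v) u v) ⟩
        sum (λ i → sum λ j → wedge d (⟦ M ⟧ u) (⟦ M ⟧ v) (⟦ E ⟧ u) (⟦ E ⟧ v) i j * (u i * v j))
          ≡⟨ sum-zero (λ i → sum-zero λ j → trans (cong (_* (u i * v j)) (Y-vectors u v i j)) (ℤ.*-zeroˡ (u i * v j))) ⟩
        0ℤ ∎
        where
        combine : ∀ {x₁ x₂ x₃ x₄ x₅ x₆ y₁ y₂ y₃ y₄ y₅ y₆ y₇ y₈ : ℤ} →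
          x₁ ≡ y₁ → x₂ ≡ y₂ → x₃ ≡ y₃ → x₃ ≡ y₄ → x₄ ≡ y₅ → x₅ ≡ y₆ → x₆ ≡ y₇ → x₆ ≡ y₈ →
          x₁ * x₂ - x₃ * x₃ + d * (x₄ * x₅ - x₆ * x₆) ≡ y₁ * y₂ - y₃ * y₄ + d * (y₅ * y₆ - y₇ * y₈)
        combine refl refl refl refl refl refl refl refl = refl

      -- On such a plane `M`, which dominates N X, would be positive definite and have a positive
      -- Gram determinant. By `form-minor₂` that determinant is -d times the one of `E`, and `E` is
      -- positive semidefinite.
      no-positive-plane : ∀ u v → form X u u ≡ + 2 → form X v v ≡ + 2 → form X u v ≡ 0ℤ → ⊥
      no-positive-plane u v Quu Qvv Quv = ℤ.<⇒≱ 0<minor minor≤0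
        where
        a c e a′ c′ e′ : ℤ
        a = form M u u
        c = form M u v
        e = form M v v
        a′ = form E u u
        c′ = form E u v
        e′ = form E v v

        NE : ∀ y → N * form E y y ≡ ⟨ ⟦ E ⟧ y , ⟦ E ⟧ y ⟩
        NE y = trans (sym (form-con N E y y)) (trans (sym (form-cong {E ⊠ E} {con N ⊠ E} E² y y)) (form-⊠ E E y y))

        E≥0 : ∀ y → 0ℤ ≤ form E y y
        E≥0 y = nonneg-cancel 0<N (subst (0ℤ ≤_) (sym (NE y)) (⟨⟩-square-nonneg (⟦ E ⟧ y)))

        0<a : 0ℤ < a
        0<a = ℤ.<-≤-trans (*-pos 0<N (subst (0ℤ <_) (sym Quu) (+<+ (ℕ.s≤s ℕ.z≤n)))) (form-X≤M u)

        -- If the form of E vanished at u, then E u = 0, hence M u = X E u = 0, against 0 < a.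
        0<a′ : 0ℤ < a′
        0<a′ = ℤ.≤∧≢⇒< (E≥0 u) λ 0≡a′ → ℤ.<-irrefl (sym (sum-zero (λ i → trans (cong (u i *_) (⟦⟧-zero X
          (⟨⟩-square≡0 (⟦ E ⟧ u) (trans (sym (NE u)) (trans (cong (N *_) (sym 0≡a′)) (ℤ.*-zeroʳ N)))) i)) (ℤ.*-zeroʳ (u i))))) 0<a

        -- With x, y, z the values of a form at (u, u), (u, v), (v, v), the vector -y u + x v is
        -- orthogonal to u, and the form takes there the value x times its Gram determinant.
        scaled : ∀ x y z → (- y) * (- y) * x + (- y * x + - y * x) * y + x * x * z ≡ x * (x * z - y * y)
        scaled = solve-∀

        0≤minor′ : 0ℤ ≤ a′ * e′ - c′ * c′
        0≤minor′ = nonneg-cancel 0<a′ (subst (0ℤ ≤_) (trans (form-lin E (- c′) a′ u v) (scaled a′ c′ e′)) (E≥0 (λ i → - c′ * u i + a′ * v i)))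

        minor≤0 : a * e - c * c ≤ 0ℤ
        minor≤0 = nonpos-if {1ℤ} {a * e - c * c} {d * (a′ * e′ - c′ * c′)} (+<+ (ℕ.s≤s ℕ.z≤n)) (*-nonneg (ℤ.<⇒≤ 0<d) 0≤minor′)
          (trans (cong (_+ d * (a′ * e′ - c′ * c′)) (ℤ.*-identityˡ (a * e - c * c))) (form-minor₂ u v))

        y : Fin n → ℤ
        y i = - c * u i + a * v i

        form-X-y : form X y y ≡ + 2 * (c * c) + + 2 * (a * a)
        form-X-y = trans (form-lin X (- c) a u v) (trans
          (cong₂ (λ p q → p + (- c * a + - c * a) * form X u v + q) (cong (- c * - c *_) Quu) (cong (a * a *_) Qvv))
          (trans (cong (λ z → - c * - c * + 2 + (- c * a + - c * a) * z + a * a * + 2) Quv) (arith a c)))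
          where
          arith : ∀ a c → - c * - c * + 2 + (- c * a + - c * a) * 0ℤ + a * a * + 2 ≡ + 2 * (c * c) + + 2 * (a * a)
          arith = solve-∀

        0<X-y : 0ℤ < form X y y
        0<X-y = subst (0ℤ <_) (sym form-X-y) (ℤ.+-mono-≤-< (*-nonneg {+ 2} (+≤+ ℕ.z≤n) (square-nonneg c)) (*-pos {+ 2} (+<+ (ℕ.s≤s ℕ.z≤n)) (*-pos 0<a 0<a)))

        0<a*minor : 0ℤ < a * (a * e - c * c)
        0<a*minor = subst (0ℤ <_) (trans (form-lin M (- c) a u v) (scaled a c e)) (ℤ.<-≤-trans (*-pos 0<N 0<X-y) (form-X≤M y))

        0<minor : 0ℤ < a * e - c * c
        0<minor = ℤ.≤∧≢⇒< (nonneg-cancel 0<a (ℤ.<⇒≤ 0<a*minor)) λ 0≡ → ℤ.<-irrefl (sym (trans (cong (a *_) (sym 0≡)) (ℤ.*-zeroʳ a))) 0<a*minor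

      form-δ : ∀ i j → form X (δ i) (δ j) ≡ A i j
      form-δ i j = trans (⟨δ,⟩ i (act A (δ j))) (trans (⟨⟩-comm (A i) (δ j)) (⟨δ,⟩ j (A i)))

      -- u = e_z + e_t and v = e_x + e_y - (A t x + A t y) e_z span a plane on which
      -- the quadratic form of A is positive definite.
      no-edge-from : ∀ x y z t → (∀ i → A i i ≡ 0ℤ) → A x y ≡ 1ℤ → A z x ≡ 0ℤ → A z y ≡ 0ℤ → A z t ≢ 1ℤ
      no-edge-from x y z t diag xy zx zy zt = no-positive-plane u v Quu Qvv Quv
        where
        α : ℤ
        α = A t x + A t y
        u xy′ v : Fin n → ℤ
        u   i = 1ℤ * δ z i + 1ℤ * δ t i
        xy′ i = 1ℤ * δ x i + 1ℤ * δ y i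
        v   i = 1ℤ * xy′ i + - α * δ z i
        two : ∀ i j → A i j ≡ 1ℤ → form X (λ k → 1ℤ * δ i k + 1ℤ * δ j k) (λ k → 1ℤ * δ i k + 1ℤ * δ j k) ≡ + 2
        two i j ij = trans (form-lin X 1ℤ 1ℤ (δ i) (δ j))
          (trans (cong₂ (λ p q → 1ℤ * 1ℤ * p + (1ℤ * 1ℤ + 1ℤ * 1ℤ) * form X (δ i) (δ j) + 1ℤ * 1ℤ * q)
                    (trans (form-δ i i) (diag i)) (trans (form-δ j j) (diag j)))
                 (cong (λ r → 1ℤ * 1ℤ * 0ℤ + (1ℤ * 1ℤ + 1ℤ * 1ℤ) * r + 1ℤ * 1ℤ * 0ℤ) (trans (form-δ i j) ij)))
        Quu : form X u u ≡ + 2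
        Quu = two z t zt
        δ-xy : ∀ k → form X (δ k) xy′ ≡ A k x + A k y
        δ-xy k = trans (⟨⟩-congʳ (δ k) (⟦⟧-lin X 1ℤ 1ℤ (δ x) (δ y))) (trans (⟨⟩-linʳ 1ℤ 1ℤ (δ k) (act A (δ x)) (act A (δ y)))
          (trans (cong₂ (λ p q → 1ℤ * p + 1ℤ * q) (form-δ k x) (form-δ k y)) (arith (A k x) (A k y))))
          where
          arith : ∀ p q → 1ℤ * p + 1ℤ * q ≡ p + q
          arith = solve-∀
        Qvv : form X v v ≡ + 2
        Qvv = trans (form-lin X 1ℤ (- α) xy′ (δ z)) (trans
          (cong₂ (λ p q → 1ℤ * 1ℤ * p + (1ℤ * - α + 1ℤ * - α) * form X xy′ (δ z) + - α * - α * q) (two x y xy) (trans (form-δ z z) (diag z)))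
          (trans (cong (λ r → 1ℤ * 1ℤ * + 2 + (1ℤ * - α + 1ℤ * - α) * r + - α * - α * 0ℤ)
            (trans (form-sym X xy′ (δ z)) (trans (δ-xy z) (cong₂ _+_ zx zy)))) (arith α)))
          where
          arith : ∀ α → 1ℤ * 1ℤ * + 2 + (1ℤ * - α + 1ℤ * - α) * 0ℤ + - α * - α * 0ℤ ≡ + 2
          arith = solve-∀
        δ-v : ∀ k → form X (δ k) v ≡ A k x + A k y + - α * A k z
        δ-v k = trans (⟨⟩-congʳ (δ k) (⟦⟧-lin X 1ℤ (- α) xy′ (δ z))) (trans (⟨⟩-linʳ 1ℤ (- α) (δ k) (act A xy′) (act A (δ z)))
          (trans (cong₂ (λ p q → 1ℤ * p + - α * q) (δ-xy k) (form-δ k z)) (cong (_+ - α * A k z) (ℤ.*-identityˡ (A k x + A k y)))))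
        Quv : form X u v ≡ 0ℤ
        Quv = trans (⟨⟩-linˡ 1ℤ 1ℤ (act A v) (δ z) (δ t)) (trans (cong₂ (λ p q → 1ℤ * p + 1ℤ * q)
          (trans (δ-v z) (trans (cong₂ _+_ (cong₂ _+_ zx zy) (cong (- α *_) (diag z))) (zeros α)))
          (trans (δ-v t) (trans (cong (λ r → α + - α * r) (trans (A-sym t z) zt)) (cancel α)))) refl)
          where
          zeros : ∀ α → 0ℤ + 0ℤ + - α * 0ℤ ≡ 0ℤ
          zeros = solve-∀
          cancel : ∀ α → α + - α * 1ℤ ≡ 0ℤ
          cancel = solve-∀

-- Partial equivalence relations and complete multipartite graphs

module Partitions where

  open import Data.Integer.Base using (ℤ; +_; _+_; _*_; -_; _-_; 0ℤ; 1ℤ; _≤_; +≤+)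
  open Determinants
  open MatrixPolynomials
  open OnePositiveEigenvalue

  open ≡-Reasoning

  𝟙 : Bool → ℤ
  𝟙 b = if b then 1ℤ else 0ℤ

  𝟙-nonneg : ∀ b → 0ℤ ≤ 𝟙 b
  𝟙-nonneg true  = +≤+ ℕ.z≤n
  𝟙-nonneg false = +≤+ ℕ.z≤n

  𝟙-idem : ∀ b → 𝟙 b * 𝟙 b ≡ 𝟙 b
  𝟙-idem true  = refl
  𝟙-idem false = refl

  𝟙-not : ∀ b → 𝟙 (not b) ≡ 1ℤ - 𝟙 b
  𝟙-not true  = refl
  𝟙-not false = refl

  sum-mono : ∀ {n} {f g : Fin n → ℤ} → (∀ i → f i ≤ g i) → sum f ≤ sum g
  sum-mono {zero}  f≤g = ℤ.≤-refl
  sum-mono {suc n} f≤g = ℤ.+-mono-≤ (f≤g zero) (sum-mono (f≤g ∘ suc))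

  sum-mono-≡ : ∀ {n} {f g : Fin n → ℤ} → (∀ i → f i ≤ g i) → sum f ≡ sum g → ∀ i → f i ≡ g i
  sum-mono-≡ {n} {f} {g} f≤g eq i = sym (ℤ.i-j≡0⇒i≡j (g i) (f i)
    (sum-nonneg-≡0 (λ j → ℤ.i≤j⇒0≤j-i (f≤g j)) (begin
      sum (λ j → g j - f j)               ≡⟨ sum-cong-≗ (λ j → minus (g j) (f j)) ⟩
      sum (λ j → 1ℤ * g j + - 1ℤ * f j)   ≡⟨ sum-lin 1ℤ (- 1ℤ) g f ⟩
      1ℤ * sum g + - 1ℤ * sum f           ≡⟨ cong (λ z → 1ℤ * sum g + - 1ℤ * z) eq ⟩
      1ℤ * sum g + - 1ℤ * sum g           ≡⟨ cancel (sum g) ⟩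
      0ℤ                                  ∎) i))
    where
    minus : ∀ a b → a - b ≡ 1ℤ * a + - 1ℤ * b
    minus = solve-∀
    cancel : ∀ a → 1ℤ * a + - 1ℤ * a ≡ 0ℤ
    cancel = solve-∀

  term≤sum : ∀ {n} {f : Fin n → ℤ} → (∀ i → 0ℤ ≤ f i) → ∀ i → f i ≤ sum f
  term≤sum {suc n} {f} f≥0 zero    = subst (_≤ sum f) (ℤ.+-identityʳ (f zero)) (ℤ.+-monoʳ-≤ (f zero) (sum-nonneg (f≥0 ∘ suc)))
  term≤sum {suc n} {f} f≥0 (suc i) = subst (_≤ sum f) (ℤ.+-identityˡ (f (suc i))) (ℤ.+-mono-≤ (f≥0 zero) (term≤sum (f≥0 ∘ suc) i))

  triangles-cong : ∀ {n n° s s° r r° : ℤ} → n ≡ n° → s ≡ s° → r ≡ r° →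
    n * n * n - + 3 * (n * s) + + 2 * r ≡ n° * n° * n° - + 3 * (n° * s°) + + 2 * r°
  triangles-cong refl refl refl = refl

  does-true : ∀ {A : Set} (d : Dec A) → does d ≡ true → A
  does-true (yes a) _ = a

  -- Symmetric and transitive only: a point may lie in no class. Then `ν` is 0 there, and so is
  -- `size`.
  module PER {n} (β : Fin n → Fin n → Bool)
    (β-sym : ∀ i j → β i j ≡ β j i)
    (β-trans : ∀ {i j k} → β i j ≡ true → β j k ≡ true → β i k ≡ true) where

    b : Fin n → Fin n → ℤ
    b i j = 𝟙 (β i j)

    ν size : Fin n → ℤ
    ν i = b i i
    size i = sum (b i)

    β-rows : ∀ {i j} → β i j ≡ true → ∀ k → β i k ≡ β j k
    β-rows {i} {j} ij k with β i k in ik | β j k in jk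
    ... | true  | true  = refl
    ... | false | false = refl
    ... | true  | false = ⊥-elim (true≢false (trans (sym (β-trans (trans (β-sym j i) ij) ik)) jk))
      where
      true≢false : true ≢ false
      true≢false ()
    ... | false | true  = trans (sym ik) (β-trans ij jk)

    size-const : ∀ {i j} → β i j ≡ true → size i ≡ size j
    size-const ij = sum-cong-≗ λ k → cong 𝟙 (β-rows ij k)

    β⇒support : ∀ {i j} → β i j ≡ true → β i i ≡ true
    β⇒support {i} {j} ij = β-trans ij (trans (β-sym j i) ij)

    ClassConst : (Fin n → ℤ) → Set
    ClassConst y = ∀ i j → β i j ≡ true → y i ≡ y j

    class-sum : ∀ y → ClassConst y → ∀ i → ⟨ b i , y ⟩ ≡ size i * y i
    class-sum y const i = trans (sum-cong-≗ term) (sym (*-distribʳ-sum (y i) (b i)))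
      where
      term : ∀ j → b i j * y j ≡ b i j * y i
      term j with β i j in ij
      ... | true  = cong (1ℤ *_) (sym (const i j ij))
      ... | false = trans (ℤ.*-zeroˡ (y j)) (sym (ℤ.*-zeroˡ (y i)))

    b-const : ∀ i → ClassConst (b i)
    b-const i j k jk = cong 𝟙 (trans (β-sym i j) (trans (β-rows jk i) (β-sym k i)))

    ν-const : ClassConst ν
    ν-const i j ij = trans (cong 𝟙 (β⇒support ij)) (sym (cong 𝟙 (β⇒support (trans (β-sym j i) ij))))

    b*ν : ∀ i j → b i j * ν j ≡ b i j
    b*ν i j with β i j in ij
    ... | false = ℤ.*-zeroˡ (ν j)
    ... | true  = trans (ℤ.*-identityˡ (ν j)) (cong 𝟙 (β⇒support (trans (β-sym j i) ij)))

    ν*b : ∀ i j → ν i * b i j ≡ b i j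
    ν*b i j with β i j in ij
    ... | false = ℤ.*-zeroʳ (ν i)
    ... | true  = trans (ℤ.*-identityʳ (ν i)) (cong 𝟙 (β⇒support ij))

    size*ν : ∀ i → size i * ν i ≡ size i
    size*ν i = trans (sym (class-sum ν ν-const i)) (sum-cong-≗ (b*ν i))

    ν≤size : ∀ i → ν i ≤ size i
    ν≤size i = term≤sum (λ j → 𝟙-nonneg (β i j)) i

    -- Sums over points, not over classes: in terms of the class sizes these are the sum, the sum of
    -- squares and the sum of cubes.
    n′ s₁ s₂ : ℤ
    n′ = sum ν
    s₁ = sum size
    s₂ = sum λ i → size i * size i

    -- The adjacency matrix of the complete multipartite graph with the classes as parts;
    -- points outside the support are isolated.
    multi : Matrix n
    multi i j = ν i * ν j - b i j

    multi-idem : ∀ i j → multi i j * multi i j ≡ multi i j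
    multi-idem i j = begin
      (ν i * ν j - b i j) * (ν i * ν j - b i j)
        ≡⟨ expand (ν i) (ν j) (b i j) ⟩
      ν i * ν i * (ν j * ν j) - + 2 * (ν i * b i j * ν j) + b i j * b i j
        ≡⟨ cong₂ _+_ (cong₂ (λ x y → x - + 2 * y) (cong₂ _*_ (𝟙-idem (β i i)) (𝟙-idem (β j j)))
             (trans (cong (_* ν j) (ν*b i j)) (b*ν i j))) (𝟙-idem (β i j)) ⟩
      ν i * ν j - + 2 * b i j + b i j
        ≡⟨ collect (ν i * ν j) (b i j) ⟩
      ν i * ν j - b i j ∎
      where
      expand : ∀ x y z → (x * y - z) * (x * y - z) ≡ x * x * (y * y) - + 2 * (x * z * y) + z * z
      expand = solve-∀
      collect : ∀ x z → x - + 2 * z + z ≡ x - z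
      collect = solve-∀

    multi-nonneg : ∀ i j → 0ℤ ≤ multi i j
    multi-nonneg i j = subst (0ℤ ≤_) (multi-idem i j) (square-nonneg (multi i j))

    sum-multi-row : ∀ (y : Fin n → ℤ) i → ⟨ multi i , y ⟩ ≡ ν i * ⟨ ν , y ⟩ - ⟨ b i , y ⟩
    sum-multi-row y i = trans (sum-cong-≗ λ j → split (ν i) (ν j) (b i j) (y j))
      (trans (sum-lin (ν i) (- 1ℤ) (λ j → ν j * y j) (λ j → b i j * y j)) (minus (ν i * ⟨ ν , y ⟩) ⟨ b i , y ⟩))
      where
      split : ∀ x y z w → (x * y - z) * w ≡ x * (y * w) + - 1ℤ * (z * w)
      split = solve-∀
      minus : ∀ a b → a + - 1ℤ * b ≡ a - b
      minus = solve-∀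

    private
      ⟨ν,ν⟩ : ⟨ ν , ν ⟩ ≡ n′
      ⟨ν,ν⟩ = sum-cong-≗ λ i → 𝟙-idem (β i i)

      ⟨ν,b⟩ : ∀ i → ⟨ ν , b i ⟩ ≡ size i
      ⟨ν,b⟩ i = trans (⟨⟩-comm ν (b i)) (sum-cong-≗ (b*ν i))

      multi-const : ∀ i → ClassConst (multi i)
      multi-const i j k jk = cong₂ (λ x y → ν i * x - y) (ν-const j k jk) (b-const i j k jk)

      ⟨⟩-multi : ∀ (x : Fin n → ℤ) i → ⟨ x , multi i ⟩ ≡ ν i * ⟨ x , ν ⟩ - ⟨ x , b i ⟩
      ⟨⟩-multi x i = trans (⟨⟩-comm x (multi i)) (trans (sum-multi-row x i) (cong₂ (λ s t → ν i * s - t) (⟨⟩-comm ν x) (⟨⟩-comm (b i) x)))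

      degree : Fin n → ℤ
      degree i = ν i * n′ - size i

      ⟨ν,multi⟩ : ∀ i → ⟨ ν , multi i ⟩ ≡ degree i
      ⟨ν,multi⟩ i = trans (⟨⟩-multi ν i) (cong₂ (λ s t → ν i * s - t) ⟨ν,ν⟩ (⟨ν,b⟩ i))

      ⟨size,ν⟩ : ⟨ size , ν ⟩ ≡ s₁
      ⟨size,ν⟩ = sum-cong-≗ size*ν

      ⟨size,b⟩ : ∀ i → ⟨ size , b i ⟩ ≡ size i * size i
      ⟨size,b⟩ i = trans (⟨⟩-comm size (b i)) (class-sum size (λ j k jk → size-const jk) i)

    -- Ordered pairs are counted, so this is twice the number of edges.
    edge-count : sum (λ i → sum λ j → multi i j) ≡ n′ * n′ - s₁
    edge-count = begin
      sum (λ i → sum λ j → multi i j)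
        ≡⟨ sum-cong-≗ (λ i → trans (sum-cong-≗ λ j → split (ν i) (ν j) (b i j)) (sum-lin (ν i) (- 1ℤ) ν (b i))) ⟩
      sum (λ i → ν i * n′ + - 1ℤ * size i)
        ≡⟨ trans (sum-cong-≗ λ i → cong (_+ - 1ℤ * size i) (ℤ.*-comm (ν i) n′)) (sum-lin n′ (- 1ℤ) ν size) ⟩
      n′ * n′ + - 1ℤ * s₁
        ≡⟨ minus (n′ * n′) s₁ ⟩
      n′ * n′ - s₁ ∎
      where
      split : ∀ x y z → x * y - z ≡ x * y + - 1ℤ * z
      split = solve-∀
      minus : ∀ a b → a + - 1ℤ * b ≡ a - b
      minus = solve-∀

    -- The trace of the cube of `multi`, six times the number of triangles.
    triangles : ℤ
    triangles = sum λ i → ⟨ multi i , act multi (multi i) ⟩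

    triangles-nonneg : 0ℤ ≤ triangles
    triangles-nonneg = sum-nonneg λ i → sum-nonneg λ j → *-nonneg (multi-nonneg i j)
      (sum-nonneg λ k → *-nonneg (multi-nonneg j k) (multi-nonneg i k))

    -- The value is that of inclusion-exclusion over triples in the support: n′ s₁ of them have a
    -- given pair of places in one class, and s₂ have all three.
    triangle-count : triangles ≡ n′ * n′ * n′ - + 3 * (n′ * s₁) + + 2 * s₂
    triangle-count = begin
      sum (λ i → ⟨ multi i , act multi (multi i) ⟩)
        ≡⟨ sum-cong-≗ row ⟩
      sum (λ i → (n′ * n′ - s₁) * ν i + - (+ 2 * n′) * size i + + 2 * (size i * size i))
        ≡⟨ trans (∑-distrib-+ (λ i → (n′ * n′ - s₁) * ν i + - (+ 2 * n′) * size i) (λ i → + 2 * (size i * size i)))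
             (cong₂ _+_ (sum-lin (n′ * n′ - s₁) (- (+ 2 * n′)) ν size) (sum-scale (+ 2) (λ i → size i * size i))) ⟩
      (n′ * n′ - s₁) * n′ + - (+ 2 * n′) * s₁ + + 2 * s₂
        ≡⟨ collect n′ s₁ s₂ ⟩
      n′ * n′ * n′ - + 3 * (n′ * s₁) + + 2 * s₂ ∎
      where
      collect : ∀ n s t → (n * n - s) * n + - (+ 2 * n) * s + + 2 * t ≡ n * n * n - + 3 * (n * s) + + 2 * t
      collect = solve-∀
      row : ∀ i → ⟨ multi i , act multi (multi i) ⟩ ≡ (n′ * n′ - s₁) * ν i + - (+ 2 * n′) * size i + + 2 * (size i * size i)
      row i = begin
        ⟨ multi i , act multi (multi i) ⟩
          ≡⟨ ⟨⟩-congʳ (multi i) (λ j → trans (sum-multi-row (multi i) j) (cong₂ (λ x y → ν j * x - y) (⟨ν,multi⟩ i)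
               (class-sum (multi i) (multi-const i) j))) ⟩
        sum (λ j → multi i j * (ν j * degree i - size j * multi i j))
          ≡⟨ sum-cong-≗ (λ j → trans (expand (multi i j) (ν j) (degree i) (size j)) (cong (λ z → degree i * (ν j * multi i j) + - 1ℤ * (size j * z)) (multi-idem i j))) ⟩
        sum (λ j → degree i * (ν j * multi i j) + - 1ℤ * (size j * multi i j))
          ≡⟨ sum-lin (degree i) (- 1ℤ) (λ j → ν j * multi i j) (λ j → size j * multi i j) ⟩
        degree i * ⟨ ν , multi i ⟩ + - 1ℤ * ⟨ size , multi i ⟩
          ≡⟨ cong₂ (λ x y → degree i * x + - 1ℤ * y) (⟨ν,multi⟩ i)
               (trans (⟨⟩-multi size i) (cong₂ (λ x y → ν i * x - y) ⟨size,ν⟩ (⟨size,b⟩ i))) ⟩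
        degree i * degree i + - 1ℤ * (ν i * s₁ - size i * size i)
          ≡⟨ arith₁ (ν i) n′ (size i) s₁ ⟩
        ν i * ν i * (n′ * n′) + - (+ 2 * n′) * (size i * ν i) + size i * size i - ν i * s₁ + size i * size i
          ≡⟨ cong₂ (λ x y → x * (n′ * n′) + - (+ 2 * n′) * y + size i * size i - ν i * s₁ + size i * size i) (𝟙-idem (β i i)) (size*ν i) ⟩
        ν i * (n′ * n′) + - (+ 2 * n′) * size i + size i * size i - ν i * s₁ + size i * size i
          ≡⟨ arith₂ (ν i) n′ (size i) s₁ ⟩
        (n′ * n′ - s₁) * ν i + - (+ 2 * n′) * size i + + 2 * (size i * size i) ∎
        where
        expand : ∀ m v D s → m * (v * D - s * m) ≡ D * (v * m) + - 1ℤ * (s * (m * m))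
        expand = solve-∀
        arith₁ : ∀ v n s t → (v * n - s) * (v * n - s) + - 1ℤ * (v * t - s * s) ≡
          v * v * (n * n) + - (+ 2 * n) * (s * v) + s * s - v * t + s * s
        arith₁ = solve-∀
        arith₂ : ∀ v n s t → v * (n * n) + - (+ 2 * n) * s + s * s - v * t + s * s ≡ (n * n - t) * v + - (+ 2 * n) * s + + 2 * (s * s)
        arith₂ = solve-∀

-- The spectrum of the multicone, expressed by traces

module BlockSpectra where

  open import Data.Integer.Base using (ℤ; +_; _+_; _*_; -_; _-_; 0ℤ; 1ℤ; _≤_; _<_; +<+)
  open Determinants
  open MatrixPolynomials
  open OnePositiveEigenvalue
  open Partitions

  open ≡-Reasoning

  -- β has v classes of size 1 and p classes of size q; R marks the points of the latter.
  record Blocks {n} (β : Fin n → Fin n → Bool) (v p q : ℤ) : Set where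
    field
      β-refl  : ∀ i → β i i ≡ true
      β-sym   : ∀ i j → β i j ≡ β j i
      β-trans : ∀ {i j k} → β i j ≡ true → β j k ≡ true → β i k ≡ true
      R       : Fin n → Bool
      size≡   : ∀ i → sum (λ j → 𝟙 (β i j)) ≡ (if R i then q else 1ℤ)
      #R      : sum (λ i → 𝟙 (R i)) ≡ p * q
      #¬R     : sum (λ i → 𝟙 (not (R i))) ≡ v

  -- The partition into the v singletons and the p q other points has a quotient matrix with rows (v
  -- - 1, p q) and (v, (p - 1) q); s is its trace and -d its determinant.
  s-of d-of : (v p q : ℤ) → ℤ
  s-of v p q = v - 1ℤ + (p - 1ℤ) * q
  d-of v p q = q * (v + p - 1ℤ)

  -- F h without the factor X + 1, respectively X + q: multiples of the projections onto the
  -- eigenspaces of -1 and -q.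
  Z₁ Z_q : (s d q : ℤ) → Pol
  Z₁ s d q = Polynomials.F s d q ⊠ (X ⊠ (X ⊞ con q))
  Z_q s d q = Polynomials.F s d q ⊠ (X ⊠ (X ⊞ con 1ℤ))

  module BlockSpectrum {n} (β : Fin n → Fin n → Bool) (v p q : ℤ) (blocks : Blocks β v p q)
    (0<v : 0ℤ < v) (0<p : 0ℤ < p) (1<q : 1ℤ < q)
    (A : Matrix n) (A-sym : ∀ i j → A i j ≡ A j i) (A≡ : ∀ i j → A i j ≡ 1ℤ - 𝟙 (β i j)) where

    open Blocks blocks
    open PER β β-sym β-trans using (b; size; size-const; class-sum; ClassConst; b-const)
    open Operator A A-sym

    s d : ℤ
    s = s-of v p q
    d = d-of v p q

    open Polynomials s d q

    k γ one : Fin n → ℤ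
    k i = 𝟙 (not (R i))
    γ i = 𝟙 (R i)
    one i = 1ℤ

    private
      R-const : ∀ {i j} → β i j ≡ true → R i ≡ R j
      R-const {i} {j} ij with R i | R j | trans (sym (size≡ i)) (trans (size-const ij) (size≡ j))
      ... | true  | true  | _ = refl
      ... | false | false | _ = refl
      ... | true  | false | q≡1 = ⊥-elim (ℤ.<-irrefl (sym q≡1) 1<q)
      ... | false | true  | 1≡q = ⊥-elim (ℤ.<-irrefl 1≡q 1<q)

      act-const : ∀ y → ClassConst y → ∀ l → act A y l ≡ sum y - size l * y l
      act-const y const l = begin
        sum (λ j → A l j * y j)                     ≡⟨ sum-cong-≗ (λ j → trans (cong (_* y j) (A≡ l j)) (split (b l j) (y j))) ⟩
        sum (λ j → 1ℤ * y j + - 1ℤ * (b l j * y j)) ≡⟨ sum-lin 1ℤ (- 1ℤ) y (λ j → b l j * y j) ⟩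
        1ℤ * sum y + - 1ℤ * ⟨ b l , y ⟩             ≡⟨ cong (λ z → 1ℤ * sum y + - 1ℤ * z) (class-sum y const l) ⟩
        1ℤ * sum y + - 1ℤ * (size l * y l)          ≡⟨ minus (sum y) (size l * y l) ⟩
        sum y - size l * y l                        ∎
        where
        split : ∀ b y → (1ℤ - b) * y ≡ 1ℤ * y + - 1ℤ * (b * y)
        split = solve-∀
        minus : ∀ a b → 1ℤ * a + - 1ℤ * b ≡ a - b
        minus = solve-∀

      size*k : ∀ l → size l * k l ≡ k l
      size*k l with R l | size≡ l
      ... | true  | e = ℤ.*-zeroʳ (size l)
      ... | false | e = trans (ℤ.*-identityʳ (size l)) e

      size*γ : ∀ l → size l * γ l ≡ q * γ l
      size*γ l with R l | size≡ l
      ... | true  | e = cong (_* 1ℤ) e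
      ... | false | e = trans (ℤ.*-zeroʳ (size l)) (sym (ℤ.*-zeroʳ q))

      γ≡ : ∀ l → γ l ≡ 1ℤ - k l
      γ≡ l with R l
      ... | true  = refl
      ... | false = refl

    act-k : ∀ l → act A k l ≡ v - k l
    act-k l = trans (act-const k (λ i j ij → cong (𝟙 ∘ not) (R-const ij)) l) (cong₂ _-_ #¬R (size*k l))

    act-γ : ∀ l → act A γ l ≡ p * q - q * γ l
    act-γ l = trans (act-const γ (λ i j ij → cong 𝟙 (R-const ij)) l) (cong₂ _-_ #R (size*γ l))

    act-b : ∀ i l → act A (b i) l ≡ size i - size i * b i l
    act-b i l = trans (act-const (b i) (b-const i) l) (cong (λ z → size i - z) same)
      where
      same : size l * b i l ≡ size i * b i l
      same with β i l in il
      ... | true  = cong (_* 1ℤ) (sym (size-const il))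
      ... | false = trans (ℤ.*-zeroʳ (size l)) (sym (ℤ.*-zeroʳ (size i)))

    act-δ : ∀ i l → act A (δ i) l ≡ 1ℤ - b i l
    act-δ i l = trans (⟨⟩-comm (A l) (δ i)) (trans (⟨δ,⟩ i (A l)) (trans (A-sym l i) (A≡ i l)))

    -- A maps the span of k and γ to itself, with characteristic polynomial F.
    F-k : ∀ l → ⟦ F ⟧ k l ≡ 0ℤ
    F-k l = begin
      act A (act A k) l + - 1ℤ * (s * act A k l) + - 1ℤ * (d * k l)
        ≡⟨ cong₂ (λ x y → x + - 1ℤ * (s * y) + - 1ℤ * (d * k l)) (trans
             (act-cong A (λ j → trans (act-k j) (trans (mix v (k j)) (cong (λ z → (v - 1ℤ) * k j + v * z) (sym (γ≡ j))))) l)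
             (trans (act-lin A (v - 1ℤ) v k γ l) (cong₂ (λ x y → (v - 1ℤ) * x + v * y) (act-k l) (trans (act-γ l) (cong (λ z → p * q - q * z) (γ≡ l))))))
             (act-k l) ⟩
      (v - 1ℤ) * (v - k l) + v * (p * q - q * (1ℤ - k l)) + - 1ℤ * (s * (v - k l)) + - 1ℤ * (d * k l)
        ≡⟨ arith v p q (k l) ⟩
      0ℤ ∎
      where
      mix : ∀ v k → v - k ≡ (v - 1ℤ) * k + v * (1ℤ - k)
      mix = solve-∀
      arith : ∀ v p q k → (v - 1ℤ) * (v - k) + v * (p * q - q * (1ℤ - k)) + - 1ℤ * ((v - 1ℤ + (p - 1ℤ) * q) * (v - k)) + - 1ℤ * (q * (v + p - 1ℤ) * k) ≡ 0ℤ
      arith = solve-∀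

    F-γ : ∀ l → ⟦ F ⟧ γ l ≡ 0ℤ
    F-γ l = begin
      act A (act A γ) l + - 1ℤ * (s * act A γ l) + - 1ℤ * (d * γ l)
        ≡⟨ cong₂ (λ x y → x + - 1ℤ * (s * y) + - 1ℤ * (d * γ l)) (trans
             (act-cong A (λ j → trans (act-γ j) (trans (mix p q (γ j)) (cong (λ z → p * q * z + (p * q - q) * γ j) (sym (k≡ j))))) l)
             (trans (act-lin A (p * q) (p * q - q) k γ l) (cong₂ (λ x y → p * q * x + (p * q - q) * y) (trans (act-k l) (cong (λ z → v - z) (k≡ l))) (act-γ l))))
             (act-γ l) ⟩
      p * q * (v - (1ℤ - γ l)) + (p * q - q) * (p * q - q * γ l) + - 1ℤ * (s * (p * q - q * γ l)) + - 1ℤ * (d * γ l)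
        ≡⟨ arith v p q (γ l) ⟩
      0ℤ ∎
      where
      k≡ : ∀ j → k j ≡ 1ℤ - γ j
      k≡ j = 𝟙-not (R j)
      mix : ∀ p q g → p * q - q * g ≡ p * q * (1ℤ - g) + (p * q - q) * g
      mix = solve-∀
      arith : ∀ v p q g → p * q * (v - (1ℤ - g)) + (p * q - q) * (p * q - q * g) + - 1ℤ * ((v - 1ℤ + (p - 1ℤ) * q) * (p * q - q * g)) + - 1ℤ * (q * (v + p - 1ℤ) * g) ≡ 0ℤ
      arith = solve-∀

    -- `δ i` lies below `b i`, and both have sum 1.
    b-single : ∀ {i} → R i ≡ false → ∀ j → b i j ≡ δ i j
    b-single {i} Ri j = sym (sum-mono-≡ {f = δ i} {b i} le (trans (trans (sum-cong-≗ λ j → sym (ℤ.*-identityʳ (δ i j))) (⟨δ,⟩ i one))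
        (sym (trans (size≡ i) (cong (λ r → if r then q else 1ℤ) Ri)))) j)
      where
      le : ∀ j → δ i j ≤ b i j
      le j with i Fin.≟ j
      ... | yes refl = ℤ.≤-reflexive (sym (cong 𝟙 (β-refl i)))
      ... | no _     = 𝟙-nonneg (β i j)

    module _ (P : Pol) where

      -- v δᵢ = (v δᵢ - k) + k, where the first vector is an eigenvector for -1 and F annihilates
      -- the second. The factor v keeps the decomposition integral.
      expand-K : ∀ i → R i ≡ false → ∀ j → v * entry P i j ≡ eval P (- 1ℤ) * (v * δ i j - k j) + ⟦ P ⟧ k j
      expand-K i Ri j = begin
        v * ⟦ P ⟧ (δ i) j                                  ≡⟨ sym (⟦⟧-scale P v (δ i) j) ⟩
        ⟦ P ⟧ (λ l → v * δ i l) j                          ≡⟨ ⟦⟧-cong P (λ l → add (v * δ i l) (k l)) j ⟩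
        ⟦ P ⟧ (λ l → y l + k l) j                          ≡⟨ ⟦⟧-+ P y k j ⟩
        ⟦ P ⟧ y j + ⟦ P ⟧ k j                              ≡⟨ cong (_+ ⟦ P ⟧ k j) (⟦⟧-eigen P (- 1ℤ) eigen j) ⟩
        eval P (- 1ℤ) * (v * δ i j - k j) + ⟦ P ⟧ k j      ∎
        where
        y : Fin n → ℤ
        y l = v * δ i l - k l
        add : ∀ a b → a ≡ a - b + b
        add = solve-∀
        eigen : ∀ l → act A y l ≡ - 1ℤ * y l
        eigen l = begin
          act A y l                             ≡⟨ act-cong A (λ j → minus (v * δ i j) (k j)) l ⟩
          act A (λ j → v * δ i j + - 1ℤ * k j) l ≡⟨ act-lin A v (- 1ℤ) (δ i) k l ⟩
          v * act A (δ i) l + - 1ℤ * act A k l  ≡⟨ cong₂ (λ x y → v * x + - 1ℤ * y) (trans (act-δ i l) (cong (λ z → 1ℤ - z) (b-single Ri l))) (act-k l) ⟩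
          v * (1ℤ - δ i l) + - 1ℤ * (v - k l)   ≡⟨ arith v (δ i l) (k l) ⟩
          - 1ℤ * (v * δ i l - k l)              ∎
          where
          minus : ∀ a b → a - b ≡ a + - 1ℤ * b
          minus = solve-∀
          arith : ∀ v d k → v * (1ℤ - d) + - 1ℤ * (v - k) ≡ - 1ℤ * (v * d - k)
          arith = solve-∀

      -- Likewise p q δᵢ = (p q δᵢ - p bᵢ) + (p bᵢ - γ) + γ, with eigenvalues 0 and -q for the first
      -- two vectors, while F annihilates γ.
      expand-Γ : ∀ i → R i ≡ true → ∀ j → p * q * entry P i j ≡
        eval P 0ℤ * (p * q * δ i j - p * b i j) + eval P (- q) * (p * b i j - γ j) + ⟦ P ⟧ γ j
      expand-Γ i Ri j = begin
        p * q * ⟦ P ⟧ (δ i) j                               ≡⟨ sym (⟦⟧-scale P (p * q) (δ i) j) ⟩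
        ⟦ P ⟧ (λ l → p * q * δ i l) j                       ≡⟨ ⟦⟧-cong P (λ l → add (p * q * δ i l) (p * b i l) (γ l)) j ⟩
        ⟦ P ⟧ (λ l → y l + z l + γ l) j                     ≡⟨ trans (⟦⟧-+ P (λ l → y l + z l) γ j) (cong (_+ ⟦ P ⟧ γ j) (⟦⟧-+ P y z j)) ⟩
        ⟦ P ⟧ y j + ⟦ P ⟧ z j + ⟦ P ⟧ γ j                   ≡⟨ cong (_+ ⟦ P ⟧ γ j) (cong₂ _+_ (⟦⟧-eigen P 0ℤ eigen-y j) (⟦⟧-eigen P (- q) eigen-z j)) ⟩
        eval P 0ℤ * y j + eval P (- q) * z j + ⟦ P ⟧ γ j    ∎
        where
        y z : Fin n → ℤ
        y l = p * q * δ i l - p * b i l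
        z l = p * b i l - γ l
        add : ∀ a b c → a ≡ a - b + (b - c) + c
        add = solve-∀
        minus : ∀ a b → a - b ≡ a + - 1ℤ * b
        minus = solve-∀
        size-i : size i ≡ q
        size-i = trans (size≡ i) (cong (λ r → if r then q else 1ℤ) Ri)
        act-bi : ∀ l → act A (b i) l ≡ q - q * b i l
        act-bi l = trans (act-b i l) (cong (λ t → t - t * b i l) size-i)
        eigen-y : ∀ l → act A y l ≡ 0ℤ * y l
        eigen-y l = begin
          act A y l                                       ≡⟨ act-cong A (λ j → minus′ (p * q * δ i j) p (b i j)) l ⟩
          act A (λ j → p * q * δ i j + - p * b i j) l     ≡⟨ act-lin A (p * q) (- p) (δ i) (b i) l ⟩
          p * q * act A (δ i) l + - p * act A (b i) l     ≡⟨ cong₂ (λ x y → p * q * x + - p * y) (act-δ i l) (act-bi l) ⟩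
          p * q * (1ℤ - b i l) + - p * (q - q * b i l)    ≡⟨ arith p q (b i l) (y l) ⟩
          0ℤ * y l                                        ∎
          where
          minus′ : ∀ a p b → a - p * b ≡ a + - p * b
          minus′ = solve-∀
          arith : ∀ p q b y → p * q * (1ℤ - b) + - p * (q - q * b) ≡ 0ℤ * y
          arith = solve-∀
        eigen-z : ∀ l → act A z l ≡ - q * z l
        eigen-z l = begin
          act A z l                                       ≡⟨ act-cong A (λ j → minus (p * b i j) (γ j)) l ⟩
          act A (λ j → p * b i j + - 1ℤ * γ j) l          ≡⟨ act-lin A p (- 1ℤ) (b i) γ l ⟩
          p * act A (b i) l + - 1ℤ * act A γ l            ≡⟨ cong₂ (λ x y → p * x + - 1ℤ * y) (act-bi l) (act-γ l) ⟩
          p * (q - q * b i l) + - 1ℤ * (p * q - q * γ l)  ≡⟨ arith p q (b i l) (γ l) ⟩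
          - q * (p * b i l - γ l)                         ∎
          where
          arith : ∀ p q b g → p * (q - q * b) + - 1ℤ * (p * q - q * g) ≡ - q * (p * b - g)
          arith = solve-∀

      -- The eigenvalues -1, 0 and -q have multiplicities v - 1, p q - p and p - 1, and α + ε is the
      -- trace of P on the plane spanned by k and γ. The common denominator v p q of the two
      -- expansions is cancelled.
      trace-formula : ∀ α ε → (∀ i → R i ≡ false → ⟦ P ⟧ k i ≡ α) → (∀ i → R i ≡ true → ⟦ P ⟧ γ i ≡ ε) →
        tr P ≡ eval P (- 1ℤ) * (v - 1ℤ) + α + (eval P 0ℤ * (p * q - p) + eval P (- q) * (p - 1ℤ) + ε)
      trace-formula α ε Pk Pγ = ℤ.*-cancelˡ-≡ (v * (p * q)) (tr P) (a + c) {{ℤ.>-nonZero (*-pos 0<v (*-pos 0<p 0<q))}} (begin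
        v * (p * q) * tr P                                    ≡⟨ sum-scale (v * (p * q)) (λ i → entry P i i) ⟨
        sum (λ i → v * (p * q) * entry P i i)                 ≡⟨ sum-cong-≗ diagonal ⟩
        sum (λ i → p * q * a * k i + v * c * γ i)             ≡⟨ sum-lin (p * q * a) (v * c) k γ ⟩
        p * q * a * sum k + v * c * sum γ                     ≡⟨ cong₂ (λ x y → p * q * a * x + v * c * y) #¬R #R ⟩
        p * q * a * v + v * c * (p * q)                       ≡⟨ collect v (p * q) a c ⟩
        v * (p * q) * (a + c)                                 ∎)
        where
        0<q : 0ℤ < q
        0<q = ℤ.<-trans (+<+ (ℕ.s≤s ℕ.z≤n)) 1<q
        a c : ℤ
        a = eval P (- 1ℤ) * (v - 1ℤ) + α
        c = eval P 0ℤ * (p * q - p) + eval P (- q) * (p - 1ℤ) + ε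
        collect : ∀ v r a c → r * a * v + v * c * r ≡ v * r * (a + c)
        collect = solve-∀
        diagonal : ∀ i → v * (p * q) * entry P i i ≡ p * q * a * k i + v * c * γ i
        diagonal i with R i in Ri
        ... | false = begin
          v * (p * q) * entry P i i      ≡⟨ reorder v (p * q) (entry P i i) ⟩
          p * q * (v * entry P i i)      ≡⟨ cong (p * q *_) (trans (expand-K i Ri i)
                                              (cong₂ (λ x y → eval P (- 1ℤ) * x + y) (trans (cong₂ (λ x y → v * x - y) (δ-refl i) (cong (𝟙 ∘ not) Ri)) (cong (_- 1ℤ) (ℤ.*-identityʳ v))) (Pk i Ri))) ⟩
          p * q * a                      ≡⟨ pad (p * q * a) (v * c) ⟩
          p * q * a * 1ℤ + v * c * 0ℤ    ∎
          where
          reorder : ∀ v r x → v * r * x ≡ r * (v * x)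
          reorder = solve-∀
          pad : ∀ x y → x ≡ x * 1ℤ + y * 0ℤ
          pad = solve-∀
        ... | true = begin
          v * (p * q) * entry P i i      ≡⟨ ℤ.*-assoc v (p * q) (entry P i i) ⟩
          v * (p * q * entry P i i)      ≡⟨ cong (v *_) (trans (expand-Γ i Ri i)
                                              (cong₂ (λ x y → x + y) (cong₂ (λ x y → eval P 0ℤ * x + eval P (- q) * y)
                                                (trans (cong₂ (λ x y → p * q * x - p * y) (δ-refl i) (cong 𝟙 (β-refl i))) (ones (p * q) p))
                                                (trans (cong₂ (λ x y → p * x - y) (cong 𝟙 (β-refl i)) (cong 𝟙 Ri)) (cong (_- 1ℤ) (ℤ.*-identityʳ p))))
                                                (Pγ i Ri))) ⟩
          v * c                          ≡⟨ pad (p * q * a) (v * c) ⟩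
          p * q * a * 0ℤ + v * c * 1ℤ    ∎
          where
          ones : ∀ a b → a * 1ℤ - b * 1ℤ ≡ a - b
          ones = solve-∀
          pad : ∀ x y → y ≡ x * 0ℤ + y * 1ℤ
          pad = solve-∀

    private
      0<q : 0ℤ < q
      0<q = ℤ.<-trans (+<+ (ℕ.s≤s ℕ.z≤n)) 1<q

      h-root₀ : eval h 0ℤ ≡ 0ℤ
      h-root₀ = ℤ.*-zeroˡ (0ℤ + q)

      h-root₁ : eval h (- 1ℤ) ≡ 0ℤ
      h-root₁ = ℤ.*-zeroˡ (- 1ℤ + q)

      h-root_q : eval h (- q) ≡ 0ℤ
      h-root_q = trans (cong (- q * (- q + 1ℤ) *_) (ℤ.+-inverseˡ q)) (ℤ.*-zeroʳ (- q * (- q + 1ℤ)))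

      *-zero : ∀ {x} y → x ≡ 0ℤ → x * y ≡ 0ℤ
      *-zero y refl = ℤ.*-zeroˡ y

      zero-* : ∀ x {y} → y ≡ 0ℤ → x * y ≡ 0ℤ
      zero-* x refl = ℤ.*-zeroʳ x

      only-main : ∀ e f g x y z α ε → e ≡ 0ℤ → f ≡ 0ℤ → g ≡ 0ℤ → e * x + α + (f * y + g * z + ε) ≡ α + ε
      only-main _ _ _ x y z α ε refl refl refl = arith x y z α ε
        where
        arith : ∀ x y z α ε → 0ℤ * x + α + (0ℤ * y + 0ℤ * z + ε) ≡ α + ε
        arith = solve-∀

    -- F annihilates k and γ, and h vanishes at 0, -1 and -q; by the two expansions this covers all
    -- basis vectors.
    Fh≡0 : ∀ y i → ⟦ F ⊠ h ⟧ y i ≡ 0ℤ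
    Fh≡0 y i = trans (⟦⟧-entries (F ⊠ h) y i) (sum-zero λ j → *-zero (y j) (entry≡0 i j))
      where
      Fh-k : ∀ j → ⟦ F ⊠ h ⟧ k j ≡ 0ℤ
      Fh-k j = trans (⟦⟧-comm F h k j) (⟦⟧-zero h F-k j)
      Fh-γ : ∀ j → ⟦ F ⊠ h ⟧ γ j ≡ 0ℤ
      Fh-γ j = trans (⟦⟧-comm F h γ j) (⟦⟧-zero h F-γ j)
      entry≡0 : ∀ i j → entry (F ⊠ h) i j ≡ 0ℤ
      entry≡0 i j with R i in Ri
      ... | false = *-cancel-≡0 v (entry (F ⊠ h) i j) 0<v (trans (expand-K (F ⊠ h) i Ri j)
        (cong₂ _+_ (*-zero (v * δ i j - k j) (zero-* (eval F (- 1ℤ)) h-root₁)) (Fh-k j)))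
      ... | true = *-cancel-≡0 (p * q) (entry (F ⊠ h) i j) (*-pos 0<p 0<q) (trans (expand-Γ (F ⊠ h) i Ri j)
        (cong₂ _+_ (cong₂ _+_ (*-zero (p * q * δ i j - p * b i j) (zero-* (eval F 0ℤ) h-root₀))
                              (*-zero (p * b i j - γ j) (zero-* (eval F (- q)) h-root_q))) (Fh-γ j)))

    private
      E-on : ∀ y → (∀ l → ⟦ F ⟧ y l ≡ 0ℤ) → ∀ l → ⟦ E ⟧ y l ≡ N * y l
      E-on y Fy l = trans (E-in-F A A-sym s d q y l) (trans (cong (λ z → N * y l + - 1ℤ * z) (trans (⟦⟧-comm F w y l) (⟦⟧-zero w Fy l))) (pad (N * y l)))
        where
        pad : ∀ x → x + - 1ℤ * 0ℤ ≡ x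
        pad = solve-∀
      XE-on : ∀ y → (∀ l → ⟦ F ⟧ y l ≡ 0ℤ) → ∀ l → ⟦ X ⊠ E ⟧ y l ≡ N * act A y l
      XE-on y Fy l = trans (act-cong A (E-on y Fy) l) (⟦⟧-scale X N y l)
      F⊠-on : ∀ P y → (∀ l → ⟦ F ⟧ y l ≡ 0ℤ) → ∀ l → ⟦ F ⊠ P ⟧ y l ≡ 0ℤ
      F⊠-on P y Fy l = trans (⟦⟧-comm F P y l) (⟦⟧-zero P Fy l)

    tr-E : tr E ≡ + 2 * N
    tr-E = trans (trace-formula E N N
      (λ i Ri → trans (E-on k F-k i) (trans (cong (λ r → N * 𝟙 (not r)) Ri) (ℤ.*-identityʳ N)))
      (λ i Ri → trans (E-on γ F-γ i) (trans (cong (λ r → N * 𝟙 r) Ri) (ℤ.*-identityʳ N))))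
      (trans (only-main (eval E (- 1ℤ)) (eval E 0ℤ) (eval E (- q)) (v - 1ℤ) (p * q - p) (p - 1ℤ) N N
        (*-zero (eval h̄ (- 1ℤ)) h-root₁) (*-zero (eval h̄ 0ℤ) h-root₀) (*-zero (eval h̄ (- q)) h-root_q))
        (double N))
      where
      double : ∀ n → n + n ≡ + 2 * n
      double = solve-∀

    tr-XE : tr (X ⊠ E) ≡ s * N
    tr-XE = trans (trace-formula (X ⊠ E) (N * (v - 1ℤ)) (N * (p * q - q * 1ℤ))
      (λ i Ri → trans (XE-on k F-k i) (cong (N *_) (trans (act-k i) (cong (λ r → v - 𝟙 (not r)) Ri))))
      (λ i Ri → trans (XE-on γ F-γ i) (cong (N *_) (trans (act-γ i) (cong (λ r → p * q - q * 𝟙 r) Ri)))))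
      (trans (only-main (eval (X ⊠ E) (- 1ℤ)) (eval (X ⊠ E) 0ℤ) (eval (X ⊠ E) (- q)) (v - 1ℤ) (p * q - p) (p - 1ℤ) (N * (v - 1ℤ)) (N * (p * q - q * 1ℤ))
        (zero-* (- 1ℤ) (*-zero (eval h̄ (- 1ℤ)) h-root₁)) (ℤ.*-zeroˡ (eval E 0ℤ)) (zero-* (- q) (*-zero (eval h̄ (- q)) h-root_q)))
        (arith N v p q))
      where
      arith : ∀ n v p q → n * (v - 1ℤ) + n * (p * q - q * 1ℤ) ≡ (v - 1ℤ + (p - 1ℤ) * q) * n
      arith = solve-∀

    -- The values of `Z₁` at -1 and of `Z_q` at -q, by which these have to be divided to become
    -- projections.
    ζ₁ ζ_q : ℤ
    ζ₁ = v * ((q - 1ℤ) * (q - 1ℤ))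
    ζ_q = p * (q * q) * ((q - 1ℤ) * (q - 1ℤ))

    eval-Z₁ : eval (Z₁ s d q) (- 1ℤ) ≡ ζ₁
    eval-Z₁ = arith v p q
      where
      arith : ∀ v p q → (- 1ℤ * - 1ℤ + - 1ℤ * ((v - 1ℤ + (p - 1ℤ) * q) * - 1ℤ) + - 1ℤ * (q * (v + p - 1ℤ))) * (- 1ℤ * (- 1ℤ + q)) ≡ v * ((q - 1ℤ) * (q - 1ℤ))
      arith = solve-∀

    eval-Z_q : eval (Z_q s d q) (- q) ≡ ζ_q
    eval-Z_q = arith v p q
      where
      arith : ∀ v p q → (- q * - q + - 1ℤ * ((v - 1ℤ + (p - 1ℤ) * q) * - q) + - 1ℤ * (q * (v + p - 1ℤ))) * (- q * (- q + 1ℤ)) ≡ p * (q * q) * ((q - 1ℤ) * (q - 1ℤ))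
      arith = solve-∀

    tr-Z₁ : tr (Z₁ s d q) ≡ (v - 1ℤ) * ζ₁
    tr-Z₁ = trans (trace-formula (Z₁ s d q) 0ℤ 0ℤ (λ i _ → F⊠-on (X ⊠ (X ⊞ Q)) k F-k i) (λ i _ → F⊠-on (X ⊠ (X ⊞ Q)) γ F-γ i))
      (trans (cong₂ (λ e f → e * (v - 1ℤ) + 0ℤ + (eval F 0ℤ * (0ℤ * (0ℤ + q)) * (p * q - p) + f * (p - 1ℤ) + 0ℤ)) eval-Z₁
          (zero-* (eval F (- q)) (zero-* (- q) (ℤ.+-inverseˡ q))))
        (arith ζ₁ (eval F 0ℤ) q (v - 1ℤ) (p * q - p) (p - 1ℤ)))
      where
      arith : ∀ e f q x y z → e * x + 0ℤ + (f * (0ℤ * (0ℤ + q)) * y + 0ℤ * z + 0ℤ) ≡ x * e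
      arith = solve-∀

    tr-Z_q : tr (Z_q s d q) ≡ (p - 1ℤ) * ζ_q
    tr-Z_q = trans (trace-formula (Z_q s d q) 0ℤ 0ℤ (λ i _ → F⊠-on (X ⊠ (X ⊞ con 1ℤ)) k F-k i) (λ i _ → F⊠-on (X ⊠ (X ⊞ con 1ℤ)) γ F-γ i))
      (trans (cong (λ e → eval F (- 1ℤ) * 0ℤ * (v - 1ℤ) + 0ℤ + (eval F 0ℤ * 0ℤ * (p * q - p) + e * (p - 1ℤ) + 0ℤ)) eval-Z_q)
        (arith (eval F (- 1ℤ)) (eval F 0ℤ) ζ_q (v - 1ℤ) (p * q - p) (p - 1ℤ)))
      where
      arith : ∀ f g e x y z → f * 0ℤ * x + 0ℤ + (g * 0ℤ * y + e * z + 0ℤ) ≡ z * e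
      arith = solve-∀

-- Part sizes from eigenvalue multiplicities in a multipartite graph

module Multiplicities where

  open import Data.Integer.Base using (ℤ; +_; _+_; _*_; -_; _-_; 0ℤ; 1ℤ; _≤_; _<_; +<+)
  open Determinants
  open MatrixPolynomials
  open OnePositiveEigenvalue
  open Partitions

  open ≡-Reasoning

  module Multipartite {n} (β : Fin n → Fin n → Bool) (β-sym : ∀ i j → β i j ≡ β j i)
      (β-trans : ∀ {i j k} → β i j ≡ true → β j k ≡ true → β i k ≡ true) where

    open PER β β-sym β-trans

    module Adjacency (A : Matrix n) (A-sym : ∀ i j → A i j ≡ A j i) (A≡ : ∀ i j → A i j ≡ multi i j) where

      open Operator A A-sym

      entry-X : ∀ i j → entry X i j ≡ A i j
      entry-X i j = trans (⟨⟩-comm (A j) (δ i)) (trans (⟨δ,⟩ i (A j)) (A-sym j i))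

      tr-XX : tr (X ⊠ X) ≡ n′ * n′ - s₁
      tr-XX = trans (tr-⊠ X X) (trans (sum-cong-≗ λ i → sum-cong-≗ λ j → trans
        (cong (λ z → z * z) (trans (entry-X i j) (A≡ i j))) (multi-idem i j)) edge-count)

      tr-XXX : tr (X ⊠ (X ⊠ X)) ≡ n′ * n′ * n′ - + 3 * (n′ * s₁) + + 2 * s₂
      tr-XXX = trans (trans (tr-⊠ X (X ⊠ X)) (sum-cong-≗ λ i → sum-cong-≗ λ j → cong₂ _*_ (trans (entry-X i j) (A≡ i j))
        (sum-cong-≗ λ k → cong₂ _*_ (A≡ j k) (trans (entry-X i k) (A≡ i k))))) triangle-count

      act-multi : ∀ y l → act A y l ≡ ν l * ⟨ ν , y ⟩ - ⟨ b l , y ⟩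
      act-multi y l = trans (sum-cong-≗ λ j → cong (_* y j) (A≡ l j)) (sum-multi-row y l)

      act-part : ∀ l j → act A (b l) j ≡ ν j * size l - size l * b l j
      act-part l j = trans (act-multi (b l) j) (cong₂ (λ x y → ν j * x - y)
        (trans (⟨⟩-comm ν (b l)) (sum-cong-≗ (b*ν l)))
        (trans (class-sum (b l) (b-const l) j) same))
        where
        same : size j * b l j ≡ size l * b l j
        same with β l j in lj
        ... | true  = cong (_* 1ℤ) (sym (size-const lj))
        ... | false = trans (ℤ.*-zeroʳ (size j)) (sym (ℤ.*-zeroʳ (size l)))

      support-true : ∀ {i} → β i i ≡ false → ∀ j → b i j ≡ 0ℤ
      support-true {i} ii j with β i j in ij
      ... | false = refl
      ... | true with trans (sym ii) (β⇒support ij)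
      ...   | ()

      module Eigenvalue (r : ℤ) (0<r : 0ℤ < r) {z : Fin n → ℤ} (eig : ∀ l → act A z l ≡ - r * z l) where

        off-support : ∀ l → β l l ≡ false → z l ≡ 0ℤ
        off-support l ll = *-cancel-≡0 r (z l) 0<r (begin
          r * z l          ≡⟨ flip r (z l) ⟩
          - (- r * z l)    ≡⟨ cong -_ (sym (eig l)) ⟩
          - act A z l      ≡⟨ cong -_ (trans (act-multi z l) (cong₂ (λ x y → x * ⟨ ν , z ⟩ - y) (cong 𝟙 ll)
                                (sum-zero λ j → trans (cong (_* z j) (support-true ll j)) (ℤ.*-zeroˡ (z j))))) ⟩
          - (0ℤ * ⟨ ν , z ⟩ - 0ℤ) ≡⟨ zeros ⟨ ν , z ⟩ ⟩
          0ℤ               ∎)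
          where
          flip : ∀ r z → r * z ≡ - (- r * z)
          flip = solve-∀
          zeros : ∀ x → - (0ℤ * x - 0ℤ) ≡ 0ℤ
          zeros = solve-∀

        -- Two points of one part have equal rows in A, hence equal values of A z, and r ≠ 0.
        constant : ClassConst z
        constant i j ij = ℤ.*-cancelˡ-≡ r (z i) (z j) {{ℤ.>-nonZero 0<r}} (ℤ.neg-injective (begin
          - (r * z i)  ≡⟨ ℤ.neg-distribˡ-* r (z i) ⟩
          - r * z i    ≡⟨ sym (eig i) ⟩
          act A z i    ≡⟨ sum-cong-≗ (λ k → cong (_* z k) (row k)) ⟩
          act A z j    ≡⟨ eig j ⟩
          - r * z j    ≡⟨ sym (ℤ.neg-distribˡ-* r (z j)) ⟩
          - (r * z j)  ∎))
          where
          row : ∀ k → A i k ≡ A j k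
          row k = trans (A≡ i k) (trans (cong₂ (λ x y → x * ν k - y) (ν-const i j ij) (cong 𝟙 (β-rows ij k))) (sym (A≡ j k)))

        total : ℤ
        total = sum z

        ⟨ν,z⟩ : ⟨ ν , z ⟩ ≡ total
        ⟨ν,z⟩ = sum-cong-≗ term
          where
          term : ∀ l → ν l * z l ≡ z l
          term l with β l l in ll
          ... | true  = ℤ.*-identityˡ (z l)
          ... | false = trans (ℤ.*-zeroˡ (z l)) (sym (off-support l ll))

        -- As z is constant on parts, A z is the total minus size times z on the support. So the
        -- total vanishes as soon as some part has size r, and otherwise it determines z.
        balance : ∀ l → ν l * total ≡ (size l - r) * z l
        balance l = begin
          ν l * total                             ≡⟨ add (ν l * total) (size l * z l) ⟩
          ν l * total - size l * z l + size l * z l ≡⟨ cong (_+ size l * z l) (trans (cong₂ (λ x y → ν l * x - y) (sym ⟨ν,z⟩)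
                                                       (sym (class-sum z constant l))) (trans (sym (act-multi z l)) (eig l))) ⟩
          - r * z l + size l * z l                ≡⟨ collect r (size l) (z l) ⟩
          (size l - r) * z l                      ∎
          where
          add : ∀ a b → a ≡ a - b + b
          add = solve-∀
          collect : ∀ r s z → - r * z + s * z ≡ (s - r) * z
          collect = solve-∀

      -- The hypotheses make Z / ζ the projection onto the eigenspace of -r, and μ the dimension of
      -- this space.
      module Multiplicity (r μ ζ : ℤ) (0<r : 0ℤ < r) (0<ζ : 0ℤ < ζ) (Z : Pol)
        (Z-eig : ∀ y l → act A (⟦ Z ⟧ y) l ≡ - r * ⟦ Z ⟧ y l)
        (eval-Z : eval Z (- r) ≡ ζ) (tr-Z : tr Z ≡ μ * ζ) where

        private
          module Col i = Eigenvalue r 0<r {entry Z i} (Z-eig (δ i))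

        Z-on : ∀ y → (∀ l → act A y l ≡ - r * y l) → ∀ l → ⟦ Z ⟧ y l ≡ ζ * y l
        Z-on y eig l = trans (⟦⟧-eigen Z (- r) eig l) (cong (_* y l) eval-Z)

        ρ? : ∀ i → Dec (size i ≡ r)
        ρ? i = size i ℤ.≟ r

        ρ : Fin n → ℤ
        ρ i = 𝟙 (does (ρ? i))

        -- If a part of size r exists, eigenvectors are constant on parts, supported on the parts of
        -- size r, and have sum 0; the dimension is then one less than the number of these parts.
        module Present (i₀ : Fin n) (i₀-size : size i₀ ≡ r) where

          private
            ν-i₀ : ν i₀ ≡ 1ℤ
            ν-i₀ with β i₀ i₀ | size*ν i₀
            ... | true  | _  = refl
            ... | false | e  = ⊥-elim (ℤ.<-irrefl (trans (sym (ℤ.*-zeroʳ (size i₀))) (trans e i₀-size)) 0<r)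

            total≡0 : ∀ i → Col.total i ≡ 0ℤ
            total≡0 i = begin
              Col.total i                        ≡⟨ sym (ℤ.*-identityˡ (Col.total i)) ⟩
              1ℤ * Col.total i                   ≡⟨ cong (_* Col.total i) (sym ν-i₀) ⟩
              ν i₀ * Col.total i                 ≡⟨ Col.balance i i₀ ⟩
              (size i₀ - r) * entry Z i i₀       ≡⟨ cong (_* entry Z i i₀) (trans (cong (_- r) i₀-size) (ℤ.+-inverseʳ r)) ⟩
              0ℤ * entry Z i i₀                  ≡⟨ ℤ.*-zeroˡ (entry Z i i₀) ⟩
              0ℤ                                 ∎

            supported : ∀ i l → ρ l * entry Z i l ≡ entry Z i l
            supported i l = case (ρ? l)
              where
              product≡0 : (size l - r) * entry Z i l ≡ 0ℤ
              product≡0 = trans (sym (Col.balance i l)) (trans (cong (ν l *_) (total≡0 i)) (ℤ.*-zeroʳ (ν l)))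
              case : (dec : Dec (size l ≡ r)) → 𝟙 (does dec) * entry Z i l ≡ entry Z i l
              case (yes _) = ℤ.*-identityˡ (entry Z i l)
              case (no ≢r) = trans (ℤ.*-zeroˡ (entry Z i l)) (sym ([ (λ e → ⊥-elim (≢r (ℤ.i-j≡0⇒i≡j (size l) r e))) , (λ e → e) ]′
                (ℤ.i*j≡0⇒i≡0∨j≡0 (size l - r) product≡0)))

            -- The difference of the indicators of two parts of size r is an eigenvector, so Z
            -- multiplies it by ζ; evaluated directly, Z adds up r equal entries for each part.
            part-difference : ∀ l l′ → size l ≡ r → size l′ ≡ r → r * (entry Z l l - entry Z l l′) ≡ ζ * (b l l - b l′ l)
            part-difference l l′ sl sl′ = begin
              r * (entry Z l l - entry Z l l′)
                ≡⟨ distr r (entry Z l l) (entry Z l l′) ⟩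
              r * entry Z l l - r * entry Z l l′
                ≡⟨ sym (cong₂ _-_ (value l sl) (value l′ sl′)) ⟩
              ⟦ Z ⟧ (b l) l - ⟦ Z ⟧ (b l′) l
                ≡⟨ sym (trans (⟦⟧-lin Z 1ℤ (- 1ℤ) (b l) (b l′) l) (minus (⟦ Z ⟧ (b l) l) (⟦ Z ⟧ (b l′) l))) ⟩
              ⟦ Z ⟧ y l
                ≡⟨ Z-on y eig l ⟩
              ζ * (1ℤ * b l l + - 1ℤ * b l′ l)
                ≡⟨ cong (ζ *_) (minus (b l l) (b l′ l)) ⟩
              ζ * (b l l - b l′ l) ∎
              where
              y : Fin n → ℤ
              y j = 1ℤ * b l j + - 1ℤ * b l′ j
              distr : ∀ r a b → r * (a - b) ≡ r * a - r * b
              distr = solve-∀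
              minus : ∀ a b → 1ℤ * a + - 1ℤ * b ≡ a - b
              minus = solve-∀
              value : ∀ m → size m ≡ r → ⟦ Z ⟧ (b m) l ≡ r * entry Z l m
              value m sm = trans (⟦⟧-entries Z (b m) l) (trans (⟨⟩-comm (entry Z l) (b m))
                (trans (class-sum (entry Z l) (Col.constant l) m) (cong (_* entry Z l m) sm)))
              eig : ∀ j → act A y j ≡ - r * y j
              eig j = trans (act-lin A 1ℤ (- 1ℤ) (b l) (b l′) j) (trans (cong₂ (λ x y → 1ℤ * x + - 1ℤ * y)
                (trans (act-part l j) (cong (λ t → ν j * t - t * b l j) sl)) (trans (act-part l′ j) (cong (λ t → ν j * t - t * b l′ j) sl′)))
                (arith (ν j) r (b l j) (b l′ j)))
                where
                arith : ∀ v r a b → 1ℤ * (v * r - r * a) + - 1ℤ * (v * r - r * b) ≡ - r * (1ℤ * a + - 1ℤ * b)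
                arith = solve-∀

            ρ-const : ClassConst ρ
            ρ-const i j ij with ρ? i | ρ? j
            ... | yes _ | yes _ = refl
            ... | no  _ | no  _ = refl
            ... | yes e | no ne = ⊥-elim (ne (trans (sym (size-const ij)) e))
            ... | no ne | yes e = ⊥-elim (ne (trans (size-const ij) e))

            card : ℤ
            card = sum ρ

            -- Sum `part-difference` over all l′ in parts of size r; the entries Z l l′ add up to
            -- the total of an eigenvector, which is 0.
            diagonal : ∀ l → r * card * entry Z l l ≡ ζ * (card - r) * ρ l
            diagonal l with ρ? l in eq
            ... | no ≢r = trans (cong (r * card *_) (trans (sym (supported l l)) (trans (cong (λ z → 𝟙 (does z) * entry Z l l) eq) (ℤ.*-zeroˡ (entry Z l l)))))
                          (trans (ℤ.*-zeroʳ (r * card)) (sym (ℤ.*-zeroʳ (ζ * (card - r)))))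
            ... | yes sl = begin
              r * card * entry Z l l
                ≡⟨ rearrange r card (entry Z l l) ⟩
              r * entry Z l l * card + - r * 0ℤ
                ≡⟨ cong (λ z → r * entry Z l l * card + - r * z) (sym (trans (sum-cong-≗ (supported l)) (total≡0 l))) ⟩
              r * entry Z l l * card + - r * sum (λ l′ → ρ l′ * entry Z l l′)
                ≡⟨ sym (sum-lin (r * entry Z l l) (- r) ρ (λ l′ → ρ l′ * entry Z l l′)) ⟩
              sum (λ l′ → r * entry Z l l * ρ l′ + - r * (ρ l′ * entry Z l l′))
                ≡⟨ sum-cong-≗ term ⟩
              sum (λ l′ → ζ * ρ l′ + - ζ * (b l l′ * ρ l′))
                ≡⟨ sum-lin ζ (- ζ) ρ (λ l′ → b l l′ * ρ l′) ⟩
              ζ * card + - ζ * ⟨ b l , ρ ⟩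
                ≡⟨ cong (λ z → ζ * card + - ζ * z) (trans (class-sum ρ ρ-const l) (cong₂ _*_ sl (cong (λ z → 𝟙 (does z)) eq))) ⟩
              ζ * card + - ζ * (r * 1ℤ)
                ≡⟨ collect ζ card r ⟩
              ζ * (card - r) * 1ℤ ∎
              where
              rearrange : ∀ r c z → r * c * z ≡ r * z * c + - r * 0ℤ
              rearrange = solve-∀
              collect : ∀ z c r → z * c + - z * (r * 1ℤ) ≡ z * (c - r) * 1ℤ
              collect = solve-∀
              ν-l : b l l ≡ 1ℤ
              ν-l with β l l | size*ν l
              ... | true  | _ = refl
              ... | false | e = ⊥-elim (ℤ.<-irrefl (trans (sym (ℤ.*-zeroʳ (size l))) (trans e sl)) 0<r)
              term : ∀ l′ → r * entry Z l l * ρ l′ + - r * (ρ l′ * entry Z l l′) ≡ ζ * ρ l′ + - ζ * (b l l′ * ρ l′)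
              term l′ with ρ? l′
              ... | no _    = zeros (r * entry Z l l) r (entry Z l l′) ζ (b l l′)
                where
                zeros : ∀ x r y z b → x * 0ℤ + - r * (0ℤ * y) ≡ z * 0ℤ + - z * (b * 0ℤ)
                zeros = solve-∀
              ... | yes sl′ = trans (ones r (entry Z l l) (entry Z l l′)) (trans (part-difference l l′ sl sl′)
                  (trans (cong₂ (λ x y → ζ * (x - y)) ν-l (cong 𝟙 (β-sym l′ l))) (ones′ ζ (b l l′))))
                where
                ones : ∀ r x y → r * x * 1ℤ + - r * (1ℤ * y) ≡ r * (x - y)
                ones = solve-∀
                ones′ : ∀ z b → z * (1ℤ - b) ≡ z * 1ℤ + - z * (b * 1ℤ)
                ones′ = solve-∀

          0<card : 0ℤ < card
          0<card = ℤ.<-≤-trans (subst (0ℤ <_) (cong 𝟙 (sym (dec-true (ρ? i₀) i₀-size))) (+<+ (ℕ.s≤s ℕ.z≤n)))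
            (term≤sum (λ i → 𝟙-nonneg (does (ρ? i))) i₀)

          -- The sum of `diagonal` equates r card tr Z with ζ (card - r) card, so that card - r = r
          -- μ.
          #ρ : sum ρ ≡ r * (μ + 1ℤ)
          #ρ = ℤ.*-cancelˡ-≡ (ζ * card) card (r * (μ + 1ℤ)) {{ℤ.>-nonZero (*-pos 0<ζ 0<card)}} (begin
            ζ * card * card                              ≡⟨ split ζ card r ⟩
            ζ * (card - r) * card + r * (ζ * card)       ≡⟨ cong (_+ r * (ζ * card)) (sym (sum-scale (ζ * (card - r)) ρ)) ⟩
            sum (λ l → ζ * (card - r) * ρ l) + r * (ζ * card)
              ≡⟨ cong (_+ r * (ζ * card)) (sym (trans (sym (sum-scale (r * card) (λ l → entry Z l l))) (sum-cong-≗ diagonal))) ⟩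
            r * card * tr Z + r * (ζ * card)             ≡⟨ cong (λ t → r * card * t + r * (ζ * card)) tr-Z ⟩
            r * card * (μ * ζ) + r * (ζ * card)          ≡⟨ collect r card μ ζ ⟩
            ζ * card * (r * (μ + 1ℤ))                    ∎)
            where
            split : ∀ z c r → z * c * c ≡ z * (c - r) * c + r * (z * c)
            split = solve-∀
            collect : ∀ r c m z → r * c * (m * z) + r * (z * c) ≡ z * c * (r * (m + 1ℤ))
            collect = solve-∀

        module Absent (absent : ∀ i → size i ≢ r) where

          private
            diff≢0 : ∀ l → size l - r ≢ 0ℤ
            diff≢0 l e = absent l (ℤ.i-j≡0⇒i≡j (size l) r e)

            -- By balance, an eigenvector is determined by its total.
            rank-one : ∀ i j → entry Z i j * entry Z i j ≡ entry Z i i * entry Z j j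
            rank-one i j with β i i in ii
            ... | false = trans (cong (λ z → z * z) (trans (entry-sym Z i j) (Col.off-support j i ii)))
                            (sym (trans (cong (_* entry Z j j) (Col.off-support i i ii)) (ℤ.*-zeroˡ (entry Z j j))))
            ... | true with β j j in jj
            ...   | false = trans (cong (λ z → z * z) (Col.off-support i j jj))
                              (sym (trans (cong (entry Z i i *_) (Col.off-support j j jj)) (ℤ.*-zeroʳ (entry Z i i))))
            ...   | true = ℤ.*-cancelˡ-≡ ((size i - r) * (size j - r)) _ _ {{nz}} (begin
              (size i - r) * (size j - r) * (zij * zij)         ≡⟨ reorder (size i - r) (size j - r) zij ⟩
              (size j - r) * zij * ((size i - r) * zij)         ≡⟨ cong (λ z → (size j - r) * zij * ((size i - r) * z)) (entry-sym Z i j) ⟩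
              (size j - r) * zij * ((size i - r) * entry Z j i) ≡⟨ cong₂ _*_ (eq i j jj) (eq j i ii) ⟩
              Col.total i * Col.total j                         ≡⟨ sym (cong₂ _*_ (eq i i ii) (eq j j jj)) ⟩
              (size i - r) * zii * ((size j - r) * zjj)         ≡⟨ reorder′ (size i - r) (size j - r) zii zjj ⟩
              (size i - r) * (size j - r) * (zii * zjj)         ∎)
              where
              zij zii zjj : ℤ
              zij = entry Z i j
              zii = entry Z i i
              zjj = entry Z j j
              nz : ℤ.NonZero ((size i - r) * (size j - r))
              nz = ℤ.≢-nonZero λ e → no-zero (ℤ.i*j≡0⇒i≡0∨j≡0 (size i - r) e)
                where
                no-zero : size i - r ≡ 0ℤ ⊎ size j - r ≡ 0ℤ → ⊥
                no-zero (inj₁ e) = diff≢0 i e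
                no-zero (inj₂ e) = diff≢0 j e
              eq : ∀ k l → β l l ≡ true → (size l - r) * entry Z k l ≡ Col.total k
              eq k l ll = trans (sym (Col.balance k l)) (trans (cong (λ t → 𝟙 t * Col.total k) ll) (ℤ.*-identityˡ (Col.total k)))
              reorder : ∀ a b z → a * b * (z * z) ≡ b * z * (a * z)
              reorder = solve-∀
              reorder′ : ∀ a b x y → a * x * (b * y) ≡ a * b * (x * y)
              reorder′ = solve-∀

          -- Z has rank at most one, so (tr Z)² = tr Z²; with Z² = ζ Z this reads μ² = μ.
          multiplicity-≤1 : μ * μ ≡ μ
          multiplicity-≤1 = ℤ.*-cancelˡ-≡ (ζ * ζ) (μ * μ) μ {{ℤ.>-nonZero (*-pos 0<ζ 0<ζ)}} (begin
            ζ * ζ * (μ * μ)                                          ≡⟨ reorder ζ μ ⟩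
            μ * ζ * (μ * ζ)                                          ≡⟨ sym (cong₂ _*_ tr-Z tr-Z) ⟩
            tr Z * tr Z                                              ≡⟨ *-distribʳ-sum (tr Z) (λ i → entry Z i i) ⟩
            sum (λ i → entry Z i i * tr Z)                           ≡⟨ sum-cong-≗ (λ i → *-distribˡ-sum (entry Z i i) (λ j → entry Z j j)) ⟩
            sum (λ i → sum λ j → entry Z i i * entry Z j j)          ≡⟨ sum-cong-≗ (λ i → sum-cong-≗ λ j → sym (rank-one i j)) ⟩
            sum (λ i → sum λ j → entry Z i j * entry Z i j)          ≡⟨ sym (tr-⊠ Z Z) ⟩
            tr (Z ⊠ Z)                                               ≡⟨ tr-cong {Z ⊠ Z} {con ζ ⊠ Z} (λ y → Z-on (⟦ Z ⟧ y) (Z-eig y)) ⟩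
            tr (con ζ ⊠ Z)                                           ≡⟨ trans (tr-con ζ Z) (cong (ζ *_) tr-Z) ⟩
            ζ * (μ * ζ)                                              ≡⟨ reorder′ ζ μ ⟩
            ζ * ζ * μ                                                ∎)
            where
            reorder : ∀ z m → z * z * (m * m) ≡ m * z * (m * z)
            reorder = solve-∀
            reorder′ : ∀ z m → z * (m * z) ≡ z * z * m
            reorder′ = solve-∀

          -- Applied with r = 1, below which no part size can lie. The factors size - r are then
          -- positive on the support, and every entry of an eigenvector has the sign of its total.
          module Minimal (r≤size : ∀ i → β i i ≡ true → r ≤ size i) where
            private
              0<diff : ∀ l → β l l ≡ true → 0ℤ < size l - r
              0<diff l ll = ℤ.≤∧≢⇒< (ℤ.i≤j⇒0≤j-i (r≤size l ll)) (λ e → diff≢0 l (sym e))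

              -- A part l has entry sum (size l) z_l = total + r z_l, which exceeds the total if total z_l > 0.
              z≡0 : ∀ i → entry Z i i ≡ 0ℤ
              z≡0 i with β i i in ii
              ... | false = Col.off-support i i ii
              ... | true = *-cancel-≡0 (size i - r) (entry Z i i) (0<diff i ii) (trans (sym (Col.balance i i)) (trans (cong (ν i *_) t≡0) (ℤ.*-zeroʳ (ν i))))
                where
                t : ℤ
                t = Col.total i
                z : Fin n → ℤ
                z = entry Z i
                nonneg : ∀ l → 0ℤ ≤ t * z l
                nonneg l with β l l in ll
                ... | false = ℤ.≤-reflexive (sym (trans (cong (t *_) (Col.off-support i l ll)) (ℤ.*-zeroʳ t)))
                ... | true  = nonneg-cancel (0<diff l ll) (subst (0ℤ ≤_) (begin
                    t * t                         ≡⟨ cong (t *_) (trans (sym (ℤ.*-identityˡ t)) (trans (cong (λ b → 𝟙 b * t) (sym ll)) (Col.balance i l))) ⟩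
                    t * ((size l - r) * z l)      ≡⟨ swap t (size l - r) (z l) ⟩
                    (size l - r) * (t * z l)      ∎) (square-nonneg t))
                  where
                  swap : ∀ t d z → t * (d * z) ≡ d * (t * z)
                  swap = solve-∀
                balance-i : t ≡ (size i - r) * z i
                balance-i = trans (sym (ℤ.*-identityˡ t)) (trans (cong (λ b → 𝟙 b * t) (sym ii)) (Col.balance i i))
                part≤total : t * (size i * z i) ≤ t * t
                part≤total = subst₂ _≤_ (begin
                    sum (λ j → b i j * (t * z j))    ≡⟨ sum-cong-≗ (λ j → swap (b i j) t (z j)) ⟩
                    sum (λ j → t * (b i j * z j))    ≡⟨ sum-scale t (λ j → b i j * z j) ⟩
                    t * ⟨ b i , z ⟩                  ≡⟨ cong (t *_) (class-sum z (Col.constant i) i) ⟩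
                    t * (size i * z i)               ∎)
                  (sum-scale t z)
                  (sum-mono λ j → b*≤ (β i j) (nonneg j))
                  where
                  swap : ∀ b t z → b * (t * z) ≡ t * (b * z)
                  swap = solve-∀
                  b*≤ : ∀ β {x} → 0ℤ ≤ x → 𝟙 β * x ≤ x
                  b*≤ true  {x} _   = ℤ.≤-reflexive (ℤ.*-identityˡ x)
                  b*≤ false {x} 0≤x = subst (_≤ x) (sym (ℤ.*-zeroˡ x)) 0≤x
                tz≡0 : t * z i ≡ 0ℤ
                tz≡0 = ℤ.≤-antisym (nonpos-if {r} {t * z i} {t * t - t * (size i * z i)} 0<r (ℤ.i≤j⇒0≤j-i part≤total)
                    (trans (cong (λ s → r * (t * z i) + (t * s - t * (size i * z i))) balance-i) (arith r t (size i) (z i)))) (nonneg i)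
                  where
                  arith : ∀ r t s z → r * (t * z) + (t * ((s - r) * z) - t * (s * z)) ≡ 0ℤ
                  arith = solve-∀
                t≡0 : t ≡ 0ℤ
                t≡0 = square≡0 t (trans (cong (t *_) balance-i) (trans (swap t (size i - r) (z i)) (trans (cong ((size i - r) *_) tz≡0) (ℤ.*-zeroʳ (size i - r)))))
                  where
                  swap : ∀ t d z → t * (d * z) ≡ d * (t * z)
                  swap = solve-∀

            multiplicity-0 : μ ≡ 0ℤ
            multiplicity-0 = *-cancel-≡0 ζ μ 0<ζ (trans (ℤ.*-comm ζ μ) (trans (sym tr-Z) (sum-zero z≡0)))

-- Recovering the part sizes of the unknown graph

module Recognition where

  open import Data.Integer.Base using (ℤ; +_; _+_; _*_; -_; _-_; 0ℤ; 1ℤ; _≤_; _<_; +≤+; +<+)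
  open Determinants
  open MatrixPolynomials
  open OnePositiveEigenvalue
  open Partitions
  open BlockSpectra
  open Multiplicities

  open ≡-Reasoning

  ∧-true : ∀ x y → x ∧ y ≡ true → x ≡ true × y ≡ true
  ∧-true true true _ = refl , refl

  not-true : ∀ x → not x ≡ true → x ≡ false
  not-true false _ = refl

  ≡-from-diff : ∀ {a b} → a ≡ b → a - b ≡ 0ℤ
  ≡-from-diff {a} refl = ℤ.+-inverseʳ a

  +-mono-≡0 : ∀ {x y z w} → 0ℤ ≤ x → 0ℤ ≤ y → 0ℤ ≤ z → 0ℤ ≤ w → x + y + z + w ≡ 0ℤ → x ≡ 0ℤ × w ≡ 0ℤ
  +-mono-≡0 {x} {y} {z} {w} 0≤x 0≤y 0≤z 0≤w eq =
    proj₁ (+-nonneg-≡0 {x} {y} 0≤x 0≤y (proj₁ xyz)) , proj₂ xyzw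
    where
    xyzw : x + y + z ≡ 0ℤ × w ≡ 0ℤ
    xyzw = +-nonneg-≡0 {x + y + z} {w} (ℤ.+-mono-≤ (ℤ.+-mono-≤ 0≤x 0≤y) 0≤z) 0≤w eq
    xyz : x + y ≡ 0ℤ × z ≡ 0ℤ
    xyz = +-nonneg-≡0 {x + y} {z} (ℤ.+-mono-≤ 0≤x 0≤y) 0≤z (proj₁ xyzw)

  -- s₂ and s₁ are eliminated by means of the numbers of triangles and edges.
  eliminate-singles : ∀ v q t s₁ s₂ P →
    P ≡ 1ℤ * s₂ + - (+ 2 * q) * s₁ + (q * q * (v + + 2 * q - t) + - ((1ℤ - q) * (1ℤ - q)) * v) →
    (v + + 2 * q - t) * (v + + 2 * q - t) - s₁ ≡ (v + + 2 * q) * (v + + 2 * q) - (v + + 2 * q * q) →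
    (v + + 2 * q - t) * (v + + 2 * q - t) * (v + + 2 * q - t) - + 3 * ((v + + 2 * q - t) * s₁) + + 2 * s₂ ≡
      (v + + 2 * q) * (v + + 2 * q) * (v + + 2 * q) - + 3 * ((v + + 2 * q) * (v + + 2 * q * q)) + + 2 * (v + + 2 * q * (q * q)) →
    + 2 * P + + 2 * (t * (s₁ - v)) + + 2 * (v * (t * (v + + 2 * q - t - v))) + + 3 * (v * ((v + 1ℤ) * t)) ≡ 0ℤ
  eliminate-singles v q t s₁ s₂ P P≡ E₁ E₂ = trans
    (cong (λ z → + 2 * z + + 2 * (t * (s₁ - v)) + + 2 * (v * (t * (v + + 2 * q - t - v))) + + 3 * (v * ((v + 1ℤ) * t))) P≡)
    -- The multiplier c of the edge equation is dictated by the coefficient of s₁: -3 n′ - c has to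
    -- be 2 t - 4 q, with n′ = v + 2 q - t.
    (trans (arith v q t s₁ s₂) (trans (cong₂ (λ x y → x + (+ 4 * q - + 2 * t - + 3 * (v + + 2 * q - t)) * y) (≡-from-diff E₂) (≡-from-diff E₁))
      (cong (λ z → 0ℤ + z) (ℤ.*-zeroʳ (+ 4 * q - + 2 * t - + 3 * (v + + 2 * q - t))))))
    where
    arith : ∀ v q t s₁ s₂ →
      + 2 * (1ℤ * s₂ + - (+ 2 * q) * s₁ + (q * q * (v + + 2 * q - t) + - ((1ℤ - q) * (1ℤ - q)) * v))
        + + 2 * (t * (s₁ - v)) + + 2 * (v * (t * (v + + 2 * q - t - v))) + + 3 * (v * ((v + 1ℤ) * t)) ≡
      ((v + + 2 * q - t) * (v + + 2 * q - t) * (v + + 2 * q - t) - + 3 * ((v + + 2 * q - t) * s₁) + + 2 * s₂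
        - ((v + + 2 * q) * (v + + 2 * q) * (v + + 2 * q) - + 3 * ((v + + 2 * q) * (v + + 2 * q * q)) + + 2 * (v + + 2 * q * (q * q))))
      + (+ 4 * q - + 2 * t - + 3 * (v + + 2 * q - t)) *
        ((v + + 2 * q - t) * (v + + 2 * q - t) - s₁ - ((v + + 2 * q) * (v + + 2 * q) - (v + + 2 * q * q)))
    arith = solve-∀

  -- For v = 1: T counts triangles after deletion of a part of size c, which lowers n′, s₁, s₂ by c,
  -- c², c³. Subtracting 3 c times the edge equation from the triangle equation removes s₁ and s₂.
  -- The summand 0 fits the four-term shape of `+-mono-≡0`.
  eliminate-part : ∀ c q t s₁ s₂ T →
    T ≡ (1ℤ + + 2 * q - t - c) * (1ℤ + + 2 * q - t - c) * (1ℤ + + 2 * q - t - c) - + 3 * ((1ℤ + + 2 * q - t - c) * (s₁ - c * c)) + + 2 * (s₂ - c * (c * c)) →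
    (1ℤ + + 2 * q - t) * (1ℤ + + 2 * q - t) - s₁ ≡ (1ℤ + + 2 * q) * (1ℤ + + 2 * q) - (1ℤ + + 2 * q * q) →
    (1ℤ + + 2 * q - t) * (1ℤ + + 2 * q - t) * (1ℤ + + 2 * q - t) - + 3 * ((1ℤ + + 2 * q - t) * s₁) + + 2 * s₂ ≡
      (1ℤ + + 2 * q) * (1ℤ + + 2 * q) * (1ℤ + + 2 * q) - + 3 * ((1ℤ + + 2 * q) * (1ℤ + + 2 * q * q)) + + 2 * (1ℤ + + 2 * q * (q * q)) →
    + 6 * ((c - q) * (c - q) * (c - 1ℤ)) + 0ℤ + T + + 6 * (c * c * t) ≡ 0ℤ
  eliminate-part c q t s₁ s₂ T T≡ E₁ E₂ = trans
    (cong (λ z → + 6 * ((c - q) * (c - q) * (c - 1ℤ)) + 0ℤ + z + + 6 * (c * c * t)) T≡)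
    (trans (arith c q t s₁ s₂) (trans (cong₂ (λ x y → x + - (+ 3 * c) * y) (≡-from-diff E₂) (≡-from-diff E₁))
      (cong (λ z → 0ℤ + z) (ℤ.*-zeroʳ (- (+ 3 * c))))))
    where
    arith : ∀ c q t s₁ s₂ →
      + 6 * ((c - q) * (c - q) * (c - 1ℤ)) + 0ℤ
        + ((1ℤ + + 2 * q - t - c) * (1ℤ + + 2 * q - t - c) * (1ℤ + + 2 * q - t - c) - + 3 * ((1ℤ + + 2 * q - t - c) * (s₁ - c * c)) + + 2 * (s₂ - c * (c * c)))
        + + 6 * (c * c * t) ≡
      ((1ℤ + + 2 * q - t) * (1ℤ + + 2 * q - t) * (1ℤ + + 2 * q - t) - + 3 * ((1ℤ + + 2 * q - t) * s₁) + + 2 * s₂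
        - ((1ℤ + + 2 * q) * (1ℤ + + 2 * q) * (1ℤ + + 2 * q) - + 3 * ((1ℤ + + 2 * q) * (1ℤ + + 2 * q * q)) + + 2 * (1ℤ + + 2 * q * (q * q))))
      + - (+ 3 * c) * ((1ℤ + + 2 * q - t) * (1ℤ + + 2 * q - t) - s₁ - ((1ℤ + + 2 * q) * (1ℤ + + 2 * q) - (1ℤ + + 2 * q * q)))
    arith = solve-∀

  conclude-singles : ∀ v q t s₁ P → 0ℤ < v → 0ℤ ≤ t → 0ℤ ≤ P → 0ℤ ≤ s₁ - v → 0ℤ ≤ v + + 2 * q - t - v →
    + 2 * P + + 2 * (t * (s₁ - v)) + + 2 * (v * (t * (v + + 2 * q - t - v))) + + 3 * (v * ((v + 1ℤ) * t)) ≡ 0ℤ → P ≡ 0ℤ × t ≡ 0ℤ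
  conclude-singles v q t s₁ P 0<v 0≤t 0≤P 0≤s₁-v 0≤m eq =
    *-cancel-≡0 (+ 2) P (+<+ (ℕ.s≤s ℕ.z≤n)) (proj₁ split) ,
    *-cancel-≡0 (v + 1ℤ) t 0<v+1 (*-cancel-≡0 v ((v + 1ℤ) * t) 0<v
      (*-cancel-≡0 (+ 3) (v * ((v + 1ℤ) * t)) (+<+ (ℕ.s≤s ℕ.z≤n)) (proj₂ split)))
    where
    m = v + + 2 * q - t - v
    0<v+1 : 0ℤ < v + 1ℤ
    0<v+1 = ℤ.+-mono-<-≤ 0<v (+≤+ ℕ.z≤n)
    split : + 2 * P ≡ 0ℤ × + 3 * (v * ((v + 1ℤ) * t)) ≡ 0ℤ
    split = +-mono-≡0 {+ 2 * P} {+ 2 * (t * (s₁ - v))} {+ 2 * (v * (t * m))} {+ 3 * (v * ((v + 1ℤ) * t))}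
      (*-nonneg {+ 2} {P} (+≤+ ℕ.z≤n) 0≤P)
      (*-nonneg {+ 2} {t * (s₁ - v)} (+≤+ ℕ.z≤n) (*-nonneg {t} {s₁ - v} 0≤t 0≤s₁-v))
      (*-nonneg {+ 2} {v * (t * m)} (+≤+ ℕ.z≤n) (*-nonneg {v} {t * m} (ℤ.<⇒≤ 0<v) (*-nonneg {t} {m} 0≤t 0≤m)))
      (*-nonneg {+ 3} {v * ((v + 1ℤ) * t)} (+≤+ ℕ.z≤n)
        (*-nonneg {v} {(v + 1ℤ) * t} (ℤ.<⇒≤ 0<v) (*-nonneg {v + 1ℤ} {t} (ℤ.<⇒≤ 0<v+1) 0≤t))) eq

  conclude-part : ∀ c q t T → 1ℤ < c → 0ℤ ≤ t → 0ℤ ≤ T →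
    + 6 * ((c - q) * (c - q) * (c - 1ℤ)) + 0ℤ + T + + 6 * (c * c * t) ≡ 0ℤ → c ≡ q × t ≡ 0ℤ
  conclude-part c q t T 1<c 0≤t 0≤T eq =
    ℤ.i-j≡0⇒i≡j c q (square≡0 (c - q) (*-cancel-≡0 (c - 1ℤ) ((c - q) * (c - q)) 0<c-1
      (trans (ℤ.*-comm (c - 1ℤ) ((c - q) * (c - q))) (*-cancel-≡0 (+ 6) ((c - q) * (c - q) * (c - 1ℤ)) (+<+ (ℕ.s≤s ℕ.z≤n)) (proj₁ split))))) ,
    *-cancel-≡0 (c * c) t (*-pos {c} {c} 0<c 0<c) (*-cancel-≡0 (+ 6) (c * c * t) (+<+ (ℕ.s≤s ℕ.z≤n)) (proj₂ split))
    where
    0<c-1 : 0ℤ < c - 1ℤ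
    0<c-1 = ℤ.+-monoˡ-< (- 1ℤ) 1<c
    0<c : 0ℤ < c
    0<c = ℤ.<-trans (+<+ (ℕ.s≤s ℕ.z≤n)) 1<c
    split : + 6 * ((c - q) * (c - q) * (c - 1ℤ)) ≡ 0ℤ × + 6 * (c * c * t) ≡ 0ℤ
    split = +-mono-≡0 {+ 6 * ((c - q) * (c - q) * (c - 1ℤ))} {0ℤ} {T} {+ 6 * (c * c * t)}
      (*-nonneg {+ 6} {(c - q) * (c - q) * (c - 1ℤ)} (+≤+ ℕ.z≤n) (*-nonneg {(c - q) * (c - q)} {c - 1ℤ} (square-nonneg (c - q)) (ℤ.<⇒≤ 0<c-1))) ℤ.≤-refl 0≤T
      (*-nonneg {+ 6} {c * c * t} (+≤+ ℕ.z≤n) (*-nonneg {c * c} {t} (square-nonneg c) 0≤t)) eq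

  -- The graph is already multipartite up to isolated vertices; what is left is to find the part
  -- sizes and to exclude isolated vertices.
  module MultipartiteCase {n} (adj : Fin n → Fin n → Bool) (adj-sym : ∀ i j → adj i j ≡ adj j i) (adj-irrefl : ∀ i → adj i i ≡ false)
      (v p q : ℤ) (0<v : 0ℤ < v) (1<p : 1ℤ < p) (1<q : 1ℤ < q) (order≡ : sum {n} (λ _ → 1ℤ) ≡ v + p * q)
      (A : Matrix n) (A≡adj : ∀ i j → A i j ≡ 𝟙 (adj i j)) (A-sym : ∀ i j → A i j ≡ A j i) (β : Fin n → Fin n → Bool)
      (β-sym : ∀ i j → β i j ≡ β j i) (β-trans : ∀ {i j k} → β i j ≡ true → β j k ≡ true → β i k ≡ true)
      (β≤ : ∀ i j → 𝟙 (β i j) ≤ 𝟙 (not (adj i j)))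
      (β-on : ∀ i j → β i i ≡ true → β j j ≡ true → β i j ≡ not (adj i j))
      (isolated : ∀ i → β i i ≡ false → ∀ j → adj i j ≡ false) where

    open Operator A A-sym
    open PER β β-sym β-trans

    module _ (A≡multi : ∀ i j → A i j ≡ multi i j) (Z₁ Z_q : Pol) (ζ₁ ζ_q : ℤ) (0<ζ₁ : 0ℤ < ζ₁) (0<ζ_q : 0ℤ < ζ_q)
        (Z₁-eig : ∀ y l → act A (⟦ Z₁ ⟧ y) l ≡ - 1ℤ * ⟦ Z₁ ⟧ y l)
        (Z_q-eig : ∀ y l → act A (⟦ Z_q ⟧ y) l ≡ - q * ⟦ Z_q ⟧ y l) (eval-Z₁ : eval Z₁ (- 1ℤ) ≡ ζ₁)
        (eval-Z_q : eval Z_q (- q) ≡ ζ_q) (tr-Z₁ : tr Z₁ ≡ (v - 1ℤ) * ζ₁) (tr-Z_q : tr Z_q ≡ (p - 1ℤ) * ζ_q)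
        (edges : tr (X ⊠ X) ≡ (v + p * q) * (v + p * q) - (v + p * q * q))
        (tris : tr (X ⊠ (X ⊠ X)) ≡ (v + p * q) * (v + p * q) * (v + p * q) - + 3 * ((v + p * q) * (v + p * q * q)) + + 2 * (v + p * q * (q * q))) where

      0<q : 0ℤ < q
      0<q = ℤ.<-trans (+<+ (ℕ.s≤s ℕ.z≤n)) 1<q

      0<q-1 : 0ℤ < q - 1ℤ
      0<q-1 = ℤ.+-monoˡ-< (- 1ℤ) 1<q

      0<p : 0ℤ < p
      0<p = ℤ.<-trans (+<+ (ℕ.s≤s ℕ.z≤n)) 1<p

      open Multipartite.Adjacency β β-sym β-trans A A-sym A≡multi using (tr-XX; tr-XXX; module Multiplicity)

      private
        E₁ : n′ * n′ - s₁ ≡ (v + p * q) * (v + p * q) - (v + p * q * q)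
        E₁ = trans (sym tr-XX) edges

        E₂ : n′ * n′ * n′ - + 3 * (n′ * s₁) + + 2 * s₂ ≡
             (v + p * q) * (v + p * q) * (v + p * q) - + 3 * ((v + p * q) * (v + p * q * q)) + + 2 * (v + p * q * (q * q))
        E₂ = trans (sym tr-XXX) tris

        non-degree : Fin n → ℤ
        non-degree i = sum λ j → 𝟙 (not (adj i j))

        -- All ordered pairs minus twice the number of edges; a vertex counts as non-adjacent to
        -- itself.
        sum-non-degree : sum non-degree ≡ v + p * q * q
        sum-non-degree = begin
          sum (λ i → sum λ j → 𝟙 (not (adj i j)))
            ≡⟨ sum-cong-≗ (λ i → trans (sum-cong-≗ λ j → trans (𝟙-not (adj i j)) (trans (cong (λ z → 1ℤ - z) (trans (sym (A≡adj i j)) (A≡multi i j))) (minus 1ℤ (multi i j))))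
                 (trans (sum-lin 1ℤ (- 1ℤ) (λ _ → 1ℤ) (multi i)) (cong (λ z → 1ℤ * z + - 1ℤ * sum (multi i)) order≡))) ⟩
          sum (λ i → 1ℤ * (v + p * q) + - 1ℤ * sum (multi i))
            ≡⟨ trans (sum-cong-≗ λ i → cong (_+ - 1ℤ * sum (multi i)) (ℤ.*-comm 1ℤ (v + p * q))) (sum-lin (v + p * q) (- 1ℤ) (λ _ → 1ℤ) (λ i → sum (multi i))) ⟩
          (v + p * q) * sum {n} (λ _ → 1ℤ) + - 1ℤ * sum (λ i → sum (multi i))
            ≡⟨ cong₂ (λ x y → (v + p * q) * x + - 1ℤ * y) order≡ (trans edge-count E₁) ⟩
          (v + p * q) * (v + p * q) + - 1ℤ * ((v + p * q) * (v + p * q) - (v + p * q * q))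
            ≡⟨ cancel ((v + p * q) * (v + p * q)) (v + p * q * q) ⟩
          v + p * q * q ∎
          where
          minus : ∀ a b → a - b ≡ a * 1ℤ + - 1ℤ * b
          minus = solve-∀
          cancel : ∀ a b → a + - 1ℤ * (a - b) ≡ b
          cancel = solve-∀

        -- An isolated vertex would be non-adjacent to all v + p q vertices, more than q and more
        -- than 1. So the support is everything, and non-adjacency coincides with β and is
        -- transitive.
        blocks-from : (R : Fin n → Bool) → (∀ i → non-degree i ≡ (if R i then q else 1ℤ)) →
          sum (λ i → 𝟙 (R i)) ≡ p * q → sum (λ i → 𝟙 (not (R i))) ≡ v → Blocks (λ i j → not (adj i j)) v p q
        blocks-from R sizes #R #¬R = record
          { β-refl  = λ i → cong not (adj-irrefl i)
          ; β-sym   = λ i j → cong not (adj-sym i j)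
          ; β-trans = λ {i} {j} {k} ij jk → trans (sym (β≡ i k)) (β-trans {i} {j} {k} (trans (β≡ i j) ij) (trans (β≡ j k) jk))
          ; R       = R
          ; size≡   = sizes
          ; #R      = #R
          ; #¬R     = #¬R
          }
          where
          q<order : q < v + p * q
          q<order = subst₂ _<_ (ℤ.+-identityˡ q) refl (ℤ.+-mono-<-≤ 0<v (subst₂ _≤_ (ℤ.*-identityˡ q) refl (ℤ.*-monoʳ-≤-nonNeg q {{ℤ.nonNegative (ℤ.<⇒≤ 0<q)}} (ℤ.<⇒≤ 1<p))))
          supported : ∀ i → β i i ≡ true
          supported i with β i i in ii
          ... | true  = refl
          ... | false with R i | trans (sym (sizes i)) (trans (sum-cong-≗ λ j → cong (𝟙 ∘ not) (isolated i ii j)) order≡)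
          ...   | true  | e = ⊥-elim (ℤ.<-irrefl e q<order)
          ...   | false | e = ⊥-elim (ℤ.<-irrefl e (ℤ.<-trans 1<q q<order))
          β≡ : ∀ i j → β i j ≡ not (adj i j)
          β≡ i j = β-on i j (supported i) (supported j)

        size≤non-degree : ∀ i → size i ≤ non-degree i
        size≤non-degree i = sum-mono (β≤ i)

        1≤non-degree : ∀ i → 1ℤ ≤ non-degree i
        1≤non-degree i = subst (_≤ non-degree i) (cong (𝟙 ∘ not) (adj-irrefl i)) (term≤sum (λ j → 𝟙-nonneg (not (adj i j))) i)

        count-not : (R : Fin n → Bool) → sum (λ i → 𝟙 (R i)) + sum (λ i → 𝟙 (not (R i))) ≡ v + p * q
        count-not R = trans (sym (∑-distrib-+ (λ i → 𝟙 (R i)) (λ i → 𝟙 (not (R i))))) (trans (sum-cong-≗ λ i → total (R i)) order≡)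
          where
          total : ∀ r → 𝟙 r + 𝟙 (not r) ≡ 1ℤ
          total true  = refl
          total false = refl

      private
        module At-1 = Multiplicity 1ℤ (v - 1ℤ) ζ₁ (+<+ (ℕ.s≤s ℕ.z≤n)) 0<ζ₁ Z₁ Z₁-eig eval-Z₁ tr-Z₁
        module At-q = Multiplicity q (p - 1ℤ) ζ_q 0<q 0<ζ_q Z_q Z_q-eig eval-Z_q tr-Z_q

        n-1≢0 : ∀ {x} → 1ℤ < x → x - 1ℤ ≢ 0ℤ
        n-1≢0 {x} 1<x e = ℤ.<-irrefl (sym (ℤ.i-j≡0⇒i≡j x 1ℤ e)) 1<x

      -- p parts of size q leave v vertices, and the number of edges forces these to
      -- be adjacent to everything.
      module q-parts (i₀ : Fin n) (i₀-size : size i₀ ≡ q) where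
        private
          R : Fin n → Bool
          R i = does (At-q.ρ? i)

          #R : sum (λ i → 𝟙 (R i)) ≡ p * q
          #R = trans (At-q.Present.#ρ i₀ i₀-size) (arith p q)
            where
            arith : ∀ p q → q * (p - 1ℤ + 1ℤ) ≡ p * q
            arith = solve-∀

          #¬R : sum (λ i → 𝟙 (not (R i))) ≡ v
          #¬R = +-cancelˡ (p * q) (sum λ i → 𝟙 (not (R i))) v (trans (cong (_+ sum (λ i → 𝟙 (not (R i)))) (sym #R)) (trans (count-not R) (ℤ.+-comm v (p * q))))

          f : Fin n → ℤ
          f i = if R i then q else 1ℤ

          f≤ : ∀ i → f i ≤ non-degree i
          f≤ i with At-q.ρ? i
          ... | yes e = subst (_≤ non-degree i) e (size≤non-degree i)
          ... | no  _ = 1≤non-degree i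

          sum-f : sum f ≡ v + p * q * q
          sum-f = begin
            sum f                                              ≡⟨ sum-cong-≗ (λ i → split (R i)) ⟩
            sum (λ i → q * 𝟙 (R i) + 1ℤ * 𝟙 (not (R i)))       ≡⟨ sum-lin q 1ℤ (λ i → 𝟙 (R i)) (λ i → 𝟙 (not (R i))) ⟩
            q * sum (λ i → 𝟙 (R i)) + 1ℤ * sum (λ i → 𝟙 (not (R i))) ≡⟨ cong₂ (λ x y → q * x + 1ℤ * y) #R #¬R ⟩
            q * (p * q) + 1ℤ * v                               ≡⟨ arith v p q ⟩
            v + p * q * q                                      ∎
            where
            split : ∀ r → (if r then q else 1ℤ) ≡ q * 𝟙 r + 1ℤ * 𝟙 (not r)
            split true  = one q
              where
              one : ∀ q → q ≡ q * 1ℤ + 1ℤ * 0ℤ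
              one = solve-∀
            split false = zero′ q
              where
              zero′ : ∀ q → 1ℤ ≡ q * 0ℤ + 1ℤ * 1ℤ
              zero′ = solve-∀
            arith : ∀ v p q → q * (p * q) + 1ℤ * v ≡ v + p * q * q
            arith = solve-∀

        result : Blocks (λ i j → not (adj i j)) v p q
        result = blocks-from R (λ i → sym (sum-mono-≡ f≤ (trans sum-f (sym sum-non-degree)) i)) #R #¬R

      -- Without a part of size q the multiplicity μ = p - 1 of -q would satisfy μ² = μ, so p would
      -- be 1 or 2.
      p≢2⇒blocks : p ≢ + 2 → Blocks (λ i j → not (adj i j)) v p q
      p≢2⇒blocks p≢2 with Fin.any? At-q.ρ?
      ... | yes (i₀ , e) = q-parts.result i₀ e
      ... | no none = ⊥-elim (contradict (ℤ.i*j≡0⇒i≡0∨j≡0 (p - 1ℤ) product≡0))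
        where
        expand : ∀ p → (p - 1ℤ) * (p - + 2) ≡ (p - 1ℤ) * (p - 1ℤ) - (p - 1ℤ)
        expand = solve-∀
        product≡0 : (p - 1ℤ) * (p - + 2) ≡ 0ℤ
        product≡0 = trans (expand p) (≡-from-diff (At-q.Absent.multiplicity-≤1 (λ i e → none (i , e))))
        contradict : p - 1ℤ ≡ 0ℤ ⊎ p - + 2 ≡ 0ℤ → ⊥
        contradict (inj₁ e) = n-1≢0 1<p e
        contradict (inj₂ e) = p≢2 (ℤ.i-j≡0⇒i≡j p (+ 2) e)

      private
        t : ℤ
        t = v + p * q - n′

        n′≡ : n′ ≡ v + p * q - t
        n′≡ = arith (v + p * q) n′
          where
          arith : ∀ a b → b ≡ a - (a - b)
          arith = solve-∀

        ν≤1 : ∀ i → ν i ≤ 1ℤ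
        ν≤1 i with β i i
        ... | true  = ℤ.≤-refl
        ... | false = +≤+ ℕ.z≤n

        0≤t : 0ℤ ≤ t
        0≤t = ℤ.i≤j⇒0≤j-i (subst (n′ ≤_) order≡ (sum-mono ν≤1))

        t≡0⇒ν≡1 : t ≡ 0ℤ → ∀ i → ν i ≡ 1ℤ
        t≡0⇒ν≡1 t≡0 = sum-mono-≡ ν≤1 (trans (sym (ℤ.i-j≡0⇒i≡j (v + p * q) n′ t≡0)) (sym order≡))

      module p≡2 (p≡2 : p ≡ + 2) where

        private
          E₁′ : (v + + 2 * q - t) * (v + + 2 * q - t) - s₁ ≡ (v + + 2 * q) * (v + + 2 * q) - (v + + 2 * q * q)
          E₁′ = subst (λ p → (v + p * q - t) * (v + p * q - t) - s₁ ≡ (v + p * q) * (v + p * q) - (v + p * q * q)) p≡2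
            (trans (cong (λ m → m * m - s₁) (sym n′≡)) E₁)

          E₂′ : (v + + 2 * q - t) * (v + + 2 * q - t) * (v + + 2 * q - t) - + 3 * ((v + + 2 * q - t) * s₁) + + 2 * s₂ ≡
                (v + + 2 * q) * (v + + 2 * q) * (v + + 2 * q) - + 3 * ((v + + 2 * q) * (v + + 2 * q * q)) + + 2 * (v + + 2 * q * (q * q))
          E₂′ = subst (λ p → (v + p * q - t) * (v + p * q - t) * (v + p * q - t) - + 3 * ((v + p * q - t) * s₁) + + 2 * s₂ ≡
                (v + p * q) * (v + p * q) * (v + p * q) - + 3 * ((v + p * q) * (v + p * q * q)) + + 2 * (v + p * q * (q * q))) p≡2
            (trans (cong (λ m → m * m * m - + 3 * (m * s₁) + + 2 * s₂) (sym n′≡)) E₂)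

          n′≡2 : n′ ≡ v + + 2 * q - t
          n′≡2 = subst (λ p → n′ ≡ v + p * q - t) p≡2 n′≡

        module singles (i₀ : Fin n) (i₀-size : size i₀ ≡ 1ℤ) where
          private
            ρ : Fin n → ℤ
            ρ = At-1.ρ

            #ρ : sum ρ ≡ v
            #ρ = trans (At-1.Present.#ρ i₀ i₀-size) (arith v)
              where
              arith : ∀ v → 1ℤ * (v - 1ℤ + 1ℤ) ≡ v
              arith = solve-∀

            ν-of-size-1 : ∀ {i} → size i ≡ 1ℤ → ν i ≡ 1ℤ
            ν-of-size-1 {i} e with β i i | size*ν i
            ... | true  | _ = refl
            ... | false | f with trans (sym (ℤ.*-zeroʳ (size i))) (trans f e)
            ...   | ()

            ρ≤ν : ∀ i → ρ i ≤ ν i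
            ρ≤ν i with At-1.ρ? i
            ... | yes e = ℤ.≤-reflexive (sym (ν-of-size-1 e))
            ... | no  _ = 𝟙-nonneg (β i i)

            -- Over the points of parts of size other than 1, the squared deviation of the part size
            -- from q. Its sum is the P of `eliminate-singles`.
            spread : Fin n → ℤ
            spread i = (ν i - ρ i) * ((size i - q) * (size i - q))

            spread-nonneg : ∀ i → 0ℤ ≤ spread i
            spread-nonneg i = *-nonneg (ℤ.i≤j⇒0≤j-i (ρ≤ν i)) (square-nonneg (size i - q))

            spread≡ : ∀ i → spread i ≡ 1ℤ * (size i * size i) + - (+ 2 * q) * size i + (q * q * ν i + - ((1ℤ - q) * (1ℤ - q)) * ρ i)
            spread≡ i with At-1.ρ? i
            ... | yes e = trans (cong₂ (λ x y → (x - 1ℤ) * ((y - q) * (y - q))) (ν-of-size-1 e) e)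
                (trans (arith q) (sym (cong₂ (λ x y → 1ℤ * (y * y) + - (+ 2 * q) * y + (q * q * x + - ((1ℤ - q) * (1ℤ - q)) * 1ℤ)) (ν-of-size-1 e) e)))
              where
              arith : ∀ q → (1ℤ - 1ℤ) * ((1ℤ - q) * (1ℤ - q)) ≡ 1ℤ * (1ℤ * 1ℤ) + - (+ 2 * q) * 1ℤ + (q * q * 1ℤ + - ((1ℤ - q) * (1ℤ - q)) * 1ℤ)
              arith = solve-∀
            ... | no _ = trans (arith₁ (ν i) (size i) q) (trans (cong (λ z → z * size i + - (+ 2 * q) * z + (q * q * ν i + - ((1ℤ - q) * (1ℤ - q)) * 0ℤ)) (size*ν i))
                (arith₂ (size i) q (ν i)))
              where
              arith₁ : ∀ v s q → (v - 0ℤ) * ((s - q) * (s - q)) ≡ s * v * s + - (+ 2 * q) * (s * v) + (q * q * v + - ((1ℤ - q) * (1ℤ - q)) * 0ℤ)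
              arith₁ = solve-∀
              arith₂ : ∀ s q v → s * s + - (+ 2 * q) * s + (q * q * v + - ((1ℤ - q) * (1ℤ - q)) * 0ℤ) ≡
                1ℤ * (s * s) + - (+ 2 * q) * s + (q * q * v + - ((1ℤ - q) * (1ℤ - q)) * 0ℤ)
              arith₂ = solve-∀

            sum-spread : sum spread ≡ 1ℤ * s₂ + - (+ 2 * q) * s₁ + (q * q * (v + + 2 * q - t) + - ((1ℤ - q) * (1ℤ - q)) * v)
            sum-spread = trans (sum-cong-≗ spread≡) (trans
              (∑-distrib-+ (λ i → 1ℤ * (size i * size i) + - (+ 2 * q) * size i) (λ i → q * q * ν i + - ((1ℤ - q) * (1ℤ - q)) * ρ i))
              (cong₂ _+_ (sum-lin 1ℤ (- (+ 2 * q)) (λ i → size i * size i) size)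
                (trans (sum-lin (q * q) (- ((1ℤ - q) * (1ℤ - q))) ν ρ) (cong₂ (λ x y → q * q * x + - ((1ℤ - q) * (1ℤ - q)) * y) n′≡2 #ρ))))

            0≤s₁-v : 0ℤ ≤ s₁ - v
            0≤s₁-v = ℤ.i≤j⇒0≤j-i (subst (_≤ s₁) #ρ (sum-mono λ i → ℤ.≤-trans (ρ≤ν i) (ν≤size i)))

            0≤2q-t : 0ℤ ≤ v + + 2 * q - t - v
            0≤2q-t = ℤ.i≤j⇒0≤j-i (subst₂ _≤_ #ρ n′≡2 (sum-mono ρ≤ν))

            identity : + 2 * sum spread + + 2 * (t * (s₁ - v)) + + 2 * (v * (t * (v + + 2 * q - t - v))) + + 3 * (v * ((v + 1ℤ) * t)) ≡ 0ℤ
            identity = eliminate-singles v q t s₁ s₂ (sum spread) sum-spread E₁′ E₂′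

            conclusion : sum spread ≡ 0ℤ × t ≡ 0ℤ
            conclusion = conclude-singles v q t s₁ (sum spread) 0<v 0≤t (sum-nonneg spread-nonneg) 0≤s₁-v 0≤2q-t identity

            t≡0 : t ≡ 0ℤ
            t≡0 = proj₂ conclusion

            spread≡0 : ∀ i → spread i ≡ 0ℤ
            spread≡0 = sum-nonneg-≡0 spread-nonneg (proj₁ conclusion)

            ν≡1 : ∀ i → ν i ≡ 1ℤ
            ν≡1 = t≡0⇒ν≡1 t≡0

            supported : ∀ i → β i i ≡ true
            supported i = 𝟙-true (β i i) (ν≡1 i)
              where
              𝟙-true : ∀ x → 𝟙 x ≡ 1ℤ → x ≡ true
              𝟙-true true _ = refl

            R : Fin n → Bool
            R i = not (does (At-1.ρ? i))

            size≡non-degree : ∀ i → non-degree i ≡ size i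
            size≡non-degree i = sum-cong-≗ λ j → cong 𝟙 (sym (β-on i j (supported i) (supported j)))

            sizes : ∀ i → size i ≡ (if R i then q else 1ℤ)
            sizes i = case (At-1.ρ? i) (spread≡0 i)
              where
              case : (dec : Dec (size i ≡ 1ℤ)) → (ν i - 𝟙 (does dec)) * ((size i - q) * (size i - q)) ≡ 0ℤ →
                     size i ≡ (if not (does dec) then q else 1ℤ)
              case (yes e) _ = e
              case (no  _) z = ℤ.i-j≡0⇒i≡j (size i) q (square≡0 (size i - q) (trans (sym (ℤ.*-identityˡ ((size i - q) * (size i - q))))
                (trans (cong (λ x → (x - 0ℤ) * ((size i - q) * (size i - q))) (sym (ν≡1 i))) z)))

            #¬R : sum (λ i → 𝟙 (not (R i))) ≡ v
            #¬R = trans (sum-cong-≗ λ i → cong 𝟙 (Bool.not-involutive (does (At-1.ρ? i)))) #ρ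

            #R : sum (λ i → 𝟙 (R i)) ≡ p * q
            #R = +-cancelʳ v (sum λ i → 𝟙 (R i)) (p * q) (trans (cong (λ z → sum (λ i → 𝟙 (R i)) + z) (sym #¬R)) (trans (count-not R) (ℤ.+-comm v (p * q))))

          result : Blocks (λ i j → not (adj i j)) v p q
          result = blocks-from R (λ i → trans (size≡non-degree i) (sizes i)) #R #¬R

        -- For v = 1 the eigenvalue -1 has multiplicity 0 and yields no part of size 1. Deleting any
        -- one part shows that its size is q and that t = 0; the number of edges then gives a
        -- contradiction.
        module no-singles (none : ∀ i → size i ≢ 1ℤ) (v≡1 : v ≡ 1ℤ) where
          private
            1<size : ∀ i → ν i ≡ 1ℤ → 1ℤ < size i
            1<size i e = ℤ.≤∧≢⇒< (subst (_≤ size i) e (ν≤size i)) (none i ∘ sym)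

            E₁″ : (1ℤ + + 2 * q - t) * (1ℤ + + 2 * q - t) - s₁ ≡ (1ℤ + + 2 * q) * (1ℤ + + 2 * q) - (1ℤ + + 2 * q * q)
            E₁″ = subst (λ v → (v + + 2 * q - t) * (v + + 2 * q - t) - s₁ ≡ (v + + 2 * q) * (v + + 2 * q) - (v + + 2 * q * q)) v≡1 E₁′

            E₂″ : (1ℤ + + 2 * q - t) * (1ℤ + + 2 * q - t) * (1ℤ + + 2 * q - t) - + 3 * ((1ℤ + + 2 * q - t) * s₁) + + 2 * s₂ ≡
                  (1ℤ + + 2 * q) * (1ℤ + + 2 * q) * (1ℤ + + 2 * q) - + 3 * ((1ℤ + + 2 * q) * (1ℤ + + 2 * q * q)) + + 2 * (1ℤ + + 2 * q * (q * q))
            E₂″ = subst (λ v → (v + + 2 * q - t) * (v + + 2 * q - t) * (v + + 2 * q - t) - + 3 * ((v + + 2 * q - t) * s₁) + + 2 * s₂ ≡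
                  (v + + 2 * q) * (v + + 2 * q) * (v + + 2 * q) - + 3 * ((v + + 2 * q) * (v + + 2 * q * q)) + + 2 * (v + + 2 * q * (q * q))) v≡1 E₂′

            n′≡3 : n′ ≡ 1ℤ + + 2 * q - t
            n′≡3 = subst (λ v → n′ ≡ v + + 2 * q - t) v≡1 n′≡2

          module DeletePart (i₀ : Fin n) (i₀∈ : ν i₀ ≡ 1ℤ) where
            private
              c : ℤ
              c = size i₀

              -- The deleted part is only taken out of the support, so the ground set stays `Fin n`
              -- and the counts for partial equivalence relations apply unchanged.
              β′ : Fin n → Fin n → Bool
              β′ i j = not (β i₀ i) ∧ β i j

              β′-sym : ∀ i j → β′ i j ≡ β′ j i
              β′-sym i j with β i j in ij
              ... | false = trans (Bool.∧-zeroʳ (not (β i₀ i))) (sym (trans (cong (not (β i₀ j) ∧_) (trans (β-sym j i) ij)) (Bool.∧-zeroʳ (not (β i₀ j)))))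
              ... | true  = cong₂ (λ x y → not x ∧ y) (trans (β-sym i₀ i) (trans (β-rows ij i₀) (β-sym j i₀))) (trans (sym ij) (β-sym i j))

              β′-trans : ∀ {i j k} → β′ i j ≡ true → β′ j k ≡ true → β′ i k ≡ true
              β′-trans {i} {j} {k} ij jk = cong₂ _∧_ (proj₁ (∧-true (not (β i₀ i)) (β i j) ij))
                (β-trans {i} {j} {k} (proj₂ (∧-true (not (β i₀ i)) (β i j) ij)) (proj₂ (∧-true (not (β i₀ j)) (β j k) jk)))

              module Rest = PER β′ β′-sym β′-trans

              ∧-𝟙 : ∀ x y → 𝟙 (not x ∧ y) ≡ (1ℤ - 𝟙 x) * 𝟙 y
              ∧-𝟙 true  y = sym (ℤ.*-zeroˡ (𝟙 y))
              ∧-𝟙 false y = sym (ℤ.*-identityˡ (𝟙 y))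

              size-rest : ∀ i → Rest.size i ≡ (1ℤ - b i₀ i) * size i
              size-rest i = trans (sum-cong-≗ λ j → ∧-𝟙 (β i₀ i) (β i j)) (sum-scale (1ℤ - b i₀ i) (b i))

              expand : ∀ x y → (1ℤ - x) * y ≡ 1ℤ * y + - 1ℤ * (x * y)
              expand = solve-∀

              collapse : ∀ x y → 1ℤ * x + - 1ℤ * y ≡ x - y
              collapse = solve-∀

              rest-sum : ∀ (y : Fin n → ℤ) → ClassConst y → sum (λ i → (1ℤ - b i₀ i) * y i) ≡ sum y - c * y i₀
              rest-sum y const = trans (sum-cong-≗ λ i → expand (b i₀ i) (y i)) (trans (sum-lin 1ℤ (- 1ℤ) y (λ i → b i₀ i * y i))
                (trans (cong (λ z → 1ℤ * sum y + - 1ℤ * z) (class-sum y const i₀)) (collapse (sum y) (c * y i₀))))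

              n-rest : Rest.n′ ≡ 1ℤ + + 2 * q - t - c
              n-rest = trans (sum-cong-≗ λ i → ∧-𝟙 (β i₀ i) (β i i)) (trans (rest-sum ν ν-const)
                (cong₂ _-_ n′≡3 (trans (cong (c *_) i₀∈) (ℤ.*-identityʳ c))))

              s₁-rest : Rest.s₁ ≡ s₁ - c * c
              s₁-rest = trans (sum-cong-≗ size-rest) (rest-sum size (λ i j → size-const))

              s₂-rest : Rest.s₂ ≡ s₂ - c * (c * c)
              s₂-rest = trans (sum-cong-≗ λ i → trans (cong (λ z → z * z) (size-rest i)) (square (β i₀ i) (size i)))
                (rest-sum (λ i → size i * size i) (λ i j ij → cong (λ z → z * z) (size-const ij)))
                where
                square : ∀ x s → (1ℤ - 𝟙 x) * s * ((1ℤ - 𝟙 x) * s) ≡ (1ℤ - 𝟙 x) * (s * s)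
                square true  s = refl′ s
                  where
                  refl′ : ∀ s → (1ℤ - 1ℤ) * s * ((1ℤ - 1ℤ) * s) ≡ (1ℤ - 1ℤ) * (s * s)
                  refl′ = solve-∀
                square false s = refl′ s
                  where
                  refl′ : ∀ s → (1ℤ - 0ℤ) * s * ((1ℤ - 0ℤ) * s) ≡ (1ℤ - 0ℤ) * (s * s)
                  refl′ = solve-∀

              identity : + 6 * ((c - q) * (c - q) * (c - 1ℤ)) + 0ℤ + Rest.triangles + + 6 * (c * c * t) ≡ 0ℤ
              identity = eliminate-part c q t s₁ s₂ Rest.triangles
                (trans Rest.triangle-count (triangles-cong n-rest s₁-rest s₂-rest)) E₁″ E₂″

              1<c : 1ℤ < c
              1<c = 1<size i₀ i₀∈

              conclusion : c ≡ q × t ≡ 0ℤ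
              conclusion = conclude-part c q t Rest.triangles 1<c 0≤t Rest.triangles-nonneg identity

            size≡q : size i₀ ≡ q
            size≡q = proj₁ conclusion

            t≡0 : t ≡ 0ℤ
            t≡0 = proj₂ conclusion

          private
            sizes : ∀ i → size i ≡ q * ν i
            sizes i with β i i in ii | size*ν i
            ... | true  | e = trans (DeletePart.size≡q i (cong 𝟙 ii)) (sym (ℤ.*-identityʳ q))
            ... | false | e = trans (sym e) (trans (ℤ.*-zeroʳ (size i)) (sym (ℤ.*-zeroʳ q)))

            s₁≡ : s₁ ≡ q * (1ℤ + + 2 * q - t)
            s₁≡ = trans (sum-cong-≗ sizes) (trans (sum-scale q ν) (cong (q *_) n′≡3))

            E₃ : (1ℤ + + 2 * q - t) * (1ℤ + + 2 * q - t) - q * (1ℤ + + 2 * q - t) ≡ (1ℤ + + 2 * q) * (1ℤ + + 2 * q) - (1ℤ + + 2 * q * q)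
            E₃ = trans (cong (λ z → (1ℤ + + 2 * q - t) * (1ℤ + + 2 * q - t) - z) (sym s₁≡)) E₁″

          impossible : ⊥
          impossible with Fin.any? (λ i → β i i Bool.≟ true)
          -- If all parts have size q and t = 0, the edge equation reduces to q = 1.
          ... | yes (i₀ , e) = n-1≢0 1<q (trans (arith q) (≡-from-diff (sym (subst (λ t → (1ℤ + + 2 * q - t) * (1ℤ + + 2 * q - t) - q * (1ℤ + + 2 * q - t) ≡
                  (1ℤ + + 2 * q) * (1ℤ + + 2 * q) - (1ℤ + + 2 * q * q)) (DeletePart.t≡0 i₀ (cong 𝟙 e)) E₃))))
            where
            arith : ∀ q → q - 1ℤ ≡ (1ℤ + + 2 * q) * (1ℤ + + 2 * q) - (1ℤ + + 2 * q * q) - ((1ℤ + + 2 * q - 0ℤ) * (1ℤ + + 2 * q - 0ℤ) - q * (1ℤ + + 2 * q - 0ℤ))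
            arith = solve-∀
          -- If there is no part there is no edge, whereas twice the number of edges is q (2 q + 4)
          -- > 0.
          ... | no none = ℤ.<-irrefl (trans (sym (rhs m≡0)) (trans E₃ (value q))) (*-pos 0<q (ℤ.+-mono-<-≤ (*-pos {+ 2} (+<+ (ℕ.s≤s ℕ.z≤n)) 0<q) (+≤+ {0} {4} ℕ.z≤n)))
            where
            m≡0 : 1ℤ + + 2 * q - t ≡ 0ℤ
            m≡0 = trans (sym n′≡3) (sum-zero ν≡0)
              where
              ν≡0 : ∀ i → ν i ≡ 0ℤ
              ν≡0 i with β i i in ii
              ... | false = refl
              ... | true  = ⊥-elim (none (i , ii))
            rhs : ∀ {m} → m ≡ 0ℤ → m * m - q * m ≡ 0ℤ
            rhs refl = cong (λ z → 0ℤ + - z) (ℤ.*-zeroʳ q)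
            value : ∀ q → (1ℤ + + 2 * q) * (1ℤ + + 2 * q) - (1ℤ + + 2 * q * q) ≡ q * (+ 2 * q + + 4)
            value = solve-∀

        result : Blocks (λ i j → not (adj i j)) v p q
        result with Fin.any? At-1.ρ?
        ... | yes (i₀ , e) = singles.result i₀ e
        ... | no none = ⊥-elim (no-singles.impossible (λ i e → none (i , e))
          (ℤ.i-j≡0⇒i≡j v 1ℤ (At-1.Absent.Minimal.multiplicity-0 (λ i e → none (i , e)) λ i ii → subst (_≤ size i) (cong 𝟙 ii) (ν≤size i))))

      blocks : Blocks (λ i j → not (adj i j)) v p q
      blocks with p ℤ.≟ + 2
      ... | yes p≡2′ = p≡2.result p≡2′
      ... | no p≢2   = p≢2⇒blocks p≢2

  module Recognise {n} (adj : Fin n → Fin n → Bool) (adj-sym : ∀ i j → adj i j ≡ adj j i) (adj-irrefl : ∀ i → adj i i ≡ false)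
      (v p q : ℤ) (0<v : 0ℤ < v) (1<p : 1ℤ < p) (1<q : 1ℤ < q) (order≡ : sum {n} (λ _ → 1ℤ) ≡ v + p * q)
      (A : Matrix n) (A≡adj : ∀ i j → A i j ≡ 𝟙 (adj i j)) (A-sym : ∀ i j → A i j ≡ A j i) where

    open Operator A A-sym

    module _ (no-bad-edge : ∀ x y z t → adj x y ≡ true → adj z x ≡ false → adj z y ≡ false → adj z t ≢ true) (Z₁ Z_q : Pol)
        (ζ₁ ζ_q : ℤ) (0<ζ₁ : 0ℤ < ζ₁) (0<ζ_q : 0ℤ < ζ_q) (Z₁-eig : ∀ y l → act A (⟦ Z₁ ⟧ y) l ≡ - 1ℤ * ⟦ Z₁ ⟧ y l)
        (Z_q-eig : ∀ y l → act A (⟦ Z_q ⟧ y) l ≡ - q * ⟦ Z_q ⟧ y l) (eval-Z₁ : eval Z₁ (- 1ℤ) ≡ ζ₁)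
        (eval-Z_q : eval Z_q (- q) ≡ ζ_q) (tr-Z₁ : tr Z₁ ≡ (v - 1ℤ) * ζ₁) (tr-Z_q : tr Z_q ≡ (p - 1ℤ) * ζ_q)
        (edges : tr (X ⊠ X) ≡ (v + p * q) * (v + p * q) - (v + p * q * q))
        (tris : tr (X ⊠ (X ⊠ X)) ≡ (v + p * q) * (v + p * q) * (v + p * q) - + 3 * ((v + p * q) * (v + p * q * q)) + + 2 * (v + p * q * (q * q))) where

      nonisolated? : ∀ i → Dec (∃[ j ] adj i j ≡ true)
      nonisolated? i = Fin.any? λ j → adj i j Bool.≟ true

      nz : Fin n → Bool
      nz i = does (nonisolated? i)

      -- Non-adjacency among the vertices that have a neighbour. `no-bad-edge` gives its
      -- transitivity: if i and k were adjacent, j would have a neighbour and miss both ends of that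
      -- edge.
      β : Fin n → Fin n → Bool
      β i j = nz i ∧ (nz j ∧ not (adj i j))

      private
        nz-witness : ∀ {i} → nz i ≡ true → ∃[ j ] adj i j ≡ true
        nz-witness {i} nzi with nonisolated? i
        ... | yes w = w

        nz-edge : ∀ {i j} → adj i j ≡ true → nz i ≡ true
        nz-edge {i} {j} ij = dec-true (nonisolated? i) (j , ij)

        β-sym : ∀ i j → β i j ≡ β j i
        β-sym i j = trans (swap (nz i) (nz j) (not (adj i j))) (cong (λ a → nz j ∧ (nz i ∧ not a)) (adj-sym i j))
          where
          swap : ∀ x y z → x ∧ (y ∧ z) ≡ y ∧ (x ∧ z)
          swap true  true  z = refl
          swap true  false z = refl
          swap false true  z = refl
          swap false false z = refl

        β-true : ∀ {i j} → β i j ≡ true → nz i ≡ true × (nz j ≡ true × adj i j ≡ false)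
        β-true {i} {j} e = proj₁ outer , proj₁ inner , not-true (adj i j) (proj₂ inner)
          where
          outer : nz i ≡ true × nz j ∧ not (adj i j) ≡ true
          outer = ∧-true (nz i) (nz j ∧ not (adj i j)) e
          inner : nz j ≡ true × not (adj i j) ≡ true
          inner = ∧-true (nz j) (not (adj i j)) (proj₂ outer)

        β-trans : ∀ {i j k} → β i j ≡ true → β j k ≡ true → β i k ≡ true
        β-trans {i} {j} {k} ij jk with adj i k in ik
        ... | false = cong₂ (λ x y → x ∧ (y ∧ true)) (proj₁ (β-true {i} {j} ij)) (proj₁ (proj₂ (β-true {j} {k} jk)))
        ... | true  = ⊥-elim (no-bad-edge i k j (proj₁ nb) ik (trans (adj-sym j i) (proj₂ (proj₂ (β-true {i} {j} ij))))
                        (proj₂ (proj₂ (β-true {j} {k} jk))) (proj₂ nb))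
          where
          nb : ∃[ t ] adj j t ≡ true
          nb = nz-witness {j} (proj₁ (proj₂ (β-true {i} {j} ij)))

        β-diag : ∀ i → β i i ≡ nz i
        β-diag i = trans (cong (λ a → nz i ∧ (nz i ∧ not a)) (adj-irrefl i)) (idem (nz i))
          where
          idem : ∀ x → x ∧ (x ∧ true) ≡ x
          idem true  = refl
          idem false = refl

      open PER β β-sym β-trans using (b; multi)

      private
        A≡multi : ∀ i j → A i j ≡ multi i j
        A≡multi i j = trans (A≡adj i j) (trans cases (cong₂ (λ x y → 𝟙 x * 𝟙 y - b i j) (sym (β-diag i)) (sym (β-diag j))))
          where
          cases : 𝟙 (adj i j) ≡ 𝟙 (nz i) * 𝟙 (nz j) - 𝟙 (nz i ∧ (nz j ∧ not (adj i j)))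
          cases with adj i j in ij
          ... | true  = sym (cong₂ (λ x y → 𝟙 x * 𝟙 y - 𝟙 (x ∧ (y ∧ false))) (nz-edge ij) (nz-edge (trans (adj-sym j i) ij)))
          ... | false = zero-case (nz i) (nz j)
            where
            zero-case : ∀ x y → 0ℤ ≡ 𝟙 x * 𝟙 y - 𝟙 (x ∧ (y ∧ true))
            zero-case true  true  = refl
            zero-case true  false = refl
            zero-case false true  = refl
            zero-case false false = refl

      blocks : Blocks (λ i j → not (adj i j)) v p q
      blocks = MultipartiteCase.blocks adj adj-sym adj-irrefl v p q 0<v 1<p 1<q order≡ A A≡adj A-sym
        β β-sym (λ {i} {j} {k} → β-trans {i} {j} {k}) β≤ β-on isolated A≡multi
        Z₁ Z_q ζ₁ ζ_q 0<ζ₁ 0<ζ_q Z₁-eig Z_q-eig eval-Z₁ eval-Z_q tr-Z₁ tr-Z_q edges tris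
        where
        β≤ : ∀ i j → 𝟙 (β i j) ≤ 𝟙 (not (adj i j))
        β≤ i j = ∧-≤ (nz i) (nz j) (not (adj i j))
          where
          ∧-≤ : ∀ x y z → 𝟙 (x ∧ (y ∧ z)) ≤ 𝟙 z
          ∧-≤ true  true  z = ℤ.≤-refl
          ∧-≤ true  false z = 𝟙-nonneg z
          ∧-≤ false y     z = 𝟙-nonneg z
        β-on : ∀ i j → β i i ≡ true → β j j ≡ true → β i j ≡ not (adj i j)
        β-on i j ii jj = cong₂ (λ x y → x ∧ (y ∧ not (adj i j))) (trans (sym (β-diag i)) ii) (trans (sym (β-diag j)) jj)
        isolated : ∀ i → β i i ≡ false → ∀ j → adj i j ≡ false
        isolated i ii j with adj i j in ij
        ... | false = refl
        ... | true with trans (sym (nz-edge ij)) (trans (sym (β-diag i)) ii)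
        ...   | ()

-- Equivalence relations with the same class sizes are isomorphic

module BlockIsomorphism where

  open import Data.Integer.Base using (ℤ; +_; _+_; _*_; 0ℤ; 1ℤ)
  open Determinants
  open MatrixPolynomials
  open Partitions
  open BlockSpectra
  open Recognition using (∧-true)

  open ≡-Reasoning

  bit : Bool → ℕ
  bit b = if b then 1 else 0

  count : ∀ {n} → (Fin n → Bool) → ℕ
  count {zero}  P = 0
  count {suc n} P = bit (P zero) ℕ.+ count (P ∘ suc)

  rank : ∀ {n} → (Fin n → Bool) → Fin n → ℕ
  rank P zero    = 0
  rank P (suc i) = bit (P zero) ℕ.+ rank (P ∘ suc) i

  sum-𝟙 : ∀ {n} (P : Fin n → Bool) → sum (λ i → 𝟙 (P i)) ≡ + count P
  sum-𝟙 {zero}  P = refl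
  sum-𝟙 {suc n} P = cong₂ _+_ (𝟙-bit (P zero)) (sum-𝟙 (P ∘ suc))
    where
    𝟙-bit : ∀ b → 𝟙 b ≡ + bit b
    𝟙-bit true  = refl
    𝟙-bit false = refl

  rank-cong : ∀ {n} {P Q : Fin n → Bool} → P ≗ Q → rank P ≗ rank Q
  rank-cong P≗Q zero    = refl
  rank-cong P≗Q (suc i) = cong₂ (λ b m → bit b ℕ.+ m) (P≗Q zero) (rank-cong (P≗Q ∘ suc) i)

  count-cong : ∀ {n} {P Q : Fin n → Bool} → P ≗ Q → count P ≡ count Q
  count-cong {zero}  P≗Q = refl
  count-cong {suc n} P≗Q = cong₂ (λ b m → bit b ℕ.+ m) (P≗Q zero) (count-cong (P≗Q ∘ suc))

  rank<count : ∀ {n} (P : Fin n → Bool) i → P i ≡ true → rank P i ℕ.< count P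
  rank<count P zero    Pi rewrite Pi = s≤s z≤n
  rank<count P (suc i) Pi = ℕ.+-monoʳ-< (bit (P zero)) (rank<count (P ∘ suc) i Pi)

  rank-injective : ∀ {n} (P : Fin n → Bool) i j → P i ≡ true → P j ≡ true → rank P i ≡ rank P j → i ≡ j
  rank-injective P zero    zero    Pi Pj eq = refl
  rank-injective P zero    (suc j) Pi Pj eq rewrite Pi with eq
  ... | ()
  rank-injective P (suc i) zero    Pi Pj eq rewrite Pj with eq
  ... | ()
  rank-injective P (suc i) (suc j) Pi Pj eq =
    cong suc (rank-injective (P ∘ suc) i j Pi Pj (ℕ.+-cancelˡ-≡ (bit (P zero)) (rank (P ∘ suc) i) (rank (P ∘ suc) j) eq))

  rank-surjective : ∀ {n} (P : Fin n → Bool) k → k ℕ.< count P → ∃[ i ] (P i ≡ true × rank P i ≡ k)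
  rank-surjective {suc n} P k k< with P zero in P0
  rank-surjective {suc n} P zero    k<       | true  = zero , P0 , refl
  rank-surjective {suc n} P (suc k) (s≤s k<) | true  =
    let i , Pi , eq = rank-surjective (P ∘ suc) k k< in suc i , Pi , trans (cong (λ b → bit b ℕ.+ rank (P ∘ suc) i) P0) (cong suc eq)
  rank-surjective {suc n} P k k<             | false =
    let i , Pi , eq = rank-surjective (P ∘ suc) k k< in suc i , Pi , trans (cong (λ b → bit b ℕ.+ rank (P ∘ suc) i) P0) eq

  -- Every point of a finite set with an equivalence relation is determined by the
  -- size of its class, the number of its class among those of the same size, and
  -- its position in the class.
  module Code {n} (β : Fin n → Fin n → Bool) (β-refl : ∀ i → β i i ≡ true)
    (β-sym : ∀ i j → β i j ≡ β j i)
    (β-trans : ∀ {i j k} → β i j ≡ true → β j k ≡ true → β i k ≡ true) where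

    open PER β β-sym β-trans using (β-rows)

    sz pos : Fin n → ℕ
    sz i = count (β i)
    pos i = rank (β i) i

    first? : ∀ i → Dec (pos i ≡ 0)
    first? i = pos i ℕ.≟ 0

    sz-const : ∀ {i j} → β i j ≡ true → sz i ≡ sz j
    sz-const ij = count-cong (β-rows ij)

    private
      0<sz : ∀ i → 0 ℕ.< sz i
      0<sz i = ℕ.≤-<-trans z≤n (rank<count (β i) i (β-refl i))

      rep-data : ∀ i → ∃[ r ] (β i r ≡ true × rank (β i) r ≡ 0)
      rep-data i = rank-surjective (β i) 0 (0<sz i)

    rep : Fin n → Fin n
    rep i = proj₁ (rep-data i)

    β-rep : ∀ i → β i (rep i) ≡ true
    β-rep i = proj₁ (proj₂ (rep-data i))

    pos-of : ∀ {i j} → β i j ≡ true → rank (β i) j ≡ pos j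
    pos-of {j = j} ij = rank-cong (β-rows ij) j

    pos-rep : ∀ i → pos (rep i) ≡ 0
    pos-rep i = trans (sym (pos-of (β-rep i))) (proj₂ (proj₂ (rep-data i)))

    pos-injective : ∀ {i j} → β i j ≡ true → pos i ≡ pos j → i ≡ j
    pos-injective {i} {j} ij eq = rank-injective (β i) i j (β-refl i) ij (trans eq (sym (pos-of ij)))

    rep-unique : ∀ {i r} → β i r ≡ true → pos r ≡ 0 → r ≡ rep i
    rep-unique {i} {r} ir eq = pos-injective (β-trans (trans (β-sym r i) ir) (β-rep i)) (trans eq (sym (pos-rep i)))

    rep-const : ∀ {i j} → β i j ≡ true → rep i ≡ rep j
    rep-const {i} {j} ij = rep-unique (β-trans (trans (β-sym j i) ij) (β-rep i)) (pos-rep i)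

    -- One representative for each class of size s: `count` gives the number of these classes, and
    -- `rank` numbers them.
    firstOfSize : ℕ → Fin n → Bool
    firstOfSize s j = does (first? j) ∧ does (sz j ℕ.≟ s)

    cls : Fin n → ℕ
    cls i = rank (firstOfSize (sz i)) (rep i)

    firstOfSize-rep : ∀ i → firstOfSize (sz i) (rep i) ≡ true
    firstOfSize-rep i = cong₂ _∧_ (dec-true (first? (rep i)) (pos-rep i)) (dec-true (sz (rep i) ℕ.≟ sz i) (sym (sz-const (β-rep i))))

    cls-const : ∀ {i j} → β i j ≡ true → cls i ≡ cls j
    cls-const ij = cong₂ (λ s → rank (firstOfSize s)) (sz-const ij) (rep-const ij)

    cls-injective : ∀ {i j} → sz i ≡ sz j → cls i ≡ cls j → β i j ≡ true
    cls-injective {i} {j} szeq clseq = β-trans (β-rep i) (trans (cong (λ r → β r j) same) (trans (β-sym (rep j) j) (β-rep j)))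
      where
      same : rep i ≡ rep j
      same = rank-injective (firstOfSize (sz i)) (rep i) (rep j) (firstOfSize-rep i)
        (subst (λ s → firstOfSize s (rep j) ≡ true) (sym szeq) (firstOfSize-rep j))
        (trans clseq (cong (λ s → rank (firstOfSize s) (rep j)) (sym szeq)))

    cls< : ∀ i → cls i ℕ.< count (firstOfSize (sz i))
    cls< i = rank<count (firstOfSize (sz i)) (rep i) (firstOfSize-rep i)

    pos< : ∀ i → pos i ℕ.< sz i
    pos< i = rank<count (β i) i (β-refl i)

    -- Every code in range occurs, so the set of codes depends only on the number of classes of each
    -- size.
    realise : ∀ s c k → c ℕ.< count (firstOfSize s) → k ℕ.< s → ∃[ j ] (sz j ≡ s × cls j ≡ c × pos j ≡ k)
    realise s c k c< k< = j , szj , clsj , trans (sym (pos-of r~j)) posj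
      where
      found : ∃[ r ] (firstOfSize s r ≡ true × rank (firstOfSize s) r ≡ c)
      found = rank-surjective (firstOfSize s) c c<
      r : Fin n
      r = proj₁ found
      both : does (first? r) ≡ true × does (sz r ℕ.≟ s) ≡ true
      both = ∧-true (does (first? r)) (does (sz r ℕ.≟ s)) (proj₁ (proj₂ found))
      szr : sz r ≡ s
      szr = does-true (sz r ℕ.≟ s) (proj₂ both)
      inner : ∃[ j ] (β r j ≡ true × rank (β r) j ≡ k)
      inner = rank-surjective (β r) k (subst (k ℕ.<_) (sym szr) k<)
      j : Fin n
      j = proj₁ inner
      r~j : β r j ≡ true
      r~j = proj₁ (proj₂ inner)
      posj : rank (β r) j ≡ k
      posj = proj₂ (proj₂ inner)
      szj : sz j ≡ s
      szj = trans (sym (sz-const r~j)) szr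
      clsj : cls j ≡ c
      clsj = trans (cong₂ (λ s → rank (firstOfSize s)) szj (sym (rep-unique (trans (β-sym j r) r~j) (does-true (first? r) (proj₁ both))))) (proj₂ (proj₂ found))

    private
      does-size-const : ∀ s {i j} → β i j ≡ true → does (sz i ℕ.≟ s) ≡ does (sz j ℕ.≟ s)
      does-size-const s ij = cong (λ m → does (m ℕ.≟ s)) (sz-const ij)

    -- Double counting: each point with class size s is paired with the first point of its class.
    count-size : ∀ s → + count (λ i → does (sz i ℕ.≟ s)) ≡ + s * + count (firstOfSize s)
    count-size s = begin
      + count (λ i → does (sz i ℕ.≟ s))
        ≡⟨ sym (sum-𝟙 λ i → does (sz i ℕ.≟ s)) ⟩
      sum (λ i → 𝟙 (does (sz i ℕ.≟ s)))
        ≡⟨ sum-cong-≗ (λ i → sym (one-first i)) ⟩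
      sum (λ i → sum λ j → 𝟙 (firstOfSize s j) * 𝟙 (β j i))
        ≡⟨ ∑-comm (λ i j → 𝟙 (firstOfSize s j) * 𝟙 (β j i)) ⟩
      sum (λ j → sum λ i → 𝟙 (firstOfSize s j) * 𝟙 (β j i))
        ≡⟨ sum-cong-≗ (λ j → trans (sum-scale (𝟙 (firstOfSize s j)) (λ i → 𝟙 (β j i))) (trans (cong (𝟙 (firstOfSize s j) *_) (sum-𝟙 (β j))) (size-s j))) ⟩
      sum (λ j → + s * 𝟙 (firstOfSize s j))
        ≡⟨ trans (sum-scale (+ s) (λ j → 𝟙 (firstOfSize s j))) (cong (+ s *_) (sum-𝟙 (firstOfSize s))) ⟩
      + s * + count (firstOfSize s) ∎
      where
      size-s : ∀ j → 𝟙 (firstOfSize s j) * + sz j ≡ + s * 𝟙 (firstOfSize s j)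
      size-s j = case (does (first? j)) (sz j ℕ.≟ s)
        where
        case : ∀ f (d : Dec (sz j ≡ s)) → 𝟙 (f ∧ does d) * + sz j ≡ + s * 𝟙 (f ∧ does d)
        case true  (yes e) = trans (ℤ.*-identityˡ (+ sz j)) (trans (cong +_ e) (sym (ℤ.*-identityʳ (+ s))))
        case true  (no _)  = trans (ℤ.*-zeroˡ (+ sz j)) (sym (ℤ.*-zeroʳ (+ s)))
        case false _       = trans (ℤ.*-zeroˡ (+ sz j)) (sym (ℤ.*-zeroʳ (+ s)))
      one-first : ∀ i → sum (λ j → 𝟙 (firstOfSize s j) * 𝟙 (β j i)) ≡ 𝟙 (does (sz i ℕ.≟ s))
      one-first i = begin
        sum f                                           ≡⟨ sum-only f (rep i) (λ j j≢ → others j j≢ (first? j) (β j i) refl) ⟩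
        𝟙 (firstOfSize s (rep i)) * 𝟙 (β (rep i) i)     ≡⟨ cong₂ (λ x y → 𝟙 x * 𝟙 y) (cong₂ _∧_ (dec-true (first? (rep i)) (pos-rep i)) (sym (does-size-const s (β-rep i))))
                                                             (trans (β-sym (rep i) i) (β-rep i)) ⟩
        𝟙 (does (sz i ℕ.≟ s)) * 1ℤ                      ≡⟨ ℤ.*-identityʳ (𝟙 (does (sz i ℕ.≟ s))) ⟩
        𝟙 (does (sz i ℕ.≟ s))                           ∎
        where
        f : Fin n → ℤ
        f j = 𝟙 (firstOfSize s j) * 𝟙 (β j i)
        others : ∀ j → j ≢ rep i → (d : Dec (pos j ≡ 0)) → ∀ x → β j i ≡ x → 𝟙 (does d ∧ does (sz j ℕ.≟ s)) * 𝟙 x ≡ 0ℤ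
        others j j≢ (no _)  x     e = ℤ.*-zeroˡ (𝟙 x)
        others j j≢ (yes p) false e = ℤ.*-zeroʳ (𝟙 (does (sz j ℕ.≟ s)))
        others j j≢ (yes p) true  e = ⊥-elim (j≢ (rep-unique (trans (β-sym i j) e) p))

  -- The right side involves only v, p and q; for q = 1 both summands contribute at s = 1.
  blocks⇒count : ∀ {n} {β : Fin n → Fin n → Bool} {v p q} (B : Blocks β v p q) s →
    + count (λ i → does (count (β i) ℕ.≟ s)) ≡ 𝟙 (does (q ℤ.≟ + s)) * (p * q) + 𝟙 (does (1ℤ ℤ.≟ + s)) * v
  blocks⇒count {n} {β} {v} {p} {q} B s = begin
    + count (λ i → does (count (β i) ℕ.≟ s))
      ≡⟨ sym (sum-𝟙 λ i → does (count (β i) ℕ.≟ s)) ⟩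
    sum (λ i → 𝟙 (does (count (β i) ℕ.≟ s)))
      ≡⟨ sum-cong-≗ (λ i → trans (cong 𝟙 (as-ℤ (count (β i)) s)) (trans (cong (λ z → 𝟙 (does (z ℤ.≟ + s))) (trans (sym (sum-𝟙 (β i))) (size≡ i))) (split (R i)))) ⟩
    sum (λ i → 𝟙 (does (q ℤ.≟ + s)) * 𝟙 (R i) + 𝟙 (does (1ℤ ℤ.≟ + s)) * 𝟙 (not (R i)))
      ≡⟨ sum-lin (𝟙 (does (q ℤ.≟ + s))) (𝟙 (does (1ℤ ℤ.≟ + s))) (λ i → 𝟙 (R i)) (λ i → 𝟙 (not (R i))) ⟩
    𝟙 (does (q ℤ.≟ + s)) * sum (λ i → 𝟙 (R i)) + 𝟙 (does (1ℤ ℤ.≟ + s)) * sum (λ i → 𝟙 (not (R i)))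
      ≡⟨ cong₂ (λ x y → 𝟙 (does (q ℤ.≟ + s)) * x + 𝟙 (does (1ℤ ℤ.≟ + s)) * y) #R #¬R ⟩
    𝟙 (does (q ℤ.≟ + s)) * (p * q) + 𝟙 (does (1ℤ ℤ.≟ + s)) * v ∎
    where
    open Blocks B
    as-ℤ : ∀ m s → does (m ℕ.≟ s) ≡ does (+ m ℤ.≟ + s)
    as-ℤ m s = refl
    split : ∀ r → 𝟙 (does ((if r then q else 1ℤ) ℤ.≟ + s)) ≡ 𝟙 (does (q ℤ.≟ + s)) * 𝟙 r + 𝟙 (does (1ℤ ℤ.≟ + s)) * 𝟙 (not r)
    split true  = arith (𝟙 (does (q ℤ.≟ + s))) (𝟙 (does (1ℤ ℤ.≟ + s)))
      where
      arith : ∀ x y → x ≡ x * 1ℤ + y * 0ℤ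
      arith = solve-∀
    split false = arith (𝟙 (does (q ℤ.≟ + s))) (𝟙 (does (1ℤ ℤ.≟ + s)))
      where
      arith : ∀ x y → y ≡ x * 0ℤ + y * 1ℤ
      arith = solve-∀

  -- Both relations realise the same codes, and points with equal codes correspond. Being related
  -- means agreement in the first two components of the code.
  blocks-isomorphic : ∀ {n} {β γ : Fin n → Fin n → Bool} {v p q} → Blocks β v p q → Blocks γ v p q →
    Σ[ φ ∈ Fin n ↔ Fin n ] (∀ i j → β i j ≡ γ (Inverse.to φ i) (Inverse.to φ j))
  blocks-isomorphic {n} {β} {γ} B C = mk↔ₛ′ to from to∘from from∘to , preserves
    where
    module B = Blocks B
    module C = Blocks C
    module β = Code β B.β-refl B.β-sym B.β-trans
    module γ = Code γ C.β-refl C.β-sym C.β-trans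

    -- The points in classes of size s are equally many on both sides; for s > 0 one may divide by
    -- s.
    same-count : ∀ s → 0 ℕ.< s → count (β.firstOfSize s) ≡ count (γ.firstOfSize s)
    same-count (suc s) _ = ℤ.+-injective (ℤ.*-cancelˡ-≡ (+ suc s) (+ count (β.firstOfSize (suc s))) (+ count (γ.firstOfSize (suc s)))
      (trans (sym (β.count-size (suc s))) (trans (trans (blocks⇒count B (suc s)) (sym (blocks⇒count C (suc s)))) (γ.count-size (suc s)))))

    Match : Fin n → Fin n → Set
    Match i j = β.sz i ≡ γ.sz j × β.cls i ≡ γ.cls j × β.pos i ≡ γ.pos j

    right : ∀ i → ∃[ j ] Match i j
    right i = proj₁ found , sym (proj₁ (proj₂ found)) , sym (proj₁ (proj₂ (proj₂ found))) , sym (proj₂ (proj₂ (proj₂ found)))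
      where
      found : ∃[ j ] (γ.sz j ≡ β.sz i × γ.cls j ≡ β.cls i × γ.pos j ≡ β.pos i)
      found = γ.realise (β.sz i) (β.cls i) (β.pos i)
        (subst (β.cls i ℕ.<_) (same-count (β.sz i) (ℕ.≤-<-trans z≤n (β.pos< i))) (β.cls< i)) (β.pos< i)

    left : ∀ j → ∃[ i ] Match i j
    left j = β.realise (γ.sz j) (γ.cls j) (γ.pos j) (subst (γ.cls j ℕ.<_) (sym (same-count (γ.sz j) (ℕ.≤-<-trans z≤n (γ.pos< j)))) (γ.cls< j)) (γ.pos< j)

    uniqueʳ : ∀ i j j′ → Match i j → Match i j′ → j ≡ j′
    uniqueʳ i j j′ (a , b , c) (a′ , b′ , c′) =
      γ.pos-injective {j} {j′} (γ.cls-injective {j} {j′} (trans (sym a) a′) (trans (sym b) b′)) (trans (sym c) c′)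

    uniqueˡ : ∀ i i′ j → Match i j → Match i′ j → i ≡ i′
    uniqueˡ i i′ j (a , b , c) (a′ , b′ , c′) =
      β.pos-injective {i} {i′} (β.cls-injective {i} {i′} (trans a (sym a′)) (trans b (sym b′))) (trans c (sym c′))

    to from : Fin n → Fin n
    to i = proj₁ (right i)
    from j = proj₁ (left j)

    to∘from : ∀ j → to (from j) ≡ j
    to∘from j = uniqueʳ (from j) (to (from j)) j (proj₂ (right (from j))) (proj₂ (left j))

    from∘to : ∀ i → from (to i) ≡ i
    from∘to i = uniqueˡ (from (to i)) i (to i) (proj₂ (left (to i))) (proj₂ (right i))

    forth : ∀ i j k l → Match i k → Match j l → β i j ≡ true → γ k l ≡ true
    forth i j k l (a , b , _) (a′ , b′ , _) ij =
      γ.cls-injective {k} {l} (trans (sym a) (trans (β.sz-const {i} {j} ij) a′)) (trans (sym b) (trans (β.cls-const {i} {j} ij) b′))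

    back : ∀ i j k l → Match i k → Match j l → γ k l ≡ true → β i j ≡ true
    back i j k l (a , b , _) (a′ , b′ , _) kl =
      β.cls-injective {i} {j} (trans a (trans (γ.sz-const {k} {l} kl) (sym a′))) (trans b (trans (γ.cls-const {k} {l} kl) (sym b′)))

    Bool-≡ : ∀ x y → (x ≡ true → y ≡ true) → (y ≡ true → x ≡ true) → x ≡ y
    Bool-≡ true  y     f g = sym (f refl)
    Bool-≡ false true  f g = g refl
    Bool-≡ false false f g = refl

    preserves : ∀ i j → β i j ≡ γ (to i) (to j)
    preserves i j = Bool-≡ (β i j) (γ (to i) (to j))
      (forth i j (to i) (to j) (proj₂ (right i)) (proj₂ (right j))) (back i j (to i) (to j) (proj₂ (right i)) (proj₂ (right j)))

-- Transfer of traces and annihilators to the unknown graph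

module Reconstruction where

  open import Data.Integer.Base using (ℤ; +_; _+_; _*_; -_; _-_; 0ℤ; 1ℤ; _≤_; _<_; +<+)
  open Determinants
  open MatrixPolynomials
  open OnePositiveEigenvalue
  open Partitions
  open BlockSpectra
  open Multiplicities
  open Recognition

  open ≡-Reasoning

  module _ {n} (A : Matrix n) (A-sym : ∀ i j → A i j ≡ A j i) (s d q : ℤ) where

    open Operator A A-sym
    open Polynomials s d q using (F; h; Q)

    module _ (Fh≡0 : ∀ y i → ⟦ F ⊠ h ⟧ y i ≡ 0ℤ) where

      open PolSolver using (solve; _:=_; _:+_; _:*_) renaming (con to :con)

      private
        eigen : ∀ r z a → a + r * z ≡ 0ℤ → a ≡ - r * z
        eigen r z a eq = +-cancelʳ (r * z) a (- r * z) (trans eq (arith r z))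
          where
          arith : ∀ r z → 0ℤ ≡ - r * z + r * z
          arith = solve-∀

      -- (X + 1) Z₁ = F h, which acts as zero.
      Z₁-eigen : ∀ y l → act A (⟦ Z₁ s d q ⟧ y) l ≡ - 1ℤ * ⟦ Z₁ s d q ⟧ y l
      Z₁-eigen y l = eigen 1ℤ (⟦ Z₁ s d q ⟧ y l) (act A (⟦ Z₁ s d q ⟧ y) l) (trans (sym (identity F X Q y l)) (Fh≡0 y l))
        where
        identity : ∀ f x q → f ⊠ (x ⊠ (x ⊞ con 1ℤ) ⊠ (x ⊞ q)) ≋ (x ⊞ con 1ℤ) ⊠ (f ⊠ (x ⊠ (x ⊞ q)))
        identity = solve 3 (λ f x q → f :* (x :* (x :+ :con 1ℤ) :* (x :+ q)) := (x :+ :con 1ℤ) :* (f :* (x :* (x :+ q)))) (λ y i → refl)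

      Z_q-eigen : ∀ y l → act A (⟦ Z_q s d q ⟧ y) l ≡ - q * ⟦ Z_q s d q ⟧ y l
      Z_q-eigen y l = eigen q (⟦ Z_q s d q ⟧ y l) (act A (⟦ Z_q s d q ⟧ y) l) (trans (sym (identity F X Q y l)) (Fh≡0 y l))
        where
        identity : ∀ f x q → f ⊠ (x ⊠ (x ⊞ con 1ℤ) ⊠ (x ⊞ q)) ≋ (x ⊞ q) ⊠ (f ⊠ (x ⊠ (x ⊞ con 1ℤ)))
        identity = solve 3 (λ f x q → f :* (x :* (x :+ :con 1ℤ) :* (x :+ q)) := (x :+ q) :* (f :* (x :* (x :+ :con 1ℤ)))) (λ y i → refl)

  module BlockTraces {n} (β : Fin n → Fin n → Bool) (v p q : ℤ) (blocks : Blocks β v p q)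
    (A : Matrix n) (A-sym : ∀ i j → A i j ≡ A j i) (A≡ : ∀ i j → A i j ≡ 1ℤ - 𝟙 (β i j)) where

    open Blocks blocks
    open PER β β-sym β-trans
    open Operator A A-sym

    order≡ : sum {n} (λ _ → 1ℤ) ≡ v + p * q
    order≡ = trans (sum-cong-≗ λ i → split (R i)) (trans (∑-distrib-+ (λ i → 𝟙 (not (R i))) (λ i → 𝟙 (R i))) (cong₂ _+_ #¬R #R))
      where
      split : ∀ r → 1ℤ ≡ 𝟙 (not r) + 𝟙 r
      split true  = refl
      split false = refl

    private
      ν≡1 : ∀ i → ν i ≡ 1ℤ
      ν≡1 i = cong 𝟙 (β-refl i)

      A≡multi : ∀ i j → A i j ≡ multi i j
      A≡multi i j = trans (A≡ i j) (sym (cong₂ (λ x y → x * y - b i j) (ν≡1 i) (ν≡1 j)))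

      module M = Multipartite.Adjacency β β-sym β-trans A A-sym A≡multi

      n′≡ : n′ ≡ v + p * q
      n′≡ = trans (sum-cong-≗ ν≡1) order≡

      weighted : ∀ (g : ℤ → ℤ) → sum (λ i → g (size i)) ≡ g 1ℤ * v + g q * (p * q)
      weighted g = trans (sum-cong-≗ λ i → trans (cong g (size≡ i)) (split (R i))) (trans
        (sum-lin (g 1ℤ) (g q) (λ i → 𝟙 (not (R i))) (λ i → 𝟙 (R i))) (cong₂ (λ x y → g 1ℤ * x + g q * y) #¬R #R))
        where
        split : ∀ r → g (if r then q else 1ℤ) ≡ g 1ℤ * 𝟙 (not r) + g q * 𝟙 r
        split true  = arith (g 1ℤ) (g q)
          where
          arith : ∀ x y → y ≡ x * 0ℤ + y * 1ℤ
          arith = solve-∀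
        split false = arith (g 1ℤ) (g q)
          where
          arith : ∀ x y → x ≡ x * 1ℤ + y * 0ℤ
          arith = solve-∀

      s₁≡ : s₁ ≡ v + p * q * q
      s₁≡ = trans (weighted (λ x → x)) (arith v p q)
        where
        arith : ∀ v p q → 1ℤ * v + q * (p * q) ≡ v + p * q * q
        arith = solve-∀

      s₂≡ : s₂ ≡ v + p * q * (q * q)
      s₂≡ = trans (weighted (λ x → x * x)) (arith v p q)
        where
        arith : ∀ v p q → 1ℤ * 1ℤ * v + q * q * (p * q) ≡ v + p * q * (q * q)
        arith = solve-∀

    edges : tr (X ⊠ X) ≡ (v + p * q) * (v + p * q) - (v + p * q * q)
    edges = trans M.tr-XX (cong₂ (λ m s → m * m - s) n′≡ s₁≡)

    tris : tr (X ⊠ (X ⊠ X)) ≡ (v + p * q) * (v + p * q) * (v + p * q) - + 3 * ((v + p * q) * (v + p * q * q)) + + 2 * (v + p * q * (q * q))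
    tris = trans M.tr-XXX (triangles-cong n′≡ s₁≡ s₂≡)

  module Determined {n} (adj : Fin n → Fin n → Bool)
    (adj-sym : ∀ i j → adj i j ≡ adj j i) (adj-irrefl : ∀ i → adj i i ≡ false)
    (A : Matrix n) (A≡adj : ∀ i j → A i j ≡ 𝟙 (adj i j)) (A-sym : ∀ i j → A i j ≡ A j i)
    (β : Fin n → Fin n → Bool) (v p q : ℤ) (blocks : Blocks β v p q) (0<v : 0ℤ < v) (1<p : 1ℤ < p)
    (B : Matrix n) (B-sym : ∀ i j → B i j ≡ B j i) (B≡ : ∀ i j → B i j ≡ 1ℤ - 𝟙 (β i j))
    (same : ∀ k → powerTrace A k ≡ powerTrace B k) where

    private
      module A = Operator A A-sym
      module BT = BlockTraces β v p q blocks B B-sym B≡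
      module Iso = Isospectral A B A-sym B-sym same

      edges : A.tr (X ⊠ X) ≡ (v + p * q) * (v + p * q) - (v + p * q * q)
      edges = trans (Iso.tr-equal (X ⊠ X)) BT.edges

    module LargeParts (1<q : 1ℤ < q) where
      private
        0<p : 0ℤ < p
        0<p = ℤ.<-trans (+<+ (ℕ.s≤s ℕ.z≤n)) 1<p
        0<q : 0ℤ < q
        0<q = ℤ.<-trans (+<+ (ℕ.s≤s ℕ.z≤n)) 1<q
        0<q-1 : 0ℤ < q - 1ℤ
        0<q-1 = ℤ.+-monoˡ-< (- 1ℤ) 1<q

        s d : ℤ
        s = s-of v p q
        d = d-of v p q

        module BS = BlockSpectrum β v p q blocks 0<v 0<p 1<q B B-sym B≡
        module P = Polynomials s d q

        Fh≡0 : ∀ y i → A.⟦ P.F ⊠ P.h ⟧ y i ≡ 0ℤ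
        Fh≡0 y i = trans (Iso.annihilator-transfer (P.F ⊠ P.h) (λ y i → trans (BS.Fh≡0 y i) (sym (ℤ.*-zeroˡ (y i)))) y i) (ℤ.*-zeroˡ (y i))

        0<d : 0ℤ < d
        0<d = *-pos {q} {v + p - 1ℤ} 0<q (subst (0ℤ <_) (sym (ℤ.+-assoc v p (- 1ℤ))) (ℤ.+-mono-< 0<v (ℤ.+-monoˡ-< (- 1ℤ) 1<p)))

        -- The last two factors of N are v (q - 1) and p q (q - 1). They vanish for q = 1, which is
        -- why that case is treated apart.
        0<N : 0ℤ < P.N
        0<N = *-pos {d * (d - s - 1ℤ)} {q * q + q * s - d}
          (*-pos {d} {d - s - 1ℤ} 0<d (subst (0ℤ <_) (sym (first v p q)) (*-pos {v} {q - 1ℤ} 0<v 0<q-1)))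
          (subst (0ℤ <_) (sym (second v p q)) (*-pos {p * q} {q - 1ℤ} (*-pos {p} {q} 0<p 0<q) 0<q-1))
          where
          first : ∀ v p q → q * (v + p - 1ℤ) - (v - 1ℤ + (p - 1ℤ) * q) - 1ℤ ≡ v * (q - 1ℤ)
          first = solve-∀
          second : ∀ v p q → q * q + q * (v - 1ℤ + (p - 1ℤ) * q) - q * (v + p - 1ℤ) ≡ p * q * (q - 1ℤ)
          second = solve-∀

        no-bad-edge : ∀ x y z t → adj x y ≡ true → adj z x ≡ false → adj z y ≡ false → adj z t ≢ true
        no-bad-edge x y z t xy zx zy zt = OnePositive.no-edge-from A A-sym s d q P.N P.E P.w 0<d 0<N 1<q
          Fh≡0 (λ y → Fh≡0 (A.⟦ P.h̄ ⟧ y)) (E-in-F A A-sym s d q)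
          (trans (Iso.tr-equal P.E) BS.tr-E) (trans (Iso.tr-equal (X ⊠ P.E)) BS.tr-XE)
          x y z t (λ i → trans (A≡adj i i) (cong 𝟙 (adj-irrefl i)))
          (trans (A≡adj x y) (cong 𝟙 xy)) (trans (A≡adj z x) (cong 𝟙 zx)) (trans (A≡adj z y) (cong 𝟙 zy)) (trans (A≡adj z t) (cong 𝟙 zt))

      result : Blocks (λ i j → not (adj i j)) v p q
      result = Recognise.blocks adj adj-sym adj-irrefl v p q 0<v 1<p 1<q BT.order≡ A A≡adj A-sym no-bad-edge
        (Z₁ s d q) (Z_q s d q) BS.ζ₁ BS.ζ_q (*-pos {v} 0<v (*-pos 0<q-1 0<q-1)) (*-pos {p * (q * q)} (*-pos 0<p (*-pos 0<q 0<q)) (*-pos 0<q-1 0<q-1))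
        (Z₁-eigen A A-sym s d q Fh≡0) (Z_q-eigen A A-sym s d q Fh≡0) BS.eval-Z₁ BS.eval-Z_q
        (trans (Iso.tr-equal (Z₁ s d q)) BS.tr-Z₁) (trans (Iso.tr-equal (Z_q s d q)) BS.tr-Z_q)
        edges (trans (Iso.tr-equal (X ⊠ (X ⊠ X))) BT.tris)

    -- Every vertex is non-adjacent to itself, and the number of edges leaves room for no other
    -- non-adjacent pair.
    module Complete (q≡1 : q ≡ 1ℤ) where
      private
        non-degree : Fin n → ℤ
        non-degree i = sum λ j → 𝟙 (not (adj i j))

        m : ℤ
        m = v + p * q

        A-entry : ∀ i j → A.entry X i j ≡ 𝟙 (adj i j)
        A-entry i j = trans (⟨⟩-comm (A j) (δ i)) (trans (⟨δ,⟩ i (A j)) (trans (A-sym j i) (A≡adj i j)))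

        edge-sum : sum (λ i → sum λ j → 𝟙 (adj i j)) ≡ m * m - (v + p * q * q)
        edge-sum = trans (sym (trans (A.tr-⊠ X X) (sum-cong-≗ λ i → sum-cong-≗ λ j →
          trans (cong (λ z → z * z) (A-entry i j)) (𝟙-idem (adj i j))))) edges

        sum-non-degree : sum non-degree ≡ sum {n} (λ _ → 1ℤ)
        sum-non-degree = begin
          sum (λ i → sum λ j → 𝟙 (not (adj i j)))
            ≡⟨ sum-cong-≗ (λ i → trans (sum-cong-≗ λ j → trans (𝟙-not (adj i j)) (minus (𝟙 (adj i j))))
                 (trans (sum-lin 1ℤ (- 1ℤ) (λ _ → 1ℤ) (λ j → 𝟙 (adj i j))) (cong (λ z → 1ℤ * z + - 1ℤ * sum (λ j → 𝟙 (adj i j))) BT.order≡))) ⟩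
          sum (λ i → 1ℤ * m + - 1ℤ * sum (λ j → 𝟙 (adj i j)))
            ≡⟨ trans (sum-cong-≗ λ i → cong (_+ - 1ℤ * sum (λ j → 𝟙 (adj i j))) (ℤ.*-comm 1ℤ m)) (sum-lin m (- 1ℤ) (λ _ → 1ℤ) (λ i → sum λ j → 𝟙 (adj i j))) ⟩
          m * sum {n} (λ _ → 1ℤ) + - 1ℤ * sum (λ i → sum λ j → 𝟙 (adj i j))
            ≡⟨ cong₂ (λ x y → m * x + - 1ℤ * y) BT.order≡ edge-sum ⟩
          m * m + - 1ℤ * (m * m - (v + p * q * q))
            ≡⟨ cancel (m * m) (v + p * q * q) ⟩
          v + p * q * q
            ≡⟨ cong (λ z → v + z) (trans (cong (p * q *_) q≡1) (ℤ.*-identityʳ (p * q))) ⟩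
          v + p * q
            ≡⟨ sym BT.order≡ ⟩
          sum {n} (λ _ → 1ℤ) ∎
          where
          minus : ∀ a → 1ℤ - a ≡ 1ℤ * 1ℤ + - 1ℤ * a
          minus = solve-∀
          cancel : ∀ a b → a + - 1ℤ * (a - b) ≡ b
          cancel = solve-∀

        δ≤ : ∀ (i j : Fin n) → δ i j ≤ 𝟙 (not (adj i j))
        δ≤ i j with i Fin.≟ j
        ... | yes refl = ℤ.≤-reflexive (sym (cong (𝟙 ∘ not) (adj-irrefl i)))
        ... | no _     = 𝟙-nonneg (not (adj i j))

        sum-δ : ∀ (i : Fin n) → sum (δ i) ≡ 1ℤ
        sum-δ i = trans (sum-cong-≗ λ j → sym (ℤ.*-identityʳ (δ i j))) (⟨δ,⟩ i (λ _ → 1ℤ))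

        non-degree≡1 : ∀ i → 1ℤ ≡ non-degree i
        non-degree≡1 = sum-mono-≡ {n} {λ _ → 1ℤ} {non-degree} (λ i → subst (_≤ non-degree i) (sum-δ i) (sum-mono {n} {δ i} {λ j → 𝟙 (not (adj i j))} (δ≤ i))) (sym sum-non-degree)

        non-adjacent⇒≡ : ∀ i j → not (adj i j) ≡ true → i ≡ j
        non-adjacent⇒≡ i j e with i Fin.≟ j
        ... | yes i≡j = i≡j
        ... | no i≢j  = ⊥-elim (1≢0 (trans (sym (cong 𝟙 e)) (trans (sym diagonal) (δ-≢ i≢j))))
          where
          1≢0 : 1ℤ ≢ 0ℤ
          1≢0 ()
          diagonal : δ i j ≡ 𝟙 (not (adj i j))
          diagonal = sum-mono-≡ {n} {δ i} {λ j → 𝟙 (not (adj i j))} (δ≤ i) (trans (sum-δ i) (non-degree≡1 i)) j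

      open Blocks blocks using (R; #R; #¬R)

      result : Blocks (λ i j → not (adj i j)) v p q
      result = record
        { β-refl  = λ i → cong not (adj-irrefl i)
        ; β-sym   = λ i j → cong not (adj-sym i j)
        ; β-trans = λ {i} {j} {k} ij jk → subst (λ l → not (adj l k) ≡ true) (sym (non-adjacent⇒≡ i j ij)) jk
        -- All classes have size 1 = q, so any marking with the right counts serves; that of the
        -- given blocks is reused.
        ; R       = R
        ; size≡   = λ i → trans (sym (non-degree≡1 i)) (both (R i))
        ; #R      = #R
        ; #¬R     = #¬R
        }
        where
        both : ∀ r → 1ℤ ≡ (if r then q else 1ℤ)
        both true  = sym q≡1
        both false = refl

-- The multicone as a complete multipartite graph

module PrimePowerMulticones where

  open import Data.Integer.Base using (ℤ; +_; _+_; _*_; 0ℤ; 1ℤ)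
  open Determinants
  open MatrixPolynomials
  open Partitions
  open BlockSpectra

  open ≡-Reasoning

  sum-split : ∀ m {n} (f : Fin (m ℕ.+ n) → ℤ) → sum f ≡ sum (λ i → f (i ↑ˡ n)) + sum (λ i → f (m ↑ʳ i))
  sum-split zero    f = sym (ℤ.+-identityˡ (sum f))
  sum-split (suc m) {n} f = trans (cong (λ z → f zero + z) (sum-split m (f ∘ suc)))
    (sym (ℤ.+-assoc (f zero) (sum (λ i → f (suc (i ↑ˡ n)))) (sum (λ i → f (suc (m ↑ʳ i))))))

  sum-ones : ∀ n → sum {n} (λ _ → 1ℤ) ≡ + n
  sum-ones zero    = refl
  sum-ones (suc n) = cong (λ z → 1ℤ + z) (sum-ones n)

  does-⇔ : ∀ {A B : Set} (d : Dec A) (e : Dec B) → (A → B) → (B → A) → does d ≡ does e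
  does-⇔ (yes a) e f g = sym (dec-true e (f a))
  does-⇔ (no ¬a) e f g = sym (dec-false e (¬a ∘ g))

  sum-residues : ∀ p .{{_ : NonZero p}} k {n} → n ≡ k ℕ.* p → ∀ (f : ℕ → ℤ) →
    sum {n} (λ i → f (toℕ i % p)) ≡ + k * sum {p} (λ i → f (toℕ i))
  sum-residues p zero    refl f = sym (ℤ.*-zeroˡ (sum {p} λ i → f (toℕ i)))
  sum-residues p (suc k) refl f = begin
    sum {p ℕ.+ k ℕ.* p} (λ i → f (toℕ i % p))
      ≡⟨ sum-split p {k ℕ.* p} (λ i → f (toℕ i % p)) ⟩
    sum {p} (λ i → f (toℕ (i ↑ˡ (k ℕ.* p)) % p)) + sum {k ℕ.* p} (λ i → f (toℕ (p ↑ʳ i) % p))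
      ≡⟨ cong₂ _+_ (sum-cong-≗ {p} low) (trans (sum-cong-≗ {k ℕ.* p} high) (sum-residues p k {k ℕ.* p} refl f)) ⟩
    S + + k * S
      ≡⟨ cong (_+ + k * S) (sym (ℤ.*-identityˡ S)) ⟩
    1ℤ * S + + k * S
      ≡⟨ sym (ℤ.*-distribʳ-+ S 1ℤ (+ k)) ⟩
    + suc k * S ∎
    where
    S : ℤ
    S = sum {p} λ i → f (toℕ i)
    low : ∀ (i : Fin p) → f (toℕ (i ↑ˡ (k ℕ.* p)) % p) ≡ f (toℕ i)
    low i = cong f (trans (cong (_% p) (Fin.toℕ-↑ˡ i (k ℕ.* p))) (m<n⇒m%n≡m (Fin.toℕ<n i)))
    high : ∀ (i : Fin (k ℕ.* p)) → f (toℕ (p ↑ʳ i) % p) ≡ f (toℕ i % p)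
    high i = cong f (trans (cong (_% p) (trans (Fin.toℕ-↑ʳ p i) (ℕ.+-comm p (toℕ i)))) ([m+n]%n≡m%n (toℕ i) p))

  sum-single : ∀ {n} (x : Fin n) → sum (λ y → 𝟙 (does (x Fin.≟ y))) ≡ 1ℤ
  sum-single x = trans (sum-cong-≗ λ y → sym (ℤ.*-identityʳ (δ x y))) (⟨δ,⟩ x (λ _ → 1ℤ))

  count-residue : ∀ p .{{_ : NonZero p}} k {n} → n ≡ k ℕ.* p → ∀ (a : Fin n) →
    sum {n} (λ b → 𝟙 (does (toℕ a % p ℕ.≟ toℕ b % p))) ≡ + k
  count-residue p k n≡ a = trans (sum-residues p k n≡ (λ r → 𝟙 (does (toℕ a % p ℕ.≟ r)))) (trans (cong (+ k *_) one) (ℤ.*-identityʳ (+ k)))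
    where
    x : Fin p
    x = toℕ a mod p
    one : sum {p} (λ r → 𝟙 (does (toℕ a % p ℕ.≟ toℕ r))) ≡ 1ℤ
    one = trans (sum-cong-≗ λ r → cong 𝟙 (does-⇔ (toℕ a % p ℕ.≟ toℕ r) (x Fin.≟ r)
      (λ e → Fin.toℕ-injective (trans (Fin.toℕ-fromℕ< (m%n<n (toℕ a) p)) e))
      (λ e → trans (sym (Fin.toℕ-fromℕ< (m%n<n (toℕ a) p))) (cong toℕ e)))) (sum-single x)

  -- A divisor that p does not divide is coprime to p, so the factors p can be stripped off one by
  -- one.
  divides-prime-power : ∀ {p} → Prime p → ∀ m {g} → g ∣ p ℕ.^ m → ¬ p ∣ g → g ≡ 1
  divides-prime-power pp zero    g∣1 p∤g = ∣1⇒≡1 g∣1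
  divides-prime-power {p} pp (suc m) {g} g∣ p∤g = divides-prime-power pp m (coprime-divisor coprime g∣) p∤g
    where
    coprime : Coprime g p
    coprime (i∣g , i∣p) with prime⇒irreducible pp i∣p
    ... | inj₁ i≡1 = i≡1
    ... | inj₂ i≡p = ⊥-elim (p∤g (subst (_∣ g) i≡p i∣g))

  module _ {p} (pp : Prime p) (m : ℕ) where
    private
      n q : ℕ
      n = p ℕ.^ suc m
      q = p ℕ.^ m
      instance
        p≢0 : NonZero p
        p≢0 = prime⇒nonZero pp
        n≢0 : NonZero n
        n≢0 = primePower-nonZero (suc m) pp

      p∣n : p ∣ n
      p∣n = m∣m*n q

    -- The representative of x⁻¹ ∙ y in `ℤₙ` with the private group operations unfolded, so that
    -- adjacency in `Γ` reduces to a statement about it by computation.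
    difference : Fin n → Fin n → ℕ
    difference x y = toℕ ((toℕ ((n ℕ.∸ toℕ x) mod n) ℕ.+ toℕ y) mod n)

    private
      difference%p : ∀ x y → difference x y % p ≡ (n ℕ.∸ toℕ x ℕ.+ toℕ y) % p
      difference%p x y = begin
        difference x y % p                                       ≡⟨ cong (_% p) (Fin.toℕ-fromℕ< (m%n<n (toℕ ((n ℕ.∸ toℕ x) mod n) ℕ.+ toℕ y) n)) ⟩
        (toℕ ((n ℕ.∸ toℕ x) mod n) ℕ.+ toℕ y) % n % p            ≡⟨ m∣n⇒o%n%m≡o%m p n (toℕ ((n ℕ.∸ toℕ x) mod n) ℕ.+ toℕ y) p∣n ⟩
        (toℕ ((n ℕ.∸ toℕ x) mod n) ℕ.+ toℕ y) % p                ≡⟨ cong (λ z → (z ℕ.+ toℕ y) % p) (Fin.toℕ-fromℕ< (m%n<n (n ℕ.∸ toℕ x) n)) ⟩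
        ((n ℕ.∸ toℕ x) % n ℕ.+ toℕ y) % p                        ≡⟨ %-distribˡ-+ ((n ℕ.∸ toℕ x) % n) (toℕ y) p ⟩
        ((n ℕ.∸ toℕ x) % n % p ℕ.+ toℕ y % p) % p                ≡⟨ cong (λ z → (z ℕ.+ toℕ y % p) % p) (m∣n⇒o%n%m≡o%m p n (n ℕ.∸ toℕ x) p∣n) ⟩
        ((n ℕ.∸ toℕ x) % p ℕ.+ toℕ y % p) % p                    ≡⟨ sym (%-distribˡ-+ (n ℕ.∸ toℕ x) (toℕ y) p) ⟩
        (n ℕ.∸ toℕ x ℕ.+ toℕ y) % p                              ∎

      n%p≡0 : n % p ≡ 0
      n%p≡0 = n∣m⇒m%n≡0 n p p∣n

      cancelled : ∀ x → n ℕ.∸ toℕ x ℕ.+ toℕ x ≡ n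
      cancelled x = ℕ.m∸n+n≡m (ℕ.<⇒≤ (Fin.toℕ<n x))

    divisible⇒congruent : ∀ x y → p ∣ difference x y → toℕ x % p ≡ toℕ y % p
    divisible⇒congruent x y p∣ = sym (begin
      toℕ y % p                                                  ≡⟨ sym (m%n%n≡m%n (toℕ y) p) ⟩
      (0 ℕ.+ toℕ y % p) % p                                      ≡⟨ cong (λ z → (z ℕ.+ toℕ y % p) % p) (sym n%p≡0) ⟩
      (n % p ℕ.+ toℕ y % p) % p                                  ≡⟨ sym (%-distribˡ-+ n (toℕ y) p) ⟩
      (n ℕ.+ toℕ y) % p                                          ≡⟨ cong (λ z → (z ℕ.+ toℕ y) % p) (sym (cancelled x)) ⟩
      (n ℕ.∸ toℕ x ℕ.+ toℕ x ℕ.+ toℕ y) % p                      ≡⟨ cong (_% p) (trans (ℕ.+-assoc (n ℕ.∸ toℕ x) (toℕ x) (toℕ y))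
                                                                     (trans (cong (n ℕ.∸ toℕ x ℕ.+_) (ℕ.+-comm (toℕ x) (toℕ y))) (sym (ℕ.+-assoc (n ℕ.∸ toℕ x) (toℕ y) (toℕ x))))) ⟩
      (n ℕ.∸ toℕ x ℕ.+ toℕ y ℕ.+ toℕ x) % p                      ≡⟨ %-distribˡ-+ (n ℕ.∸ toℕ x ℕ.+ toℕ y) (toℕ x) p ⟩
      ((n ℕ.∸ toℕ x ℕ.+ toℕ y) % p ℕ.+ toℕ x % p) % p            ≡⟨ cong (λ z → (z ℕ.+ toℕ x % p) % p) (trans (sym (difference%p x y)) (n∣m⇒m%n≡0 (difference x y) p p∣)) ⟩
      (0 ℕ.+ toℕ x % p) % p                                      ≡⟨ m%n%n≡m%n (toℕ x) p ⟩
      toℕ x % p                                                  ∎)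

    congruent⇒divisible : ∀ x y → toℕ x % p ≡ toℕ y % p → p ∣ difference x y
    congruent⇒divisible x y eq = m%n≡0⇒n∣m (difference x y) p (begin
      difference x y % p                         ≡⟨ difference%p x y ⟩
      (n ℕ.∸ toℕ x ℕ.+ toℕ y) % p                ≡⟨ %-distribˡ-+ (n ℕ.∸ toℕ x) (toℕ y) p ⟩
      ((n ℕ.∸ toℕ x) % p ℕ.+ toℕ y % p) % p      ≡⟨ cong (λ z → ((n ℕ.∸ toℕ x) % p ℕ.+ z) % p) (sym eq) ⟩
      ((n ℕ.∸ toℕ x) % p ℕ.+ toℕ x % p) % p      ≡⟨ sym (%-distribˡ-+ (n ℕ.∸ toℕ x) (toℕ x) p) ⟩
      (n ℕ.∸ toℕ x ℕ.+ toℕ x) % p                ≡⟨ cong (_% p) (cancelled x) ⟩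
      n % p                                      ≡⟨ n%p≡0 ⟩
      0                                          ∎)

    -- The gcd with a power of p is 1 exactly when p does not divide the difference. The parts of
    -- `Γ` are therefore the residue classes modulo p.
    unit⇔incongruent : ∀ x y → does (gcd (difference x y) n ℕ.≟ 1) ≡ not (does (toℕ x % p ℕ.≟ toℕ y % p))
    unit⇔incongruent x y = case (toℕ x % p ℕ.≟ toℕ y % p)
      where
      case : (e : Dec (toℕ x % p ≡ toℕ y % p)) → does (gcd (difference x y) n ℕ.≟ 1) ≡ not (does e)
      case (yes eq) = dec-false (gcd (difference x y) n ℕ.≟ 1) λ g≡1 →
        ℕ.nonTrivial⇒≢1 {{prime⇒nonTrivial pp}} (∣1⇒≡1 (subst (p ∣_) g≡1 (gcd-greatest (congruent⇒divisible x y eq) p∣n)))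
      case (no neq) = dec-true (gcd (difference x y) n ℕ.≟ 1)
        (divides-prime-power pp (suc m) (gcd[m,n]∣n (difference x y) n)
          λ p∣g → neq (divisible⇒congruent x y (∣-trans p∣g (gcd[m,n]∣m (difference x y) n))))

    module _ (v : ℕ) where

      βᶜ : Fin v ⊎ Fin n → Fin v ⊎ Fin n → Bool
      βᶜ (inj₁ x) (inj₁ y) = does (x Fin.≟ y)
      βᶜ (inj₁ x) (inj₂ b) = false
      βᶜ (inj₂ a) (inj₁ y) = false
      βᶜ (inj₂ a) (inj₂ b) = does (toℕ a % p ℕ.≟ toℕ b % p)

      β : Fin (v ℕ.+ n) → Fin (v ℕ.+ n) → Bool
      β i j = βᶜ (splitAt v i) (splitAt v j)

      private
        Rᶜ : Fin v ⊎ Fin n → Bool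
        Rᶜ (inj₁ _) = false
        Rᶜ (inj₂ _) = true

        βᶜ-refl : ∀ x → βᶜ x x ≡ true
        βᶜ-refl (inj₁ x) = dec-true (x Fin.≟ x) refl
        βᶜ-refl (inj₂ a) = dec-true (toℕ a % p ℕ.≟ toℕ a % p) refl

        βᶜ-sym : ∀ x y → βᶜ x y ≡ βᶜ y x
        βᶜ-sym (inj₁ x) (inj₁ y) = does-⇔ (x Fin.≟ y) (y Fin.≟ x) sym sym
        βᶜ-sym (inj₁ x) (inj₂ b) = refl
        βᶜ-sym (inj₂ a) (inj₁ y) = refl
        βᶜ-sym (inj₂ a) (inj₂ b) = does-⇔ (toℕ a % p ℕ.≟ toℕ b % p) (toℕ b % p ℕ.≟ toℕ a % p) sym sym

        βᶜ-trans : ∀ x y z → βᶜ x y ≡ true → βᶜ y z ≡ true → βᶜ x z ≡ true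
        βᶜ-trans (inj₁ x) (inj₁ y) (inj₁ z) xy yz =
          dec-true (x Fin.≟ z) (trans (does-true (x Fin.≟ y) xy) (does-true (y Fin.≟ z) yz))
        βᶜ-trans (inj₂ a) (inj₂ b) (inj₂ c) ab bc =
          dec-true (toℕ a % p ℕ.≟ toℕ c % p) (trans (does-true (toℕ a % p ℕ.≟ toℕ b % p) ab) (does-true (toℕ b % p ℕ.≟ toℕ c % p) bc))

        sum-⊎ : ∀ (f : Fin v ⊎ Fin n → ℤ) → sum (λ i → f (splitAt v i)) ≡ sum (λ x → f (inj₁ x)) + sum (λ a → f (inj₂ a))
        sum-⊎ f = trans (sum-split v (λ i → f (splitAt v i))) (cong₂ _+_
          (sum-cong-≗ λ x → cong f (Fin.splitAt-↑ˡ v x n)) (sum-cong-≗ λ a → cong f (Fin.splitAt-↑ʳ v n a)))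

        sizeᶜ : ∀ x → sum (λ j → 𝟙 (βᶜ x (splitAt v j))) ≡ (if Rᶜ x then + q else 1ℤ)
        sizeᶜ (inj₁ x) = trans (sum-⊎ (λ y → 𝟙 (βᶜ (inj₁ x) y))) (cong₂ _+_ (sum-single x) (sum-zero {n} {λ _ → 0ℤ} λ _ → refl))
        sizeᶜ (inj₂ a) = trans (sum-⊎ (λ y → 𝟙 (βᶜ (inj₂ a) y))) (trans (cong₂ _+_ (sum-zero {v} {λ _ → 0ℤ} λ _ → refl) (count-residue p q (ℕ.*-comm p q) a))
          (ℤ.+-identityˡ (+ q)))

      primePower-blocks : Blocks β (+ v) (+ p) (+ q)
      primePower-blocks = record
        { β-refl  = λ i → βᶜ-refl (splitAt v i)
        ; β-sym   = λ i j → βᶜ-sym (splitAt v i) (splitAt v j)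
        ; β-trans = λ {i} {j} {k} → βᶜ-trans (splitAt v i) (splitAt v j) (splitAt v k)
        ; R       = λ i → Rᶜ (splitAt v i)
        ; size≡   = λ i → sizeᶜ (splitAt v i)
        ; #R      = trans (sum-⊎ (λ x → 𝟙 (Rᶜ x))) (trans (cong₂ _+_ (sum-zero {v} {λ _ → 0ℤ} λ _ → refl) (sum-ones n)) (trans (ℤ.+-identityˡ (+ n)) (ℤ.pos-* p q)))
        ; #¬R     = trans (sum-⊎ (λ x → 𝟙 (not (Rᶜ x)))) (trans (cong₂ _+_ (sum-ones v) (sum-zero {n} {λ _ → 0ℤ} λ _ → refl)) (ℤ.+-identityʳ (+ v)))
        }

      multicone-adjacency : ∀ (1≤ : 1 ℕ.≤ suc m) → let open Graph (K v ▽ Γ p (suc m) pp 1≤) in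
        ∀ i j → does (Inverse.to enum i ~? Inverse.to enum j) ≡ not (β i j)
      multicone-adjacency 1≤ i j with splitAt v i | splitAt v j
      ... | inj₁ x | inj₁ y = refl
      ... | inj₁ x | inj₂ b = refl
      ... | inj₂ a | inj₁ y = refl
      ... | inj₂ a | inj₂ b = unit⇔incongruent a b

-- From cospectrality to an isomorphism

module Conclusion where

  open import Data.Integer.Base using (+_; +<+)
  open Determinants
  open IntegerSpectra
  open Partitions
  open BlockSpectra
  open Reconstruction
  open PrimePowerMulticones
  open BlockIsomorphism

  adjacent : ∀ G → Fin (Graph.order G) → Fin (Graph.order G) → Bool
  adjacent G i j = does (Graph._~?_ G (Inverse.to (Graph.enum G) i) (Inverse.to (Graph.enum G) j))

  adjacent-sym : ∀ G i j → adjacent G i j ≡ adjacent G j i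
  adjacent-sym G i j = does-⇔ (_ ~? _) (_ ~? _) ~-sym ~-sym
    where open Graph G

  adjacent-irrefl : ∀ G i → adjacent G i i ≡ false
  adjacent-irrefl G i = dec-false (_ ~? _) ~-irrefl
    where open Graph G

  isomorphism : ∀ {n} H G (eH : Fin n ↔ Graph.Vertex H) (eG : Fin n ↔ Graph.Vertex G) (φ : Fin n ↔ Fin n) →
    (∀ i j → does (Graph._~?_ H (Inverse.to eH i) (Inverse.to eH j)) ≡
             does (Graph._~?_ G (Inverse.to eG (Inverse.to φ i)) (Inverse.to eG (Inverse.to φ j)))) → H ≅ G
  isomorphism {n} H G eH eG φ same = f , λ x y → mk⇔ (forth x y) (back x y)
    where
    module H = Graph H
    module G = Graph G
    module eH = Inverse eH
    f : H.Vertex ↔ G.Vertex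
    f = eG ↔-∘ (φ ↔-∘ ↔-sym eH)
    index : ∀ x → eH.to (eH.from x) ≡ x
    index = eH.strictlyInverseˡ
    decided : ∀ x y → does (x H.~? y) ≡ does (Inverse.to f x G.~? Inverse.to f y)
    decided x y = trans (sym (cong₂ (λ x y → does (x H.~? y)) (index x) (index y))) (same (eH.from x) (eH.from y))
    forth : ∀ x y → x H.~ y → Inverse.to f x G.~ Inverse.to f y
    forth x y x~y = does-true (Inverse.to f x G.~? Inverse.to f y) (trans (sym (decided x y)) (dec-true (x H.~? y) x~y))
    back : ∀ x y → Inverse.to f x G.~ Inverse.to f y → x H.~ y
    back x y fx~fy = does-true (x H.~? y) (trans (decided x y) (dec-true (Inverse.to f x G.~? Inverse.to f y) fx~fy))

  -- The two sizes are separate variables so that their equality can be matched with `refl`, which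
  -- is impossible for the orders of two given graphs.
  same-charPoly⇒powerTrace : ∀ {n m} → n ≡ m → (A : Matrix n) (A′ : Matrix m) →
    (∀ i j → A i j ≡ A j i) → (∀ i j → A′ i j ≡ A′ j i) → (B : Defs.Matrix n) (B′ : Defs.Matrix m) →
    (∀ i j → B i j ≈ℝ ℤ→ℝ (A i j)) → (∀ i j → B′ i j ≈ℝ ℤ→ℝ (A′ i j)) →
    (∀ x → charPoly B x ≈ℝ charPoly B′ x) → ∀ k → powerTrace A k ≡ powerTrace A′ k
  same-charPoly⇒powerTrace refl A A′ A-sym A′-sym B B′ B≈ B′≈ same =
    powerTrace-equal A A′ A-sym A′-sym (same-charPoly⇒same-reversed A A′ B B′ B≈ B′≈ same)

  cospectral⇒powerTrace : ∀ H G → Cospectral H G → ∀ k → powerTrace (adjacency H) k ≡ powerTrace (adjacency G) k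
  cospectral⇒powerTrace H G cospectral = same-charPoly⇒powerTrace (cospectral⇒order {H} {G} cospectral)
    (adjacency H) (adjacency G) (λ i j → cong 𝟙 (adjacent-sym H i j)) (λ i j → cong 𝟙 (adjacent-sym G i j))
    (Graph.adjacencyMatrix H) (Graph.adjacencyMatrix G) (adjacency-ℝ H) (adjacency-ℝ G) (cospectral⇒charPoly {H} {G} cospectral)

  module _ {p} (pp : Prime p) (m v : ℕ) (1≤m : 1 ℕ.≤ suc m) (1≤v : 1 ℕ.≤ v) where
    private
      G : Graph
      G = K v ▽ Γ p (suc m) pp 1≤m

      q : ℕ
      q = p ℕ.^ m

      β° : Fin (Graph.order G) → Fin (Graph.order G) → Bool
      β° = β pp m v

    same-traces⇒blocks : (adj : Fin (Graph.order G) → Fin (Graph.order G) → Bool) →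
      (∀ i j → adj i j ≡ adj j i) → (∀ i → adj i i ≡ false) →
      (∀ k → powerTrace (λ i j → 𝟙 (adj i j)) k ≡ powerTrace (adjacency G) k) →
      Blocks (λ i j → not (adj i j)) (+ v) (+ p) (+ q)
    same-traces⇒blocks adj adj-sym adj-irrefl same = case (q ℕ.≟ 1)
      where
      module D = Determined adj adj-sym adj-irrefl (λ i j → 𝟙 (adj i j)) (λ i j → refl) (λ i j → cong 𝟙 (adj-sym i j))
        β° (+ v) (+ p) (+ q) (primePower-blocks pp m v) (+<+ 1≤v) (+<+ (ℕ.nonTrivial⇒n>1 p {{prime⇒nonTrivial pp}}))
        (adjacency G) (λ i j → cong 𝟙 (adjacent-sym G i j))
        (λ i j → trans (cong 𝟙 (multicone-adjacency pp m v 1≤m i j)) (𝟙-not (β° i j)))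
        same
      case : Dec (q ≡ 1) → Blocks (λ i j → not (adj i j)) (+ v) (+ p) (+ q)
      case (yes q≡1) = D.Complete.result (cong +_ q≡1)
      case (no q≢1)  = D.LargeParts.result (+<+ (ℕ.≤∧≢⇒< (ℕ.>-nonZero⁻¹ q {{ℕ.m^n≢0 p m {{prime⇒nonZero pp}}}}) λ 1≡q → q≢1 (sym 1≡q)))

    determined : ∀ H → (∀ k → powerTrace (adjacency H) k ≡ powerTrace (adjacency G) k) → Graph.order H ≡ Graph.order G → H ≅ G
    -- Opening the record turns the order of H into a variable, which `refl` then identifies with
    -- the order of G.
    determined H@(record { order = _ }) same refl =
      isomorphism H G (Graph.enum H) (Graph.enum G) φ λ i j → trans
        (sym (Bool.not-involutive (adjacent H i j)))
        (trans (cong not (φ-preserves i j)) (sym (multicone-adjacency pp m v 1≤m (Inverse.to φ i) (Inverse.to φ j))))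
      where
      blocks : Blocks (λ i j → not (adjacent H i j)) (+ v) (+ p) (+ q)
      blocks = same-traces⇒blocks (adjacent H) (adjacent-sym H) (adjacent-irrefl H) same
      φ : Fin (Graph.order G) ↔ Fin (Graph.order G)
      φ = proj₁ (blocks-isomorphic blocks (primePower-blocks pp m v))
      φ-preserves : ∀ i j → not (adjacent H i j) ≡ β° (Inverse.to φ i) (Inverse.to φ j)
      φ-preserves = proj₂ (blocks-isomorphic blocks (primePower-blocks pp m v))

open import Data.Nat.Base using (_≤_)
open IntegerSpectra using (cospectral⇒order)
open Conclusion using (determined; cospectral⇒powerTrace)

theorem3p3 : (p m v : ℕ) (p-prime : Prime p) (1≤m : 1 ≤ m) → 1 ≤ v → DS (K v ▽ Γ p m p-prime 1≤m)
theorem3p3 p (suc m) v p-prime 1≤m 1≤v H cospectral =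
  determined p-prime m v 1≤m 1≤v H (cospectral⇒powerTrace H (K v ▽ Γ p (suc m) p-prime 1≤m) cospectral)
    (cospectral⇒order {H} {K v ▽ Γ p (suc m) p-prime 1≤m} cospectral)
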